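{- The path-checking problem for Unary Temporal Logic $\mathrm{UTL}$ (given a finite trace $\pi$ and a $\mathrm{UTL}$ formula $\varphi$, decide whether $\pi,1\models\varphi$) is in $\mathsf{AC}^1$.
   Context: Let $\mathrm{AP}$ be a set of atomic propositions. A trace of length $n$ is a function $\pi:\{1,\dots,n\}\times\mathrm{AP}\to\{\bot,\top\}$; write $p(i)=\top$ iff $\pi(i,p)=\top$. $\mathrm{UTL}$ formulae are built from atomic propositions and their negations using $\wedge$, $\vee$ and the unary temporal operators $\mathbf{X}$ (next), $\mathbf{F}$ (eventually), $\mathbf{G}$ (always) and their past duals $\mathbf{Y}$ (yesterday), $\mathbf{P}$ (once) and $\mathbf{H}$ (historically). Semantics at $1\le i\le n$: $\pi,i\models p$ iff $p(i)=\top$; Boolean connectives as usual; $\pi,i\models\mathbf{X}\varphi$ iff $i<n$ and $\pi,i+1\models\varphi$; $\pi,i\models\mathbf{Y}\varphi$ iff $i>1$ and $\pi,i-1\models\varphi$; $\pi,i\models\mathbf{F}\varphi$ iff $\pi,j\models\varphi$ for some $i\le j\le n$; $\pi,i\models\mathbf{G}\varphi$ iff $\pi,j\models\varphi$ for all $i\le j\le n$; $\pi,i\models\mathbf{P}\varphi$ iff $\pi,j\models\varphi$ for some $1\le j\le i$; $\pi,i\models\mathbf{H}\varphi$ iff $\pi,j\models\varphi$ for all $1\le j\le i$. $\mathsf{AC}^1$ is the class of problems decided by logspace-uniform families of polynomial-size, $O(\log n)$-depth circuits with unbounded fan-in AND/OR/NOT gates. -}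

module Defs where

open import Data.Bool using (Bool; true; false; not; _∧_; _∨_)
open import Data.Nat using (ℕ; zero; suc; _+_; _*_; _∸_; _^_; _≤_; _<_; _⊔_)
open import Data.Nat.Logarithm using (⌈log₂_⌉)
open import Data.Nat.Binary.Base using (ℕᵇ; 2[1+_]; 1+[2_]) renaming (zero to zeroᵇ; fromℕ to toBin)
open import Data.Fin using (Fin; toℕ)
open import Data.Vec using (Vec; []; _∷_; toList)
open import Data.List using (List; []; _∷_; _++_; [_]; replicate; concat; map; length; foldr; foldl)
open import Data.Maybe using (Maybe; just; nothing)
open import Data.Product using (Σ; _×_; _,_; ∃)
open import Relation.Binary.PropositionalEquality using (_≡_)
open import Function.Bundles using (_⇔_)

data Formula (k : ℕ) : Set where
  atom  : Fin k → Formula k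
  natom : Fin k → Formula k
  _∧ᶠ_  : Formula k → Formula k → Formula k
  _∨ᶠ_  : Formula k → Formula k → Formula k
  X F G Y P H : Formula k → Formula k

-- A trace of length len: row i-1 of the vector is position i (1-based),
-- entry p of a row is π(i,p).
Trace : ℕ → ℕ → Set
Trace k len = Vec (Vec Bool k) len

-- value of π(i,p) for 1 ≤ i ≤ len (positions outside are never queried)
val : ∀ {k len} → Trace k len → ℕ → Fin k → Bool
val []       _             p = false
val (r ∷ rs) zero          p = false
val (r ∷ rs) (suc zero)    p = Data.Vec.lookup r p
val (r ∷ rs) (suc (suc i)) p = val rs (suc i) p

Sat : ∀ {k len} → Trace k len → ℕ → Formula k → Set
Sat {len = n} π i (atom p)  = val π i p ≡ true
Sat {len = n} π i (natom p) = val π i p ≡ false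
Sat {len = n} π i (φ ∧ᶠ ψ)  = Sat π i φ × Sat π i ψ
Sat {len = n} π i (φ ∨ᶠ ψ)  = Data.Sum._⊎_ (Sat π i φ) (Sat π i ψ)
  where import Data.Sum
Sat {len = n} π i (X φ) = i < n × Sat π (suc i) φ
Sat {len = n} π i (Y φ) = 1 < i × Sat π (i ∸ 1) φ
Sat {len = n} π i (F φ) = ∃ λ j → i ≤ j × j ≤ n × Sat π j φ
Sat {len = n} π i (G φ) = ∀ j → i ≤ j → j ≤ n → Sat π j φ
Sat {len = n} π i (P φ) = ∃ λ j → 1 ≤ j × j ≤ i × Sat π j φ
Sat {len = n} π i (H φ) = ∀ j → 1 ≤ j → j ≤ i → Sat π j φ

data Sym : Set where
  s0 s1 sRow sMid sAtom sNAtom sAnd sOr sX sF sG sY sP sH sEnd : Sym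

symBits : Sym → List Bool
symBits s0     = false ∷ false ∷ false ∷ false ∷ []
symBits s1     = false ∷ false ∷ false ∷ true  ∷ []
symBits sRow   = false ∷ false ∷ true  ∷ false ∷ []
symBits sMid   = false ∷ false ∷ true  ∷ true  ∷ []
symBits sAtom  = false ∷ true  ∷ false ∷ false ∷ []
symBits sNAtom = false ∷ true  ∷ false ∷ true  ∷ []
symBits sAnd   = false ∷ true  ∷ true  ∷ false ∷ []
symBits sOr    = false ∷ true  ∷ true  ∷ true  ∷ []
symBits sX     = true  ∷ false ∷ false ∷ false ∷ []
symBits sF     = true  ∷ false ∷ false ∷ true  ∷ []
symBits sG     = true  ∷ false ∷ true  ∷ false ∷ []
symBits sY     = true  ∷ false ∷ true  ∷ true  ∷ []
symBits sP     = true  ∷ true  ∷ false ∷ false ∷ []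
symBits sH     = true  ∷ true  ∷ false ∷ true  ∷ []
symBits sEnd   = true  ∷ true  ∷ true  ∷ false ∷ []

bitSym : Bool → Sym
bitSym false = s0
bitSym true  = s1

encFormula : ∀ {k} → Formula k → List Sym
encFormula (atom p)  = sAtom  ∷ replicate (toℕ p) s1 ++ [ sEnd ]
encFormula (natom p) = sNAtom ∷ replicate (toℕ p) s1 ++ [ sEnd ]
encFormula (φ ∧ᶠ ψ)  = sAnd ∷ encFormula φ ++ encFormula ψ
encFormula (φ ∨ᶠ ψ)  = sOr  ∷ encFormula φ ++ encFormula ψ
encFormula (X φ) = sX ∷ encFormula φ
encFormula (F φ) = sF ∷ encFormula φ
encFormula (G φ) = sG ∷ encFormula φ
encFormula (Y φ) = sY ∷ encFormula φ
encFormula (P φ) = sP ∷ encFormula φ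
encFormula (H φ) = sH ∷ encFormula φ

encTrace : ∀ {k len} → Trace k len → List Sym
encTrace []       = []
encTrace (r ∷ rs) = map bitSym (toList r) ++ sRow ∷ encTrace rs

encInstance : ∀ {k len} → Trace k len → Formula k → List Bool
encInstance π φ = concat (map symBits (encTrace π ++ sMid ∷ encFormula φ))

UTL-PathChecking : List Bool → Set
UTL-PathChecking w =
  Σ ℕ λ k → Σ ℕ λ m → Σ (Trace k (suc m)) λ π → Σ (Formula k) λ φ →
    encInstance π φ ≡ w × Sat π 1 φ

-- A circuit is a list of gates in topological order; gate number j may only
-- refer to gates with number < j. The last gate is the output gate.
data Gate : Set where
  inp  : ℕ → Gate          -- i-th input bit (0-based)
  andg : List ℕ → Gate
  org  : List ℕ → Gate
  notg : ℕ → Gate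

Circuit : Set
Circuit = List Gate

lookupD : ∀ {A : Set} → A → List A → ℕ → A
lookupD d []       _       = d
lookupD d (x ∷ xs) zero    = x
lookupD d (x ∷ xs) (suc i) = lookupD d xs i

allL : List Bool → Bool
allL = foldr _∧_ true

anyL : List Bool → Bool
anyL = foldr _∨_ false

evalGate : List Bool → List Bool → Gate → Bool
evalGate w vs (inp i)   = lookupD false w i
evalGate w vs (andg js) = allL (map (lookupD false vs) js)
evalGate w vs (org js)  = anyL (map (lookupD false vs) js)
evalGate w vs (notg j)  = not (lookupD false vs j)

gateValues : List Bool → Circuit → List Bool
gateValues w = foldl (λ vs g → vs ++ [ evalGate w vs g ]) []

lastD : ∀ {A : Set} → A → List A → A
lastD d []       = d
lastD d (x ∷ xs) = lastD x xs

evalCircuit : Circuit → List Bool → Bool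
evalCircuit c w = lastD false (gateValues w c)

GateWF : ℕ → ℕ → Gate → Set
GateWF n j (inp i)   = i < n
GateWF n j (andg js) = Data.List.Relation.Unary.All.All (λ j' → j' < j) js
  where import Data.List.Relation.Unary.All
GateWF n j (org js)  = Data.List.Relation.Unary.All.All (λ j' → j' < j) js
  where import Data.List.Relation.Unary.All
GateWF n j (notg j') = j' < j

GatesWF : ℕ → ℕ → Circuit → Set
GatesWF n j []       = Data.Unit.⊤  where import Data.Unit
GatesWF n j (g ∷ gs) = GateWF n j g × GatesWF n (suc j) gs

WellFormed : ℕ → Circuit → Set
WellFormed n c = 1 ≤ length c × GatesWF n 0 c

size : Circuit → ℕ
size = length

maxL : List ℕ → ℕ
maxL = foldr _⊔_ 0

gateDepth : List ℕ → Gate → ℕ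
gateDepth ds (inp i)   = 0
gateDepth ds (andg js) = suc (maxL (map (lookupD 0 ds) js))
gateDepth ds (org js)  = suc (maxL (map (lookupD 0 ds) js))
gateDepth ds (notg j)  = suc (lookupD 0 ds j)

gateDepths : Circuit → List ℕ
gateDepths = foldl (λ ds g → ds ++ [ gateDepth ds g ]) []

depth : Circuit → ℕ
depth c = maxL (gateDepths c)

data CSym : Set where
  c0 c1 cSep cIn cAnd cOr cNot cEnd : CSym

csymBits : CSym → List Bool
csymBits c0   = false ∷ false ∷ false ∷ []
csymBits c1   = false ∷ false ∷ true  ∷ []
csymBits cSep = false ∷ true  ∷ false ∷ []
csymBits cIn  = false ∷ true  ∷ true  ∷ []
csymBits cAnd = true  ∷ false ∷ false ∷ []
csymBits cOr  = true  ∷ false ∷ true  ∷ []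
csymBits cNot = true  ∷ true  ∷ false ∷ []
csymBits cEnd = true  ∷ true  ∷ true  ∷ []

-- numbers in bijective base 2 (digits 1,2 written c0,c1), least significant first
encBin : ℕᵇ → List CSym
encBin zeroᵇ     = []
encBin 1+[2 x ]  = c0 ∷ encBin x
encBin 2[1+ x ]  = c1 ∷ encBin x

encNat : ℕ → List CSym
encNat n = encBin (toBin n)

encGate : Gate → List CSym
encGate (inp i)   = cIn ∷ encNat i ++ [ cEnd ]
encGate (andg js) = cAnd ∷ concat (map (λ j → encNat j ++ [ cSep ]) js) ++ [ cEnd ]
encGate (org js)  = cOr  ∷ concat (map (λ j → encNat j ++ [ cSep ]) js) ++ [ cEnd ]
encGate (notg j)  = cNot ∷ encNat j ++ [ cEnd ]

encCircuit : Circuit → List Bool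
encCircuit c = concat (map csymBits (concat (map encGate c)))

-- Deterministic Turing transducers: read-only input tape with end-markers,
-- one binary work tape (with blank), write-only one-way output tape.

data Move : Set where
  left stay right : Move

move : Move → ℕ → ℕ
move left  zero    = zero
move left  (suc i) = i
move stay  i       = i
move right i       = suc i

record Transducer : Set where
  field
    Q     : ℕ
    start : Fin Q
    halts : Fin Q → Bool
    -- (state, input symbol (nothing = end-marker), work symbol (nothing = blank))
    --   ↦ (new state, input move, written work symbol, work move, output bit)
    δ     : Fin Q → Maybe Bool → Maybe Bool →
            Fin Q × Move × Maybe Bool × Move × Maybe Bool

record Config (Q : ℕ) : Set where
  constructor conf
  field
    state : Fin Q
    ipos  : ℕ                  -- 0 = left end-marker, 1..n = input, n+1 = right end-marker
    wtape : ℕ → Maybe Bool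
    wpos  : ℕ
    out   : List Bool

readInput : List Bool → ℕ → Maybe Bool
readInput w zero    = nothing
readInput w (suc i) = lookupD nothing (map just w) i

open import Data.Nat using (_≡ᵇ_)

update : (ℕ → Maybe Bool) → ℕ → Maybe Bool → ℕ → Maybe Bool
update t i s j with j ≡ᵇ i
... | true  = s
... | false = t j

emit : List Bool → Maybe Bool → List Bool
emit o nothing  = o
emit o (just b) = o ++ [ b ]

initConfig : (M : Transducer) → Config (Transducer.Q M)
initConfig M = conf (Transducer.start M) 0 (λ _ → nothing) 0 []

step : (M : Transducer) → List Bool → Config (Transducer.Q M) → Config (Transducer.Q M)
step M w c@(conf q i t p o) with Transducer.halts M q
... | true  = c
... | false with Transducer.δ M q (readInput w i) (t p)
...   | (q' , mi , s , mw , b) = conf q' (move mi i) (update t p s) (move mw p) (emit o b)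

run : (M : Transducer) → List Bool → ℕ → Config (Transducer.Q M)
run M w zero    = initConfig M
run M w (suc t) = step M w (run M w t)

ComputesWithin : (M : Transducer) → List Bool → List Bool → ℕ → Set
ComputesWithin M w y s =
  ∃ λ t → Transducer.halts M (Config.state (run M w t)) ≡ true
        × Config.out (run M w t) ≡ y
        × (∀ t' → t' ≤ t → Config.wpos (run M w t') ≤ s)

LogspaceComputable : (List Bool → List Bool) → Set
LogspaceComputable f =
  Σ Transducer λ M → Σ ℕ λ c →
    ∀ w → ComputesWithin M w (f w) (c * ⌈log₂ (length w) ⌉ + c)

LogspaceUniform : (ℕ → Circuit) → Set
LogspaceUniform C =
  Σ Transducer λ M → Σ ℕ λ c →
    ∀ n → ComputesWithin M (replicate n true) (encCircuit (C n)) (c * ⌈log₂ n ⌉ + c)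

PolySize : (ℕ → Circuit) → Set
PolySize C = Σ ℕ λ c → ∀ n → size (C n) ≤ c * n ^ c + c

LogDepth : (ℕ → Circuit) → Set
LogDepth C = Σ ℕ λ c → ∀ n → depth (C n) ≤ c * ⌈log₂ n ⌉ + c

Decides : (ℕ → Circuit) → (List Bool → Set) → Set
Decides C L = ∀ w → (evalCircuit (C (length w)) w ≡ true) ⇔ L w

InAC¹ : (List Bool → Set) → Set
InAC¹ L = Σ (ℕ → Circuit) λ C →
  LogspaceUniform C × (∀ n → WellFormed n (C n)) × PolySize C × LogDepth C × Decides C L

{-# OPTIONS --safe #-}
-- Truth of a formula is derived in a proof system whose judgements say that, if the formula written between two
-- places of the input is true on an interval of positions, then so is the formula between two other places. Since
-- the formulas are in negation normal form, only truth has to be derived. Derivations of height O(log n) suffice: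
-- a formula is cut in the middle of a path of large subformulas, as in Brent's and Spira's restructuring of
-- Boolean formulas. A cut needs an interval as interpolant. There is one at every F, G, P or H, whose value
-- vector is a prefix or a suffix of the trace; and between two such operators, where only X, Y, ∧ and ∨ occur,
-- truth at one position rests on truth of the hole at no more than one position.
--
-- Rules and judgements form an alternating graph on polynomially many nodes. Its unrolling has layers 0, …, s, and
-- layer i refers to layer ⌊i/2⌋, so that a polynomial s gives logarithmic depth without computing a logarithm.
--
-- Gates and wires of the circuit are given by formulas with bounded quantifiers. These compile to a machine which
-- keeps a fixed number of polynomially bounded registers, in bijective binary, on interleaved tracks of its tape.
module Submission where

open import Defs
open import Data.Bool using (Bool; true; false; not; _∧_; _∨_; if_then_else_; T)
open import Data.Bool.Properties using (∨-identityʳ)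
open import Data.Nat
open import Data.Nat.Properties
open import Data.Nat.DivMod using (_/_; _%_; m≡m%n+[m/n]*n; m%n<n; m<n⇒m%n≡m; [m+kn]%n≡m%n)
open import Data.Nat.Logarithm using (⌈log₂_⌉; ⌈log₂⌈n/2⌉⌉≡⌈log₂n⌉∸1; ⌈log₂⌉-mono-≤; ⌈log₂2^n⌉≡n)
open import Data.Nat.Induction using (<-rec)
import Data.Nat.Binary.Base as ℕᵇ
import Data.Nat.Binary.Properties as ℕᵇₚ
open import Data.Fin using (Fin; zero; suc; toℕ; fromℕ<; splitAt; _↑ˡ_; _↑ʳ_; #_)
open import Data.Fin.Properties using (splitAt-↑ˡ; splitAt-↑ʳ; toℕ-injective; toℕ<n; toℕ-fromℕ<)
open import Data.Vec as Vec using (Vec; []; _∷_; lookup)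
import Data.Vec.Properties as Vecₚ
import Data.Vec.Relation.Unary.All as VAll
open import Data.List using (List; []; _∷_; _++_; [_]; replicate; concat; map; length; foldl)
open import Data.List.Properties
open import Data.List.Relation.Unary.All as All using (All; []; _∷_)
import Data.List.Relation.Unary.All.Properties as Allₚ
open import Data.List.Relation.Unary.Any using (here; there)
open import Data.List.Membership.Propositional using (_∈_)
open import Data.Maybe as Maybe using (Maybe; just; nothing; maybe′)
open import Data.Product hiding (map)
open import Data.Sum as Sum using (_⊎_; inj₁; inj₂; [_,_]′)
open import Data.Empty using (⊥; ⊥-elim)
open import Data.Unit using (⊤; tt)
open import Relation.Nullary
open import Relation.Binary.PropositionalEquality hiding ([_])
open import Relation.Binary.Definitions using (tri<; tri≈; tri>)
open import Function using (_∘_; id; case_of_)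
open import Function.Bundles using (mk⇔)

-- Structured programs for Turing machines

-- Spira's method guesses the value of a subformula and evaluates the rest from it. Here such a
-- value is a set of positions. There are exponentially many of these sets, while a node of a
-- polynomial graph has only a fixed number of fields below `n + 21`. Every frame around a hole is
-- monotone in the hole, so it is enough to know some positions where the hole is true, and an
-- interval of them takes two fields. No parser comes before the derivations. An item with an empty
-- interval still claims that its symbols form a formula; the rules guess where the first argument
-- of a binary formula ends and check syntax together with truth. The height stays logarithmic
-- because a cut costs 2 beyond the larger of its premises. Three statements about sizes below
-- `2 ^ h` advance together: small formulas are derivable under any hypothesis, truth passes through
-- a local path, and full knowledge of a hole lifts along any path. Going from `h` to `suc h` adds
-- at most 28, the cost of lifting, and `exponent` stems from this number.

Action : Set
Action = Move × Maybe Bool × Move × Maybe Bool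

-- The next state `nothing` means that the machine is left after the action. An exit has no state of
-- its own, so sequencing sends it straight to the entry of the second machine.
record Machine : Set where
  no-eta-equality
  field
    states : ℕ
    entry  : Fin states
    δ      : Fin states → Maybe Bool → Maybe Bool → Maybe (Fin states) × Action
open Machine public

record Snapshot : Set where
  constructor snap
  field
    ipos : ℕ
    tape : ℕ → Maybe Bool
    pos  : ℕ
    outp : List Bool
open Snapshot public

perform : Action → Snapshot → Snapshot
perform (mi , s , mw , b) (snap i t p o) = snap (move mi i) (update t p s) (move mw p) (emit o b)

idle : Maybe Bool → Action
idle s = stay , s , stay , nothing

infix 4 _≋_
record _≋_ (σ τ : Snapshot) : Set where
  constructor mk≋
  field
    ipos≡ : ipos σ ≡ ipos τ
    tape≗ : tape σ ≗ tape τ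
    pos≡  : pos σ ≡ pos τ
    outp≡ : outp σ ≡ outp τ

≋-refl : ∀ {σ} → σ ≋ σ
≋-refl = mk≋ refl (λ _ → refl) refl refl

≋-trans : ∀ {σ τ υ} → σ ≋ τ → τ ≋ υ → σ ≋ υ
≋-trans (mk≋ a b c d) (mk≋ a' b' c' d') = mk≋ (trans a a') (λ j → trans (b j) (b' j)) (trans c c') (trans d d')

update-cong : ∀ {t t'} p s → t ≗ t' → update t p s ≗ update t' p s
update-cong p s e j with j ≡ᵇ p
... | true  = refl
... | false = e j

update-at : ∀ t p s → update t p s p ≡ s
update-at t p s with p ≡ᵇ p in eq
... | true  = refl
... | false = contradiction (≡⇒≡ᵇ p p refl) (subst (λ b → ¬ T b) (sym eq) id)

update-other : ∀ t p s {j} → j ≢ p → update t p s j ≡ t j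
update-other t p s {j} j≢p with j ≡ᵇ p in eq
... | true  = contradiction (≡ᵇ⇒≡ j p (subst T (sym eq) tt)) j≢p
... | false = refl

update-idle : ∀ t p → update t p (t p) ≗ t
update-idle t p j with j ≟ p
... | yes refl = update-at t p (t p)
... | no j≢p   = update-other t p (t p) j≢p

perform-cong : ∀ a {σ τ} → σ ≋ τ → perform a σ ≋ perform a τ
perform-cong (mi , s , mw , b) {σ} (mk≋ refl e refl refl) = mk≋ refl (update-cong (pos σ) s e) refl refl

perform-idle : ∀ σ → perform (idle (tape σ (pos σ))) σ ≋ σ
perform-idle σ = mk≋ refl (update-idle (tape σ) (pos σ)) refl refl

prim : (Maybe Bool → Maybe Bool → Action) → Machine
prim f = record { states = 1 ; entry = zero ; δ = λ _ i s → nothing , f i s }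

seqM : Machine → Machine → Machine
seqM A B = record
  { states = states A + states B
  ; entry  = entry A ↑ˡ states B
  ; δ      = λ q i s → [ (λ a → map₁ (λ r → just (maybe′ (_↑ˡ states B) (states A ↑ʳ entry B) r)) (δ A a i s))
                       , (λ b → map₁ (Maybe.map (states A ↑ʳ_)) (δ B b i s)) ]′ (splitAt (states A) q) }

Test : Set
Test = Maybe Bool → Maybe Bool → Bool

branchM : Test → Machine → Machine → Machine
branchM c A B = record
  { states = suc (states A + states B)
  ; entry  = zero
  ; δ      = λ { zero i s → just (suc (if c i s then entry A ↑ˡ states B else states A ↑ʳ entry B)) , idle s
               ; (suc q) i s → [ (λ a → map₁ (Maybe.map (suc ∘ (_↑ˡ states B))) (δ A a i s))
                               , (λ b → map₁ (Maybe.map (suc ∘ (states A ↑ʳ_))) (δ B b i s)) ]′ (splitAt (states A) q) } }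

whileM : Test → Machine → Machine
whileM c A = record
  { states = suc (states A)
  ; entry  = zero
  ; δ      = λ { zero i s → (if c i s then just (suc (entry A)) else nothing) , idle s
               ; (suc q) i s → map₁ (λ r → just (maybe′ suc zero r)) (δ A q i s) } }

infixr 5 _⨟_
opaque
  _⨟_ : Machine → Machine → Machine
  _⨟_ = seqM

  branch : Test → Machine → Machine → Machine
  branch = branchM

  while : Test → Machine → Machine
  while = whileM

module Semantics (w : List Bool) (S : ℕ) where

  input : Snapshot → Maybe Bool
  input σ = readInput w (ipos σ)

  scanned : Snapshot → Maybe Bool
  scanned σ = tape σ (pos σ)

  -- The bound `S` on head positions is part of a run, including the position after the last action,
  -- so that correctness and space are proved at once.
  data Run (M : Machine) : Fin (states M) → Snapshot → Snapshot → Set where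
    exit : ∀ {q σ a} → pos σ ≤ S → pos (perform a σ) ≤ S →
           δ M q (input σ) (scanned σ) ≡ (nothing , a) → Run M q σ (perform a σ)
    next : ∀ {q q' σ τ a} → pos σ ≤ S → δ M q (input σ) (scanned σ) ≡ (just q' , a) →
           Run M q' (perform a σ) τ → Run M q σ τ

  -- Transitions between snapshots up to pointwise equality of tapes, since tapes are functions.
  infix 3 _⟶[_]_
  _⟶[_]_ : Snapshot → Machine → Snapshot → Set
  σ ⟶[ M ] τ = ∀ {σ'} → σ' ≋ σ → Σ Snapshot λ τ' → τ' ≋ τ × Run M (entry M) σ' τ'

  start≤ : ∀ {M q σ τ} → Run M q σ τ → pos σ ≤ S
  start≤ (exit p _ _) = p
  start≤ (next p _ _) = p

  input-cong : ∀ {σ τ} → σ ≋ τ → input σ ≡ input τ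
  input-cong (mk≋ refl _ _ _) = refl

  scanned-cong : ∀ {σ τ} → σ ≋ τ → scanned σ ≡ scanned τ
  scanned-cong {σ} (mk≋ _ e refl _) = e (pos σ)

  conv : ∀ {M σ σ₁ τ τ₁} → σ ≋ σ₁ → τ₁ ≋ τ → σ₁ ⟶[ M ] τ₁ → σ ⟶[ M ] τ
  conv p q t r with t (≋-trans r p)
  ... | τ' , e , run = τ' , ≋-trans e q , run

  prim-⟶ : ∀ f σ → pos σ ≤ S → pos (perform (f (input σ) (scanned σ)) σ) ≤ S →
           σ ⟶[ prim f ] perform (f (input σ) (scanned σ)) σ
  prim-⟶ f σ p₁ p₂ {σ'} e rewrite sym (input-cong e) | sym (scanned-cong e) =
    perform a σ' , pe , exit (subst (_≤ S) (sym (_≋_.pos≡ e)) p₁) (subst (_≤ S) (sym (_≋_.pos≡ pe)) p₂) refl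
    where
    a  = f (input σ') (scanned σ')
    pe = perform-cong a e

  map-nothing : ∀ {M : Machine} {q : Fin (states M)} {i s a} {X : Set} (f : Maybe (Fin (states M)) → X) →
                δ M q i s ≡ (nothing , a) → map₁ f (δ M q i s) ≡ (f nothing , a)
  map-nothing f e rewrite e = refl

  map-just : ∀ {M : Machine} {q q' : Fin (states M)} {i s a} {X : Set} (f : Maybe (Fin (states M)) → X) →
             δ M q i s ≡ (just q' , a) → map₁ f (δ M q i s) ≡ (f (just q') , a)
  map-just f e rewrite e = refl

  module _ (A B : Machine) where
    seq-right : ∀ {q σ τ} → Run B q σ τ → Run (seqM A B) (states A ↑ʳ q) σ τ
    seq-right {q} {σ} (exit {a = a} p p' e) = exit p p' eq
      where
      eq : δ (seqM A B) (states A ↑ʳ q) (input σ) (scanned σ) ≡ (nothing , a)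
      eq rewrite splitAt-↑ʳ (states A) (states B) q = map-nothing {B} (Maybe.map (states A ↑ʳ_)) e
    seq-right {q} {σ} (next {q' = q'} {a = a} p e r) = next p eq (seq-right r)
      where
      eq : δ (seqM A B) (states A ↑ʳ q) (input σ) (scanned σ) ≡ (just (states A ↑ʳ q') , a)
      eq rewrite splitAt-↑ʳ (states A) (states B) q = map-just {B} (Maybe.map (states A ↑ʳ_)) e

    seq-left : ∀ {q σ τ υ} → Run A q σ τ → Run B (entry B) τ υ → Run (seqM A B) (q ↑ˡ states B) σ υ
    seq-left {q} {σ} (exit {a = a} p p' e) r = next p eq (seq-right r)
      where
      eq : δ (seqM A B) (q ↑ˡ states B) (input σ) (scanned σ) ≡ (just (states A ↑ʳ entry B) , a)
      eq rewrite splitAt-↑ˡ (states A) q (states B) = map-nothing {A} (λ r → just (maybe′ (_↑ˡ states B) (states A ↑ʳ entry B) r)) e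
    seq-left {q} {σ} (next {q' = q'} {a = a} p e r₁) r = next p eq (seq-left r₁ r)
      where
      eq : δ (seqM A B) (q ↑ˡ states B) (input σ) (scanned σ) ≡ (just (q' ↑ˡ states B) , a)
      eq rewrite splitAt-↑ˡ (states A) q (states B) = map-just {A} (λ r → just (maybe′ (_↑ˡ states B) (states A ↑ʳ entry B) r)) e

    branch-right : ∀ c {q σ τ} → Run B q σ τ → Run (branchM c A B) (suc (states A ↑ʳ q)) σ τ
    branch-right c {q} {σ} (exit {a = a} p p' e) = exit p p' eq
      where
      eq : δ (branchM c A B) (suc (states A ↑ʳ q)) (input σ) (scanned σ) ≡ (nothing , a)
      eq rewrite splitAt-↑ʳ (states A) (states B) q = map-nothing {B} (Maybe.map (suc ∘ (states A ↑ʳ_))) e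
    branch-right c {q} {σ} (next {q' = q'} {a = a} p e r) = next p eq (branch-right c r)
      where
      eq : δ (branchM c A B) (suc (states A ↑ʳ q)) (input σ) (scanned σ) ≡ (just (suc (states A ↑ʳ q')) , a)
      eq rewrite splitAt-↑ʳ (states A) (states B) q = map-just {B} (Maybe.map (suc ∘ (states A ↑ʳ_))) e

    branch-left : ∀ c {q σ τ} → Run A q σ τ → Run (branchM c A B) (suc (q ↑ˡ states B)) σ τ
    branch-left c {q} {σ} (exit {a = a} p p' e) = exit p p' eq
      where
      eq : δ (branchM c A B) (suc (q ↑ˡ states B)) (input σ) (scanned σ) ≡ (nothing , a)
      eq rewrite splitAt-↑ˡ (states A) q (states B) = map-nothing {A} (Maybe.map (suc ∘ (_↑ˡ states B))) e
    branch-left c {q} {σ} (next {q' = q'} {a = a} p e r) = next p eq (branch-left c r)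
      where
      eq : δ (branchM c A B) (suc (q ↑ˡ states B)) (input σ) (scanned σ) ≡ (just (suc (q' ↑ˡ states B)) , a)
      eq rewrite splitAt-↑ˡ (states A) q (states B) = map-just {A} (Maybe.map (suc ∘ (_↑ˡ states B))) e

  while-body : ∀ c A {q σ τ υ} → Run A q σ τ → Run (whileM c A) zero τ υ → Run (whileM c A) (suc q) σ υ
  while-body c A (exit p p' e) r = next p (map-nothing {A} (λ r → just (maybe′ suc zero r)) e) r
  while-body c A (next p e r₁) r = next p (map-just {A} (λ r → just (maybe′ suc zero r)) e) (while-body c A r₁ r)

  infixr 5 _▷_
  opaque
    unfolding _⨟_ branch while

    _▷_ : ∀ {A B σ τ υ} → σ ⟶[ A ] τ → τ ⟶[ B ] υ → σ ⟶[ A ⨟ B ] υ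
    _▷_ {A} {B} s t e with s e
    ... | τ' , e' , r with t e'
    ... | υ' , e'' , r' = υ' , e'' , seq-left A B r r'

    idle-≋ : ∀ {σ' σ} → σ' ≋ σ → perform (idle (scanned σ')) σ' ≋ σ
    idle-≋ {σ'} e = ≋-trans (perform-idle σ') e

    branch-true : ∀ {c A B σ τ} → c (input σ) (scanned σ) ≡ true → σ ⟶[ A ] τ → σ ⟶[ branch c A B ] τ
    branch-true {c} {A} {B} {σ} ct t {σ'} e with t (idle-≋ e)
    ... | τ' , e' , r = τ' , e' , next (start≤ r) eq (branch-left A B c r)
      where
      eq : δ (branchM c A B) zero (input σ') (scanned σ') ≡ (just (suc (entry A ↑ˡ states B)) , idle (scanned σ'))
      eq rewrite input-cong e | scanned-cong e | ct = refl

    branch-false : ∀ {c A B σ τ} → c (input σ) (scanned σ) ≡ false → σ ⟶[ B ] τ → σ ⟶[ branch c A B ] τ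
    branch-false {c} {A} {B} {σ} ct t {σ'} e with t (idle-≋ e)
    ... | τ' , e' , r = τ' , e' , next (start≤ r) eq (branch-right A B c r)
      where
      eq : δ (branchM c A B) zero (input σ') (scanned σ') ≡ (just (suc (states A ↑ʳ entry B)) , idle (scanned σ'))
      eq rewrite input-cong e | scanned-cong e | ct = refl

    while-false : ∀ {c A σ} → pos σ ≤ S → c (input σ) (scanned σ) ≡ false → σ ⟶[ while c A ] σ
    while-false {c} {A} {σ} p cf {σ'} e = perform a σ' , idle-≋ e , exit p' p' eq
      where
      a : Action
      a = idle (scanned σ')
      p' : pos σ' ≤ S
      p' = subst (_≤ S) (sym (_≋_.pos≡ e)) p
      eq : δ (whileM c A) zero (input σ') (scanned σ') ≡ (nothing , a)
      eq rewrite input-cong e | scanned-cong e | cf = refl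

    while-true : ∀ {c A σ τ υ} → c (input σ) (scanned σ) ≡ true → σ ⟶[ A ] τ → τ ⟶[ while c A ] υ →
                 σ ⟶[ while c A ] υ
    while-true {c} {A} {σ} ct s t {σ'} e with s (idle-≋ e)
    ... | τ' , e' , r with t e'
    ... | υ' , e'' , r' = υ' , e'' , next (start≤ r) eq (while-body c A r r')
      where
      eq : δ (whileM c A) zero (input σ') (scanned σ') ≡ (just (suc (entry A)) , idle (scanned σ'))
      eq rewrite input-cong e | scanned-cong e | ct = refl

toTransducer : Machine → Transducer
toTransducer M = record
  { Q     = suc (states M)
  ; start = suc (entry M)
  ; halts = λ { zero → true ; (suc _) → false }
  ; δ     = λ { zero i s → zero , idle s ; (suc q) i s → map₁ (maybe′ suc zero) (δ M q i s) } }

module _ (M : Machine) (w : List Bool) (S : ℕ) where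
  open Semantics w S

  private Tr = toTransducer M

  toConfig : Fin (suc (states M)) → Snapshot → Config (suc (states M))
  toConfig q (snap i t p o) = conf q i t p o

  step-δ : ∀ {q r a} σ → δ M q (input σ) (scanned σ) ≡ (r , a) →
           step Tr w (toConfig (suc q) σ) ≡ toConfig (maybe′ suc zero r) (perform a σ)
  step-δ (snap i t p o) e rewrite e = refl

  -- The induction on the run needs an arbitrary starting time `t₀`, with the space bound for all
  -- earlier times as a hypothesis.
  run-computes : ∀ {q σ τ} t₀ → run Tr w t₀ ≡ toConfig (suc q) σ →
                 (∀ t → t < t₀ → Config.wpos (run Tr w t) ≤ S) → Run M q σ τ →
                 ComputesWithin Tr w (outp τ) S
  run-computes {σ = σ} t₀ e b (exit {a = a} p p' d) =
    suc t₀ , cong (Transducer.halts Tr ∘ Config.state) fin , cong Config.out fin , bound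
    where
    fin : run Tr w (suc t₀) ≡ toConfig zero (perform a σ)
    fin = trans (cong (step Tr w) e) (step-δ σ d)
    bound : ∀ t' → t' ≤ suc t₀ → Config.wpos (run Tr w t') ≤ S
    bound t' t'≤ with m≤n⇒m<n∨m≡n t'≤
    ... | inj₂ refl rewrite fin = p'
    ... | inj₁ (s≤s t'≤t₀) with m≤n⇒m<n∨m≡n t'≤t₀
    ...   | inj₁ lt   = b t' lt
    ...   | inj₂ refl rewrite e = p
  run-computes {σ = σ} t₀ e b (next {a = a} p d r) =
    run-computes (suc t₀) (trans (cong (step Tr w) e) (step-δ σ d)) bound r
    where
    bound : ∀ t → t < suc t₀ → Config.wpos (run Tr w t) ≤ S
    bound t (s≤s t≤) with m≤n⇒m<n∨m≡n t≤
    ... | inj₁ lt   = b t lt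
    ... | inj₂ refl rewrite e = p

  transducer-computes : ∀ {τ} → snap 0 (λ _ → nothing) 0 [] ⟶[ M ] τ → ComputesWithin Tr w (outp τ) S
  transducer-computes t with t ≋-refl
  ... | _ , e , r = subst (λ o → ComputesWithin Tr w o S) (_≋_.outp≡ e) (run-computes 0 refl (λ _ ()) r)

-- Registers on the work tape

_[_≔_] : ∀ {A : Set} → (ℕ → A) → ℕ → A → ℕ → A
(f [ r ≔ x ]) r' = if r' ≡ᵇ r then x else f r'

≔-at : ∀ {A : Set} (f : ℕ → A) r x → (f [ r ≔ x ]) r ≡ x
≔-at f r x with r ≡ᵇ r in eq
... | true  = refl
... | false = contradiction (≡⇒≡ᵇ r r refl) (subst (λ b → ¬ T b) (sym eq) id)

≔-other : ∀ {A : Set} (f : ℕ → A) {r r'} x → r' ≢ r → (f [ r ≔ x ]) r' ≡ f r'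
≔-other f {r} {r'} x ne with r' ≡ᵇ r in eq
... | true  = contradiction (≡ᵇ⇒≡ r' r (subst T (sym eq) tt)) ne
... | false = refl

≔-self : ∀ {A : Set} (f : ℕ → A) r → f [ r ≔ f r ] ≗ f
≔-self f r r' with r' ≟ r
... | yes refl = ≔-at f r (f r)
... | no ne    = ≔-other f (f r) ne

≔-≔ : ∀ {A : Set} (f : ℕ → A) r {x y} → (f [ r ≔ x ]) [ r ≔ y ] ≗ f [ r ≔ y ]
≔-≔ f r r' with r' ≡ᵇ r
... | true  = refl
... | false = refl

≔-map : ∀ {A B : Set} (g : A → B) (f : ℕ → A) r x → (g ∘ f) [ r ≔ g x ] ≗ g ∘ (f [ r ≔ x ])
≔-map g f r x r' with r' ≡ᵇ r
... | true  = refl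
... | false = refl

column : List Bool → ℕ → Maybe Bool
column ds = lookupD nothing (map just ds)

column-mid : ∀ pre d post → column (pre ++ d ∷ post) (length pre) ≡ just d
column-mid []        d post = refl
column-mid (_ ∷ pre) d post = column-mid pre d post

column-end : ∀ pre → column pre (length pre) ≡ nothing
column-end []        = refl
column-end (_ ∷ pre) = column-end pre

column-replace : ∀ pre d d' post {j} → j ≢ length pre → column (pre ++ d' ∷ post) j ≡ column (pre ++ d ∷ post) j
column-replace []        d d' post {zero}  ne = contradiction refl ne
column-replace []        d d' post {suc j} ne = refl
column-replace (_ ∷ pre) d d' post {zero}  ne = refl
column-replace (_ ∷ pre) d d' post {suc j} ne = column-replace pre d d' post (ne ∘ cong suc)

column-append : ∀ pre d {j} → j ≢ length pre → column (pre ++ [ d ]) j ≡ column pre j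
column-append []        d {zero}  ne = contradiction refl ne
column-append []        d {suc j} ne = refl
column-append (_ ∷ pre) d {zero}  ne = refl
column-append (_ ∷ pre) d {suc j} ne = column-append pre d (ne ∘ cong suc)

length-snoc : ∀ {A : Set} (xs : List A) x → length (xs ++ [ x ]) ≡ suc (length xs)
length-snoc xs x = trans (length-++ xs) (+-comm (length xs) 1)

-- Successor and predecessor of bijective base-2 numerals, least significant digit first; false and
-- true stand for the digits 1 and 2.
incL : List Bool → List Bool
incL []           = [ false ]
incL (false ∷ ds) = true ∷ ds
incL (true ∷ ds)  = false ∷ incL ds

decL : List Bool → List Bool
decL []               = []
decL (true ∷ ds)      = false ∷ ds
decL (false ∷ [])     = []
decL (false ∷ d ∷ ds) = true ∷ decL (d ∷ ds)

isTrue isFalse isBlank nonBlank : Test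
isTrue   _ s = maybe′ id false s
isFalse  _ s = maybe′ not false s
isBlank  _ s = maybe′ (λ _ → false) true s
nonBlank _ s = maybe′ (λ _ → true) false s

shift : Move → ℕ → Machine
shift mv zero    = prim (λ _ s → idle s)
shift mv (suc n) = prim (λ _ s → stay , s , mv , nothing) ⨟ shift mv n

rewriteCell : (Maybe Bool → Maybe Bool) → Machine
rewriteCell f = prim (λ _ s → stay , f s , stay , nothing)

write : Bool → Machine
write b = rewriteCell (λ _ → just b)

bump : Maybe Bool → Maybe Bool
bump = maybe′ (λ _ → just true) (just false)

emits : List Bool → Machine
emits []       = prim (λ _ s → idle s)
emits (b ∷ bs) = prim (λ _ s → stay , s , stay , just b) ⨟ emits bs

-- The work tape is divided into blocks of K + 1 cells: the first cell of a block is marked in block 0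
-- only, and cell r + 1 of block i holds the i-th digit of register r.
module Registers (K : ℕ) where
  W : ℕ
  W = suc K

  -- A left move in cell 0 keeps the head there and cannot be noticed. Therefore `home` walks back
  -- block by block until it sees the mark of block 0; each of these operations starts and ends on
  -- it.
  home inc dec print : ℕ → Machine
  home r  = shift left (suc r) ⨟ while isBlank (shift left W)
  inc r   = shift right (suc r) ⨟ while isTrue (write false ⨟ shift right W) ⨟ rewriteCell bump ⨟ home r
  -- A borrow turns the low digits 1 into 2. If the numeral ends before a digit 2 is met, all its
  -- digits were 1, and the last one is erased.
  dec r   = shift right (suc r) ⨟ while isFalse (write true ⨟ shift right W) ⨟
            branch isBlank (shift left W ⨟ rewriteCell (λ _ → nothing)) (write false) ⨟ home r
  print r = shift right (suc r) ⨟
            while nonBlank (branch isTrue (emits (csymBits c1)) (emits (csymBits c0)) ⨟ shift right W) ⨟ home r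

  put : ℕ → ℕ → Bool → Machine
  put r s b = shift left (suc r) ⨟ shift right (suc s) ⨟ write b ⨟ shift left (suc s) ⨟ shift right (suc r)

  -- Digits are written but never erased, so the target `s` has to hold zero beforehand.
  copy : ℕ → ℕ → Machine
  copy r s = shift right (suc r) ⨟
             while nonBlank (branch isTrue (put r s true) (put r s false) ⨟ shift right W) ⨟ home r

  ifZero : ℕ → Machine → Machine → Machine
  ifZero r A B = shift right (suc r) ⨟ branch isBlank (shift left (suc r) ⨟ A) (shift left (suc r) ⨟ B)

  -- It is up to `A` to decrement `r`. The loop tests the cell of `r` in block 0, which is blank
  -- exactly if the register is zero.
  countdown : ℕ → Machine → Machine
  countdown r A = shift right (suc r) ⨟ while nonBlank (shift left (suc r) ⨟ A ⨟ shift right (suc r)) ⨟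
                  shift left (suc r)

  flat : (ℕ → ℕ → Maybe Bool) → ℕ → Maybe Bool
  flat T j = T (j / W) (j % W)

  flat-at : ∀ T i {o} → o < W → flat T (i * W + o) ≡ T i o
  flat-at T i {o} o<W = cong₂ T quot rem
    where
    rem : (i * W + o) % W ≡ o
    rem = trans (cong (_% W) (+-comm (i * W) o)) (trans ([m+kn]%n≡m%n o i W) (m<n⇒m%n≡m o<W))
    quot : (i * W + o) / W ≡ i
    quot = *-cancelʳ-≡ _ _ W (+-cancelˡ-≡ o _ _ (trans (cong (_+ (i * W + o) / W * W) (sym rem))
             (trans (sym (m≡m%n+[m/n]*n (i * W + o) W)) (+-comm (i * W) o))))

  flat-write : ∀ {T T'} i {o} s → o < W → T' i o ≡ s →
               (∀ i' o' → ¬ (i' ≡ i × o' ≡ o) → T' i' o' ≡ T i' o') →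
               update (flat T) (i * W + o) s ≗ flat T'
  flat-write {T} {T'} i {o} s o<W eq rest j with j ≟ i * W + o
  ... | yes refl = trans (update-at (flat T) (i * W + o) s) (sym (trans (flat-at T' i o<W) eq))
  ... | no ne = trans (update-other (flat T) (i * W + o) s ne) (sym (rest (j / W) (j % W) λ { (p , q) →
                  ne (trans (m≡m%n+[m/n]*n j W) (trans (cong₂ (λ a b → a + b * W) q p) (+-comm o (i * W)))) }))

  marker : ℕ → Maybe Bool
  marker zero    = just true
  marker (suc _) = nothing

  cells : (ℕ → List Bool) → ℕ → ℕ → Maybe Bool
  cells R i zero    = marker i
  cells R i (suc r) = column (R r) i

  cells-cong : ∀ {R R'} → R ≗ R' → ∀ i o → cells R i o ≡ cells R' i o
  cells-cong e i zero    = refl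
  cells-cong e i (suc r) = cong (λ ds → column ds i) (e r)

  cells-write : ∀ R r ds i s → r < K → column ds i ≡ s → (∀ {j} → j ≢ i → column ds j ≡ column (R r) j) →
                update (flat (cells R)) (i * W + suc r) s ≗ flat (cells (R [ r ≔ ds ]))
  cells-write R r ds i s r<K eq rest = flat-write i s (s≤s r<K)
    (trans (cong (λ ds → column ds i) (≔-at R r ds)) eq) other
    where
    other : ∀ i' o' → ¬ (i' ≡ i × o' ≡ suc r) → cells (R [ r ≔ ds ]) i' o' ≡ cells R i' o'
    other i' zero     _  = refl
    other i' (suc r') ne with r' ≟ r
    ... | yes refl = trans (cong (λ ds → column ds i') (≔-at R r ds)) (rest λ { refl → ne (refl , refl) })
    ... | no r'≢r  = cong (λ ds → column ds i') (≔-other R ds r'≢r)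

  -- Numerals have at most `D` digits. A scan may also visit the blank block that follows them,
  -- which accounts for `suc D` blocks.
  module Effects (w : List Bool) (D : ℕ) where
    S : ℕ
    S = suc D * W
    open Semantics w S public

    block≤ : ∀ {i o} → i ≤ D → o ≤ W → i * W + o ≤ S
    block≤ {i} {o} i≤D o≤W = ≤-trans (+-mono-≤ (*-monoˡ-≤ W i≤D) o≤W) (≤-reflexive (+-comm (D * W) W))

    opaque
      place : ℕ → List Bool → (ℕ → List Bool) → ℕ → ℕ → Snapshot
      place ip out R i o = snap ip (flat (cells R)) (i * W + o) out

    opaque
      unfolding place

      place-def : ∀ ip out R i o → place ip out R i o ≡ snap ip (flat (cells R)) (i * W + o) out
      place-def ip out R i o = refl

      place≤ : ∀ {ip out R i o} → i ≤ D → o ≤ W → pos (place ip out R i o) ≤ S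
      place≤ = block≤

      place-cong : ∀ {ip out R R' i o} → R ≗ R' → place ip out R i o ≋ place ip out R' i o
      place-cong e = mk≋ refl (λ j → cells-cong e (j / W) (j % W)) refl refl

      place-out : ∀ {ip out out' R i o} → out ≡ out' → place ip out R i o ≋ place ip out' R i o
      place-out refl = ≋-refl

      scan-at : ∀ {ip out} R i {r} → r < K → scanned (place ip out R i (suc r)) ≡ column (R r) i
      scan-at R i r<K = flat-at (cells R) i (s≤s r<K)

      scan-marker : ∀ {ip out} R i → scanned (place ip out R i 0) ≡ marker i
      scan-marker R i = flat-at (cells R) i (s≤s z≤n)

    step-idle : ∀ mi mv b σ → pos σ ≤ S → move mv (pos σ) ≤ S →
                σ ⟶[ prim (λ _ s → mi , s , mv , b) ]
                snap (move mi (ipos σ)) (tape σ) (move mv (pos σ)) (emit (outp σ) b)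
    step-idle mi mv b σ p p' = conv ≋-refl (mk≋ refl (update-idle (tape σ) (pos σ)) refl refl)
                              (prim-⟶ (λ _ s → mi , s , mv , b) σ p p')

    shift-right : ∀ n {ip t p out} → n + p ≤ S → snap ip t p out ⟶[ shift right n ] snap ip t (n + p) out
    shift-right zero    {ip} {t} {p} {out} le = step-idle stay stay nothing (snap ip t p out) le le
    shift-right (suc n) {ip} {t} {p} {out} le =
      step-idle stay right nothing (snap ip t p out) (m+n≤o⇒n≤o (suc n) le) (≤-trans (s≤s (m≤n+m p n)) le)
      ▷ conv ≋-refl (mk≋ refl (λ _ → refl) (+-suc n p) refl)
          (shift-right n (subst (_≤ S) (sym (+-suc n p)) le))

    shift-left : ∀ n {ip t p out} → n + p ≤ S → snap ip t (n + p) out ⟶[ shift left n ] snap ip t p out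
    shift-left zero    {ip} {t} {p} {out} le = step-idle stay stay nothing (snap ip t p out) le le
    shift-left (suc n) {ip} {t} {p} {out} le =
      step-idle stay left nothing (snap ip t (suc n + p) out) le (≤-trans (n≤1+n _) le)
      ▷ shift-left n (≤-trans (n≤1+n _) le)

    test-at : ∀ {c : Test} {σ s} {b : Bool} → scanned σ ≡ s → c (input σ) s ≡ b → c (input σ) (scanned σ) ≡ b
    test-at refl e = e

    pre≤ : ∀ (pre : List Bool) {ds xs} → xs ≡ pre ++ ds → length xs ≤ D → length pre ≤ D
    pre≤ pre {ds} refl le = ≤-trans (m≤m+n (length pre) (length ds)) (≤-trans (≤-reflexive (sym (length-++ pre))) le)

    pre< : ∀ (pre : List Bool) {d ds xs} → xs ≡ pre ++ d ∷ ds → length xs ≤ D → suc (length pre) ≤ D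
    pre< pre {d} {ds} refl le = ≤-trans (≤-reflexive (sym (length-snoc pre d)))
      (pre≤ (pre ++ [ d ]) {ds} (sym (++-assoc pre [ d ] ds)) le)

    module _ {ip : ℕ} {out : List Bool} where
      private
        at : (ℕ → List Bool) → ℕ → ℕ → Snapshot
        at = place ip out

        swap-pos : ∀ i o → o + (i * W + 0) ≡ i * W + o
        swap-pos i o = trans (cong (o +_) (+-identityʳ (i * W))) (+-comm o (i * W))

        same-pos : ∀ {t p p'} → p ≡ p' → snap ip t p out ≋ snap ip t p' out
        same-pos refl = ≋-refl

      opaque
        unfolding place

        column⇒ : ∀ {R i o} → i ≤ D → o ≤ W → at R i 0 ⟶[ shift right o ] at R i o
        column⇒ {R} {i} {o} i≤D o≤W = conv ≋-refl (same-pos (swap-pos i o))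
          (shift-right o (≤-trans (≤-reflexive (swap-pos i o)) (block≤ i≤D o≤W)))

        column⇐ : ∀ {R i o} → i ≤ D → o ≤ W → at R i o ⟶[ shift left o ] at R i 0
        column⇐ {R} {i} {o} i≤D o≤W = conv (same-pos (sym (swap-pos i o))) ≋-refl
          (shift-left o (≤-trans (≤-reflexive (swap-pos i o)) (block≤ i≤D o≤W)))

        block⇒ : ∀ {R i o} → suc i ≤ D → o ≤ W → at R i o ⟶[ shift right W ] at R (suc i) o
        block⇒ {R} {i} {o} i<D o≤W = conv ≋-refl (same-pos (sym (+-assoc W (i * W) o)))
          (shift-right W (≤-trans (≤-reflexive (sym (+-assoc W (i * W) o))) (block≤ i<D o≤W)))

        block⇐ : ∀ {R i o} → suc i ≤ D → o ≤ W → at R (suc i) o ⟶[ shift left W ] at R i o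
        block⇐ {R} {i} {o} i<D o≤W = conv (same-pos (+-assoc W (i * W) o)) ≋-refl
          (shift-left W (≤-trans (≤-reflexive (sym (+-assoc W (i * W) o))) (block≤ i<D o≤W)))

      scan-≔ : ∀ R {r} ds i → r < K → scanned (at (R [ r ≔ ds ]) i (suc r)) ≡ column ds i
      scan-≔ R {r} ds i r<K = trans (scan-at (R [ r ≔ ds ]) i r<K) (cong (λ ds → column ds i) (≔-at R r ds))

      opaque
        unfolding place

        rewrite-at : ∀ {R r} ds i f → i ≤ D → r < K → column ds i ≡ f (column (R r) i) →
                     (∀ {j} → j ≢ i → column ds j ≡ column (R r) j) →
                     at R i (suc r) ⟶[ rewriteCell f ] at (R [ r ≔ ds ]) i (suc r)
        rewrite-at {R} {r} ds i f i≤D r<K eq rest =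
          conv ≋-refl (mk≋ refl (cells-write R r ds i _ r<K (trans eq (cong f (sym (scan-at {ip} {out} R i r<K)))) rest) refl refl)
            (prim-⟶ (λ _ s → stay , f s , stay , nothing) (at R i (suc r)) p p)
          where
          p : i * W + suc r ≤ S
          p = block≤ i≤D (s≤s (<⇒≤ r<K))

      rewrite-≔ : ∀ {R r} xs ds i f → i ≤ D → r < K → column ds i ≡ f (column xs i) →
                  (∀ {j} → j ≢ i → column ds j ≡ column xs j) →
                  at (R [ r ≔ xs ]) i (suc r) ⟶[ rewriteCell f ] at (R [ r ≔ ds ]) i (suc r)
      rewrite-≔ {R} {r} xs ds i f i≤D r<K eq rest =
        conv ≋-refl (place-cong (≔-≔ R r))
          (rewrite-at ds i f i≤D r<K (trans eq (cong (λ ys → f (column ys i)) (sym (≔-at R r xs))))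
             (λ ne → trans (rest ne) (cong (λ ys → column ys _) (sym (≔-at R r xs)))))

      home-⟶ : ∀ {R i r} → i ≤ D → r < K → at R i (suc r) ⟶[ home r ] at R 0 0
      home-⟶ {R} i≤D r<K = column⇐ i≤D (s≤s (<⇒≤ r<K)) ▷ back _ i≤D
        where
        back : ∀ i → i ≤ D → at R i 0 ⟶[ while isBlank (shift left W) ] at R 0 0
        back zero    _   = while-false (place≤ z≤n z≤n) (test-at {isBlank} {at R 0 0} (scan-marker R 0) refl)
        back (suc i) i<D = while-true (test-at {isBlank} {at R (suc i) 0} (scan-marker R (suc i)) refl)
                             (block⇐ i<D z≤n) (back i (<⇒≤ i<D))

      module _ (R : ℕ → List Bool) {r : ℕ} (r<K : r < K) where
        private
          o≤W : suc r ≤ W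
          o≤W = s≤s (<⇒≤ r<K)

          _∣_ : List Bool → ℕ → Snapshot
          xs ∣ i = at (R [ r ≔ xs ]) i (suc r)

        -- `pre` is the part of the numeral already passed and `ds` the part still to be read. The
        -- snapshot `μ` between the loop and the final rewriting is left existential, as it depends
        -- on where the carry stops.
        inc-scan : ∀ ds pre xs i → xs ≡ pre ++ ds → i ≡ length pre → length xs ≤ D →
                   Σ Snapshot λ μ → (xs ∣ i ⟶[ while isTrue (write false ⨟ shift right W) ] μ) ×
                   Σ ℕ λ j → j ≤ D × (μ ⟶[ rewriteCell bump ] (pre ++ incL ds) ∣ j)
        inc-scan [] pre xs i refl refl le = _ ,
          while-false (place≤ le' o≤W) (test-at {isTrue} {xs ∣ i} (scan-≔ R xs i r<K) (cong (maybe′ id false) blank)) ,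
          i , le' , rewrite-≔ xs (pre ++ [ false ]) i bump le' r<K
                      (trans (column-mid pre false []) (sym (cong bump blank)))
                      (λ ne → trans (column-append pre false ne) (cong (λ ys → column ys _) (sym (++-identityʳ pre))))
          where
          le' = pre≤ pre {[]} refl le
          blank : column (pre ++ []) (length pre) ≡ nothing
          blank = trans (cong (λ ys → column ys (length pre)) (++-identityʳ pre)) (column-end pre)
        inc-scan (false ∷ ds) pre xs i refl refl le = _ ,
          while-false (place≤ le' o≤W)
            (test-at {isTrue} {xs ∣ i} (scan-≔ R xs i r<K) (cong (maybe′ id false) (column-mid pre false ds))) ,
          i , le' , rewrite-≔ xs (pre ++ true ∷ ds) i bump le' r<K
                      (trans (column-mid pre true ds) (sym (cong bump (column-mid pre false ds))))
                      (column-replace pre false true ds)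
          where le' = pre≤ pre {false ∷ ds} refl le
        inc-scan (true ∷ ds) pre xs i refl refl le
          with inc-scan ds (pre ++ [ false ]) (pre ++ false ∷ ds) (suc i) (sym (++-assoc pre [ false ] ds))
                 (sym (length-snoc pre false))
                 (≤-trans (≤-reflexive (trans (length-++ pre) (sym (length-++ pre)))) le)
        ... | μ , s , j , j≤ , t = μ ,
          while-true (test-at {isTrue} {xs ∣ i} (scan-≔ R xs i r<K) (cong (maybe′ id false) (column-mid pre true ds)))
            (rewrite-≔ xs (pre ++ false ∷ ds) i _ (<⇒≤ lt) r<K (column-mid pre false ds) (column-replace pre true false ds)
             ▷ block⇒ lt o≤W) s ,
          j , j≤ , subst (λ ys → μ ⟶[ rewriteCell bump ] ys ∣ j) (++-assoc pre [ false ] (incL ds)) t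
          where lt = pre< pre {true} {ds} refl le

        inc-⟶ : length (R r) ≤ D → at R 0 0 ⟶[ inc r ] at (R [ r ≔ incL (R r) ]) 0 0
        inc-⟶ le with inc-scan (R r) [] (R r) 0 refl refl le
        ... | μ , s , j , j≤ , t =
          conv (place-cong (λ r' → sym (≔-self R r r'))) ≋-refl
            (column⇒ z≤n o≤W ▷ s ▷ t ▷ home-⟶ j≤ r<K)

        private
          finishDec : Machine
          finishDec = branch isBlank (shift left W ⨟ rewriteCell (λ _ → nothing)) (write false)

        dec-scan : ∀ d ds pre xs i → xs ≡ pre ++ d ∷ ds → i ≡ length pre → length xs ≤ D →
                   Σ Snapshot λ μ → (xs ∣ i ⟶[ while isFalse (write true ⨟ shift right W) ] μ) ×
                   Σ ℕ λ j → j ≤ D × (μ ⟶[ finishDec ] (pre ++ decL (d ∷ ds)) ∣ j)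
        dec-scan true ds pre xs i refl refl le = _ ,
          while-false (place≤ le' o≤W)
            (test-at {isFalse} {xs ∣ i} (scan-≔ R xs i r<K) (cong (maybe′ not false) (column-mid pre true ds))) ,
          i , le' ,
          branch-false (test-at {isBlank} {xs ∣ i} (scan-≔ R xs i r<K)
                          (cong (maybe′ (λ _ → false) true) (column-mid pre true ds)))
            (rewrite-≔ xs (pre ++ false ∷ ds) i _ le' r<K (column-mid pre false ds) (column-replace pre true false ds))
          where le' = pre≤ pre {true ∷ ds} refl le
        -- The numeral ends during the borrow: the head stands on the blank behind it, goes back one
        -- block and removes the digit written there last.
        dec-scan false [] pre xs i refl refl le = _ ,
          while-true (test-at {isFalse} {xs ∣ i} (scan-≔ R xs i r<K) (cong (maybe′ not false) (column-mid pre false [])))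
            (rewrite-≔ xs ys i _ (<⇒≤ lt) r<K (column-mid pre true []) (column-replace pre false true [])
             ▷ block⇒ lt o≤W)
            (while-false (place≤ lt o≤W)
              (test-at {isFalse} {ys ∣ suc i} (scan-≔ R ys (suc i) r<K) (cong (maybe′ not false) blank))) ,
          i , <⇒≤ lt ,
          branch-true (test-at {isBlank} {ys ∣ suc i} (scan-≔ R ys (suc i) r<K) (cong (maybe′ (λ _ → false) true) blank))
            (block⇐ lt o≤W ▷ rewrite-≔ ys (pre ++ []) i _ (<⇒≤ lt) r<K
               (trans (cong (λ zs → column zs i) (++-identityʳ pre)) (column-end pre))
               (λ ne → trans (cong (λ zs → column zs _) (++-identityʳ pre)) (sym (column-append pre true ne))))
          where
          ys = pre ++ [ true ]
          lt = pre< pre {false} {[]} refl le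
          blank : column ys (suc (length pre)) ≡ nothing
          blank = trans (cong (column ys) (sym (length-snoc pre true))) (column-end ys)
        dec-scan false (d ∷ ds) pre xs i refl refl le
          with dec-scan d ds (pre ++ [ true ]) (pre ++ true ∷ d ∷ ds) (suc i) (sym (++-assoc pre [ true ] (d ∷ ds)))
                 (sym (length-snoc pre true))
                 (≤-trans (≤-reflexive (trans (length-++ pre) (sym (length-++ pre)))) le)
        ... | μ , s , j , j≤ , t = μ ,
          while-true (test-at {isFalse} {xs ∣ i} (scan-≔ R xs i r<K)
                        (cong (maybe′ not false) (column-mid pre false (d ∷ ds))))
            (rewrite-≔ xs (pre ++ true ∷ d ∷ ds) i _ (<⇒≤ lt) r<K (column-mid pre true (d ∷ ds))
               (column-replace pre false true (d ∷ ds))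
             ▷ block⇒ lt o≤W) s ,
          j , j≤ , subst (λ ys → μ ⟶[ finishDec ] ys ∣ j) (++-assoc pre [ true ] (decL (d ∷ ds))) t
          where lt = pre< pre {false} {d ∷ ds} refl le

        dec-⟶ : ∀ {d ds} → R r ≡ d ∷ ds → length (R r) ≤ D → at R 0 0 ⟶[ dec r ] at (R [ r ≔ decL (R r) ]) 0 0
        dec-⟶ {d} {ds} e le with dec-scan d ds [] (R r) 0 e refl le
        ... | μ , s , j , j≤ , t =
          conv (place-cong (λ r' → sym (≔-self R r r')))
               (place-cong (λ r' → cong (λ x → (R [ r ≔ decL x ]) r') (sym e)))
            (column⇒ z≤n o≤W ▷ s ▷ t ▷ home-⟶ j≤ r<K)

        module _ {s : ℕ} (s<K : s < K) (r≢s : r ≢ s) where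
          private
            o≤W' : suc s ≤ W
            o≤W' = s≤s (<⇒≤ s<K)

            body : Machine
            body = branch isTrue (put r s true) (put r s false) ⨟ shift right W

          put-⟶ : ∀ b i {xs ds} → i ≤ D → column ds i ≡ just b → (∀ {j} → j ≢ i → column ds j ≡ column xs j) →
                  at (R [ s ≔ xs ]) i (suc r) ⟶[ put r s b ] at (R [ s ≔ ds ]) i (suc r)
          put-⟶ b i {xs} {ds} i≤D e rest =
            column⇐ i≤D o≤W ▷ column⇒ i≤D o≤W' ▷ rewrite-≔ xs ds i _ i≤D s<K e rest ▷ column⇐ i≤D o≤W' ▷ column⇒ i≤D o≤W

          copy-scan : ∀ ds pre i → R r ≡ pre ++ ds → i ≡ length pre → length (R r) ≤ D →
                      Σ ℕ λ j → j ≤ D × (at (R [ s ≔ pre ]) i (suc r) ⟶[ while nonBlank body ]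
                                         at (R [ s ≔ R r ]) j (suc r))
          copy-scan [] pre i e refl le = i , le' ,
            conv ≋-refl (place-cong (λ r' → cong (λ x → (R [ s ≔ x ]) r') (sym (trans e (++-identityʳ pre)))))
              (while-false (place≤ le' o≤W) (test-at {nonBlank} {at (R [ s ≔ pre ]) i (suc r)}
                 (scan-at (R [ s ≔ pre ]) i r<K)
                 (cong (maybe′ (λ _ → true) false) (trans (cong (λ x → column x i) (trans (≔-other R pre r≢s)
                   (trans e (++-identityʳ pre)))) (column-end pre)))))
            where le' = pre≤ pre {[]} e le
          copy-scan (d ∷ ds) pre i e refl le
            with copy-scan ds (pre ++ [ d ]) (suc i) (trans e (sym (++-assoc pre [ d ] ds))) (sym (length-snoc pre d)) le
          ... | j , j≤ , t = j , j≤ ,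
            while-true (test-at {nonBlank} {at (R [ s ≔ pre ]) i (suc r)} here' refl) (write-digit d here' ▷ block⇒ lt o≤W) t
            where
            lt = pre< pre {d} {ds} e le
            here' : scanned (at (R [ s ≔ pre ]) i (suc r)) ≡ just d
            here' = trans (scan-at (R [ s ≔ pre ]) i r<K)
                      (trans (cong (λ x → column x i) (trans (≔-other R pre r≢s) e)) (column-mid pre d ds))
            write-digit : ∀ d → scanned (at (R [ s ≔ pre ]) i (suc r)) ≡ just d →
                          at (R [ s ≔ pre ]) i (suc r) ⟶[ branch isTrue (put r s true) (put r s false) ]
                          at (R [ s ≔ pre ++ [ d ] ]) i (suc r)
            write-digit true  eq = branch-true (test-at {isTrue} {at (R [ s ≔ pre ]) i (suc r)} eq refl)
              (put-⟶ true i (<⇒≤ lt) (column-mid pre true []) (column-append pre true))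
            write-digit false eq = branch-false (test-at {isTrue} {at (R [ s ≔ pre ]) i (suc r)} eq refl)
              (put-⟶ false i (<⇒≤ lt) (column-mid pre false []) (column-append pre false))

          copy-⟶ : R s ≡ [] → length (R r) ≤ D → at R 0 0 ⟶[ copy r s ] at (R [ s ≔ R r ]) 0 0
          copy-⟶ e le with copy-scan (R r) [] 0 refl refl le
          ... | j , j≤ , t =
            conv (place-cong (λ r' → trans (sym (≔-self R s r')) (cong (λ x → (R [ s ≔ x ]) r') e))) ≋-refl
              (column⇒ z≤n o≤W ▷ t ▷ home-⟶ j≤ r<K)

        ifZero-true : ∀ {A B τ} → R r ≡ [] → at R 0 0 ⟶[ A ] τ → at R 0 0 ⟶[ ifZero r A B ] τ
        ifZero-true e t = column⇒ z≤n o≤W ▷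
          branch-true (test-at {isBlank} {at R 0 (suc r)} (scan-at R 0 r<K)
            (cong (λ x → maybe′ (λ _ → false) true (column x 0)) e)) (column⇐ z≤n o≤W ▷ t)

        ifZero-false : ∀ {A B τ d ds} → R r ≡ d ∷ ds → at R 0 0 ⟶[ B ] τ → at R 0 0 ⟶[ ifZero r A B ] τ
        ifZero-false e t = column⇒ z≤n o≤W ▷
          branch-false (test-at {isBlank} {at R 0 (suc r)} (scan-at R 0 r<K)
            (cong (λ x → maybe′ (λ _ → false) true (column x 0)) e)) (column⇐ z≤n o≤W ▷ t)

    emits-⟶ : ∀ bs {ip t p out} → p ≤ S → snap ip t p out ⟶[ emits bs ] snap ip t p (out ++ bs)
    emits-⟶ []       {ip} {t} {p} {out} p≤S =
      conv ≋-refl (mk≋ refl (λ _ → refl) refl (sym (++-identityʳ out))) (step-idle stay stay nothing (snap ip t p out) p≤S p≤S)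
    emits-⟶ (b ∷ bs) {ip} {t} {p} {out} p≤S =
      step-idle stay stay (just b) (snap ip t p out) p≤S p≤S ▷
      conv ≋-refl (mk≋ refl (λ _ → refl) refl (++-assoc out [ b ] bs)) (emits-⟶ bs p≤S)

    opaque
      unfolding place

      emits-at : ∀ bs {ip out R i o} → i ≤ D → o ≤ W →
                 place ip out R i o ⟶[ emits bs ] place ip (out ++ bs) R i o
      emits-at bs i≤D o≤W = emits-⟶ bs (block≤ i≤D o≤W)

    digitSym : Bool → CSym
    digitSym d = if d then c1 else c0

    print-⟶ : ∀ {ip out} R {r} → r < K → length (R r) ≤ D →
              place ip out R 0 0 ⟶[ print r ] place ip (out ++ concat (map csymBits (map digitSym (R r)))) R 0 0
    print-⟶ {ip} {out₀} R {r} r<K le with scan (R r) [] 0 out₀ refl refl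
      where
      o≤W = s≤s (<⇒≤ r<K)
      scan : ∀ ds pre i out → R r ≡ pre ++ ds → i ≡ length pre → Σ ℕ λ j → j ≤ D ×
             (place ip out R i (suc r) ⟶[ while nonBlank (branch isTrue (emits (csymBits c1)) (emits (csymBits c0)) ⨟ shift right W) ]
              place ip (out ++ concat (map csymBits (map digitSym ds))) R j (suc r))
      scan [] pre i out e refl = i , le' ,
        conv ≋-refl (place-out (sym (++-identityʳ out)))
          (while-false (place≤ le' o≤W) (test-at {nonBlank} {place ip out R i (suc r)} (scan-at R i r<K)
            (cong (maybe′ (λ _ → true) false) (trans (cong (λ x → column x i) (trans e (++-identityʳ pre))) (column-end pre)))))
        where le' = pre≤ pre {[]} e le
      scan (d ∷ ds) pre i out e refl
        with scan ds (pre ++ [ d ]) (suc i) (out ++ csymBits (digitSym d))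
               (trans e (sym (++-assoc pre [ d ] ds))) (sym (length-snoc pre d))
      ... | j , j≤ , t = j , j≤ ,
        while-true (test-at {nonBlank} {place ip out R i (suc r)} here' refl) (emit-digit d here' ▷ block⇒ lt o≤W)
          (conv ≋-refl (place-out (++-assoc out (csymBits (digitSym d)) _)) t)
        where
        lt = pre< pre {d} {ds} e le
        here' : scanned (place ip out R i (suc r)) ≡ just d
        here' = trans (scan-at R i r<K) (trans (cong (λ x → column x i) e) (column-mid pre d ds))
        emit-digit : ∀ d → scanned (place ip out R i (suc r)) ≡ just d →
                     place ip out R i (suc r) ⟶[ branch isTrue (emits (csymBits c1)) (emits (csymBits c0)) ]
                     place ip (out ++ csymBits (digitSym d)) R i (suc r)
        emit-digit true  eq = branch-true (test-at {isTrue} {place ip out R i (suc r)} eq refl)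
                                (emits-at (csymBits c1) (<⇒≤ lt) o≤W)
        emit-digit false eq = branch-false (test-at {isTrue} {place ip out R i (suc r)} eq refl)
                                (emits-at (csymBits c0) (<⇒≤ lt) o≤W)
    ... | j , j≤ , t = column⇒ z≤n (s≤s (<⇒≤ r<K)) ▷ t ▷ home-⟶ j≤ r<K

-- Bijective binary numerals and register files

bits : ℕᵇ.ℕᵇ → List Bool
bits ℕᵇ.zero      = []
bits ℕᵇ.1+[2 x ]  = false ∷ bits x
bits ℕᵇ.2[1+ x ]  = true ∷ bits x

bits-suc : ∀ x → bits (ℕᵇ.suc x) ≡ incL (bits x)
bits-suc ℕᵇ.zero      = refl
bits-suc ℕᵇ.1+[2 x ]  = refl
bits-suc ℕᵇ.2[1+ x ]  = cong (false ∷_) (bits-suc x)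

opaque
  digits : ℕ → List Bool
  digits n = bits (ℕᵇ.fromℕ n)

  digits-def : ∀ n → digits n ≡ bits (ℕᵇ.fromℕ n)
  digits-def n = refl

  digits-zero : digits 0 ≡ []
  digits-zero = refl

  digits-suc : ∀ n → digits (suc n) ≡ incL (digits n)
  digits-suc n rewrite ℕᵇₚ.fromℕ≡fromℕ' (suc n) | ℕᵇₚ.fromℕ≡fromℕ' n = bits-suc (ℕᵇ.fromℕ' n)

incL-cons : ∀ ds → ∃₂ λ d ds' → incL ds ≡ d ∷ ds'
incL-cons []           = _ , _ , refl
incL-cons (false ∷ ds) = _ , _ , refl
incL-cons (true ∷ ds)  = _ , _ , refl

decL-incL : ∀ ds → decL (incL ds) ≡ ds
decL-incL []           = refl
decL-incL (false ∷ ds) = refl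
decL-incL (true ∷ ds) with incL ds | incL-cons ds | decL-incL ds
... | _ | _ , _ , refl | e = cong (true ∷_) e

digits-cons : ∀ n → ∃₂ λ d ds → digits (suc n) ≡ d ∷ ds
digits-cons n with incL-cons (digits n)
... | d , ds , e = d , ds , trans (digits-suc n) e

-- The least value of a numeral with `L` digits is that of `L` digits 1, which is `2 ^ L ∸ 1`.
2^bits : ∀ x → 2 ^ length (bits x) ≤ suc (ℕᵇ.toℕ x)
2^bits ℕᵇ.zero     = ≤-refl
2^bits ℕᵇ.1+[2 x ] = ≤-trans (*-monoʳ-≤ 2 (2^bits x)) (≤-reflexive (*-suc 2 (ℕᵇ.toℕ x)))
2^bits ℕᵇ.2[1+ x ] = ≤-trans (*-monoʳ-≤ 2 (2^bits x)) (n≤1+n _)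

2^-cancel-≤ : ∀ {a b} → 2 ^ a ≤ 2 ^ b → a ≤ b
2^-cancel-≤ {a} {b} le with a ≤? b
... | yes p = p
... | no ¬p = contradiction le (<⇒≱ (^-monoʳ-< 2 (s≤s (s≤s z≤n)) (≰⇒> ¬p)))

digits-fit : ∀ {v D} → v < 2 ^ D → length (digits v) ≤ D
digits-fit {v} lt rewrite digits-def v =
  2^-cancel-≤ (≤-trans (subst (λ z → 2 ^ length (bits (ℕᵇ.fromℕ v)) ≤ suc z) (ℕᵇₚ.toℕ-fromℕ v)
    (2^bits (ℕᵇ.fromℕ v))) lt)

nth : List ℕ → ℕ → ℕ
nth = lookupD 0

setAt : List ℕ → ℕ → ℕ → List ℕ
setAt []       zero    x = x ∷ []
setAt []       (suc i) x = 0 ∷ setAt [] i x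
setAt (v ∷ vs) zero    x = x ∷ vs
setAt (v ∷ vs) (suc i) x = v ∷ setAt vs i x

nth-setAt : ∀ vs i x → nth (setAt vs i x) i ≡ x
nth-setAt []       zero    x = refl
nth-setAt []       (suc i) x = nth-setAt [] i x
nth-setAt (v ∷ vs) zero    x = refl
nth-setAt (v ∷ vs) (suc i) x = nth-setAt vs i x

nth-setAt-other : ∀ vs i x {j} → j ≢ i → nth (setAt vs i x) j ≡ nth vs j
nth-setAt-other []       zero    x {zero}  ne = contradiction refl ne
nth-setAt-other []       zero    x {suc j} ne = refl
nth-setAt-other []       (suc i) x {zero}  ne = refl
nth-setAt-other []       (suc i) x {suc j} ne = nth-setAt-other [] i x (ne ∘ cong suc)
nth-setAt-other (v ∷ vs) zero    x {zero}  ne = contradiction refl ne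
nth-setAt-other (v ∷ vs) zero    x {suc j} ne = refl
nth-setAt-other (v ∷ vs) (suc i) x {zero}  ne = refl
nth-setAt-other (v ∷ vs) (suc i) x {suc j} ne = nth-setAt-other vs i x (ne ∘ cong suc)

opaque
  -- The register file holding ρ below g, the values vs from g on, and zeros above them.
  frame : (ℕ → ℕ) → ℕ → List ℕ → ℕ → ℕ
  frame ρ zero    vs j       = nth vs j
  frame ρ (suc g) vs zero    = ρ zero
  frame ρ (suc g) vs (suc j) = frame (ρ ∘ suc) g vs j

  frame-low : ∀ ρ g vs {j} → j < g → frame ρ g vs j ≡ ρ j
  frame-low ρ (suc g) vs {zero}  (s≤s p) = refl
  frame-low ρ (suc g) vs {suc j} (s≤s p) = frame-low (ρ ∘ suc) g vs p

  frame-high : ∀ ρ g vs i → frame ρ g vs (g + i) ≡ nth vs i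
  frame-high ρ zero    vs i = refl
  frame-high ρ (suc g) vs i = frame-high (ρ ∘ suc) g vs i

  frame-cong : ∀ ρ g {vs vs'} → nth vs ≗ nth vs' → frame ρ g vs ≗ frame ρ g vs'
  frame-cong ρ zero    e j       = e j
  frame-cong ρ (suc g) e zero    = refl
  frame-cong ρ (suc g) e (suc j) = frame-cong (ρ ∘ suc) g e j

  frame-set : ∀ ρ g vs i x → (frame ρ g vs) [ g + i ≔ x ] ≗ frame ρ g (setAt vs i x)
  frame-set ρ zero vs i x j with j ≟ i
  ... | yes refl = trans (≔-at (nth vs) i x) (sym (nth-setAt vs i x))
  ... | no ne    = trans (≔-other (nth vs) x ne) (sym (nth-setAt-other vs i x ne))
  frame-set ρ (suc g) vs i x zero    = refl
  frame-set ρ (suc g) vs i x (suc j) = frame-set (ρ ∘ suc) g vs i x j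

  frame-frame : ∀ ρ g vs us → frame (frame ρ g vs) (g + length vs) us ≗ frame ρ g (vs ++ us)
  frame-frame ρ zero    []       us j       = refl
  frame-frame ρ zero    (v ∷ vs) us zero    = refl
  frame-frame ρ zero    (v ∷ vs) us (suc j) = frame-frame ρ zero vs us j
  frame-frame ρ (suc g) vs       us zero    = refl
  frame-frame ρ (suc g) vs       us (suc j) = frame-frame (ρ ∘ suc) g vs us j

-- Counting loops on registers

module Arithmetic (K : ℕ) where
  open Registers K

  skip : Machine
  skip = prim (λ _ s → idle s)

  incs : ℕ → ℕ → Machine
  incs zero    r = skip
  incs (suc c) r = inc r ⨟ incs c r

  clear : ℕ → Machine
  clear r = countdown r (dec r)

  transfer : ℕ → ℕ → Machine
  transfer r s = countdown r (dec r ⨟ inc s)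

  module Frames (w : List Bool) (D : ℕ) where
    open Effects w D

    opaque
      store : ℕ → List Bool → (ℕ → ℕ) → Snapshot
      store ip out ρ = place ip out (digits ∘ ρ) 0 0

    opaque
      unfolding store

      store-def : ∀ ip out ρ → store ip out ρ ≡ place ip out (digits ∘ ρ) 0 0
      store-def ip out ρ = refl

      store-cong : ∀ {ip out ρ ρ'} → ρ ≗ ρ' → store ip out ρ ≋ store ip out ρ'
      store-cong e = place-cong (λ r → cong digits (e r))

      store-out : ∀ {ip out out' ρ} → out ≡ out' → store ip out ρ ≋ store ip out' ρ
      store-out = place-out

      store≤ : ∀ {ip out ρ} → pos (store ip out ρ) ≤ S
      store≤ = place≤ z≤n z≤n

      skip-store : ∀ {ip out ρ} → store ip out ρ ⟶[ skip ] store ip out ρ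
      skip-store {ip} {out} {ρ} = step-idle stay stay nothing (store ip out ρ) store≤ store≤

      inc-store : ∀ {ip out} ρ {r} → r < K → ρ r < 2 ^ D →
                  store ip out ρ ⟶[ inc r ] store ip out (ρ [ r ≔ suc (ρ r) ])
      inc-store ρ {r} r<K lt = conv ≋-refl
        (place-cong (λ r' → trans (cong (λ x → ((digits ∘ ρ) [ r ≔ x ]) r') (sym (digits-suc (ρ r))))
                              (≔-map digits ρ r (suc (ρ r)) r')))
        (inc-⟶ (digits ∘ ρ) r<K (digits-fit lt))

      dec-store : ∀ {ip out} ρ {r v} → r < K → ρ r ≡ suc v → ρ r < 2 ^ D →
                  store ip out ρ ⟶[ dec r ] store ip out (ρ [ r ≔ v ])
      dec-store ρ {r} {v} r<K e lt with digits-cons v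
      ... | d , ds , e' = conv ≋-refl
        (place-cong (λ r' → trans (cong (λ x → ((digits ∘ ρ) [ r ≔ x ]) r') decd) (≔-map digits ρ r v r')))
        (dec-⟶ (digits ∘ ρ) r<K (trans (cong digits e) e') (digits-fit lt))
        where
        decd : decL (digits (ρ r)) ≡ digits v
        decd = trans (cong decL (trans (cong digits e) (digits-suc v))) (decL-incL (digits v))

      copy-store : ∀ {ip out} ρ {r s} → r < K → s < K → r ≢ s → ρ s ≡ 0 → ρ r < 2 ^ D →
                   store ip out ρ ⟶[ copy r s ] store ip out (ρ [ s ≔ ρ r ])
      copy-store ρ {r} {s} r<K s<K r≢s e lt = conv ≋-refl (place-cong (≔-map digits ρ s (ρ r)))
        (copy-⟶ (digits ∘ ρ) r<K s<K r≢s (trans (cong digits e) digits-zero) (digits-fit lt))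

      encBin-bits : ∀ x → encBin x ≡ map digitSym (bits x)
      encBin-bits ℕᵇ.zero     = refl
      encBin-bits ℕᵇ.1+[2 x ] = cong (c0 ∷_) (encBin-bits x)
      encBin-bits ℕᵇ.2[1+ x ] = cong (c1 ∷_) (encBin-bits x)

      print-store : ∀ {ip out} ρ {r} → r < K → ρ r < 2 ^ D →
                    store ip out ρ ⟶[ print r ] store ip (out ++ concat (map csymBits (encNat (ρ r)))) ρ
      print-store {out = out} ρ {r} r<K lt = conv ≋-refl
        (place-out (cong (λ x → out ++ concat (map csymBits x)) (trans (cong (map digitSym) (digits-def (ρ r))) (sym (encBin-bits (ℕᵇ.fromℕ (ρ r)))))))
        (print-⟶ (digits ∘ ρ) r<K (digits-fit lt))

      emits-store : ∀ {ip out ρ} bs → store ip out ρ ⟶[ emits bs ] store ip (out ++ bs) ρ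
      emits-store bs = emits-at bs z≤n z≤n

      ifZero-yes : ∀ {ip out ρ r A B τ} → r < K → ρ r ≡ 0 → store ip out ρ ⟶[ A ] τ →
                   store ip out ρ ⟶[ ifZero r A B ] τ
      ifZero-yes {ρ = ρ} r<K e = ifZero-true (digits ∘ ρ) r<K (trans (cong digits e) digits-zero)

      ifZero-no : ∀ {ip out ρ r v A B τ} → r < K → ρ r ≡ suc v → store ip out ρ ⟶[ B ] τ →
                  store ip out ρ ⟶[ ifZero r A B ] τ
      ifZero-no {ρ = ρ} {v = v} r<K e with digits-cons v
      ... | d , ds , e' = ifZero-false (digits ∘ ρ) r<K (trans (cong digits e) e')

      -- Contents and output are indexed by the rounds left, `c`, and by the rounds done, `i`: the
      -- loop register shows `c`, while partial sums and printed text depend on `i`.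
      countdown-store : ∀ {ip r A} (ρ : ℕ → ℕ → ℕ → ℕ) (out : ℕ → ℕ → List Bool) n → r < K →
                        (∀ c i → ρ c i r ≡ c) →
                        (∀ c i → suc c + i ≡ n → store ip (out (suc c) i) (ρ (suc c) i) ⟶[ A ]
                                                 store ip (out c (suc i)) (ρ c (suc i))) →
                        ∀ c i → c + i ≡ n →
                        store ip (out c i) (ρ c i) ⟶[ countdown r A ] store ip (out 0 n) (ρ 0 n)
      countdown-store {ip} {r} {A} ρ out n r<K cnt body c i e =
        column⇒ z≤n o≤W ▷ loop c i e ▷ column⇐ z≤n o≤W
        where
        o≤W : suc r ≤ W
        o≤W = s≤s (<⇒≤ r<K)
        at : ℕ → ℕ → Snapshot
        at c i = place ip (out c i) (digits ∘ ρ c i) 0 (suc r)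
        loop : ∀ c i → c + i ≡ n → at c i ⟶[ while nonBlank (shift left (suc r) ⨟ A ⨟ shift right (suc r)) ] at 0 n
        loop zero    i refl = while-false (place≤ z≤n o≤W) (test-at {nonBlank} {at 0 i} (scan-at (digits ∘ ρ 0 i) 0 r<K)
                             (cong (λ x → maybe′ (λ _ → true) false (column x 0)) (trans (cong digits (cnt 0 i)) digits-zero)))
        loop (suc c) i e with digits-cons c
        ... | d , ds , e' = while-true (test-at {nonBlank} {at (suc c) i} (scan-at (digits ∘ ρ (suc c) i) 0 r<K)
                              (cong (λ x → maybe′ (λ _ → true) false (column x 0)) (trans (cong digits (cnt (suc c) i)) e')))
                              (column⇐ z≤n o≤W ▷ body c i e ▷ column⇒ z≤n o≤W) (loop c (suc i) (trans (+-suc c i) e))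

    module _ {ip : ℕ} {ρ : ℕ → ℕ} {g : ℕ} where
      ⟪_∣_⟫ : List ℕ → List Bool → Snapshot
      ⟪ vs ∣ out ⟫ = store ip out (frame ρ g vs)

      frame≡ : ∀ {vs i v} → nth vs i ≡ v → frame ρ g vs (g + i) ≡ v
      frame≡ {vs} {i} e = trans (frame-high ρ g vs i) e

      trim : ∀ {vs vs' out} → nth vs ≗ nth vs' → ⟪ vs ∣ out ⟫ ≋ ⟪ vs' ∣ out ⟫
      trim e = store-cong (frame-cong ρ g e)

      inc-frame : ∀ {vs out} i → g + i < K → nth vs i < 2 ^ D →
                  ⟪ vs ∣ out ⟫ ⟶[ inc (g + i) ] ⟪ setAt vs i (suc (nth vs i)) ∣ out ⟫
      inc-frame {vs} i lt fits = conv ≋-refl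
        (store-cong (λ j → trans (cong (λ x → (frame ρ g vs [ g + i ≔ suc x ]) j) (frame-high ρ g vs i))
                             (frame-set ρ g vs i _ j)))
        (inc-store (frame ρ g vs) lt (subst (_< 2 ^ D) (sym (frame-high ρ g vs i)) fits))

      dec-frame : ∀ {vs out} i {v} → g + i < K → nth vs i ≡ suc v → suc v < 2 ^ D →
                  ⟪ vs ∣ out ⟫ ⟶[ dec (g + i) ] ⟪ setAt vs i v ∣ out ⟫
      dec-frame {vs} i lt e fits = conv ≋-refl (store-cong (frame-set ρ g vs i _))
        (dec-store (frame ρ g vs) lt (frame≡ {vs} e) (subst (_< 2 ^ D) (sym (frame≡ {vs} e)) fits))

      copy-frame : ∀ {vs out} i j → g + i < K → g + j < K → i ≢ j → nth vs j ≡ 0 → nth vs i < 2 ^ D →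
                   ⟪ vs ∣ out ⟫ ⟶[ copy (g + i) (g + j) ] ⟪ setAt vs j (nth vs i) ∣ out ⟫
      copy-frame {vs} i j lt lt' ne e fits = conv ≋-refl
        (store-cong (λ k → trans (cong (λ x → (frame ρ g vs [ g + j ≔ x ]) k) (frame-high ρ g vs i))
                             (frame-set ρ g vs j _ k)))
        (copy-store (frame ρ g vs) lt lt' (ne ∘ +-cancelˡ-≡ g i j) (frame≡ {vs} e)
          (subst (_< 2 ^ D) (sym (frame-high ρ g vs i)) fits))

      fetch-frame : ∀ {vs out r} j {v} → r < g → g + j < K → ρ r ≡ v → nth vs j ≡ 0 → v < 2 ^ D →
                    ⟪ vs ∣ out ⟫ ⟶[ copy r (g + j) ] ⟪ setAt vs j v ∣ out ⟫
      fetch-frame {vs} {r = r} j r<g lt e e' fits = conv ≋-refl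
        (store-cong (λ k → trans (cong (λ x → (frame ρ g vs [ g + j ≔ x ]) k) val≡) (frame-set ρ g vs j _ k)))
        (copy-store (frame ρ g vs) (<-trans (≤-trans r<g (m≤m+n g j)) lt) lt (<⇒≢ (≤-trans r<g (m≤m+n g j)))
          (frame≡ {vs} e') (subst (_< 2 ^ D) (sym val≡) fits))
        where
        val≡ = trans (frame-low ρ g vs r<g) e

      countdown-frame : ∀ {A} r (vs : ℕ → ℕ → List ℕ) (out : ℕ → ℕ → List Bool) n → g + r < K →
                        (∀ c i → nth (vs c i) r ≡ c) →
                        (∀ c i → suc c + i ≡ n → ⟪ vs (suc c) i ∣ out (suc c) i ⟫ ⟶[ A ] ⟪ vs c (suc i) ∣ out c (suc i) ⟫) →
                        ∀ c i → c + i ≡ n →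
                        ⟪ vs c i ∣ out c i ⟫ ⟶[ countdown (g + r) A ] ⟪ vs 0 n ∣ out 0 n ⟫
      countdown-frame r vs out n lt cnt = countdown-store (λ c i → frame ρ g (vs c i)) out n lt
        (λ c i → frame≡ {vs c i} (cnt c i))

      clear-frame : ∀ {out} r (vs : ℕ → List ℕ) v → g + r < K → v < 2 ^ D → (∀ x → nth (vs x) r ≡ x) →
                    (∀ x y → setAt (vs x) r y ≡ vs y) →
                    ⟪ vs v ∣ out ⟫ ⟶[ clear (g + r) ] ⟪ vs 0 ∣ out ⟫
      clear-frame {out} r vs v lt fits get set =
        countdown-frame r (λ c _ → vs c) (λ _ _ → out) v lt (λ c _ → get c)
          (λ c i e → conv ≋-refl (store-cong (λ j → cong (λ xs → frame ρ g xs j) (set (suc c) c)))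
             (dec-frame {vs (suc c)} r lt (get (suc c)) (≤-<-trans (≤-trans (m≤m+n (suc c) i) (≤-reflexive e)) fits)))
          v 0 (+-identityʳ v)

      transfer-frame : ∀ {out} r s (vs : ℕ → ℕ → List ℕ) x y → g + r < K → g + s < K → x + y < 2 ^ D →
                       (∀ x y → nth (vs x y) r ≡ x) → (∀ x y → nth (vs x y) s ≡ y) →
                       (∀ x y z → setAt (vs x y) r z ≡ vs z y) → (∀ x y z → setAt (vs x y) s z ≡ vs x z) →
                       ⟪ vs x y ∣ out ⟫ ⟶[ transfer (g + r) (g + s) ] ⟪ vs 0 (x + y) ∣ out ⟫
      transfer-frame {out} r s vs x y lt lt' fits getr gets setr sets =
        countdown-frame r vs (λ _ _ → out) (x + y) lt getr
          (λ c i e → conv ≋-refl (store-cong (λ j → cong (λ xs → frame ρ g xs j) (setr (suc c) i c)))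
               (dec-frame {vs (suc c) i} r lt (getr (suc c) i) (≤-<-trans (≤-trans (m≤m+n (suc c) i) (≤-reflexive e)) fits))
             ▷ conv ≋-refl (store-cong (λ j → cong (λ xs → frame ρ g xs j)
                              (trans (cong (λ z → setAt (vs c i) s (suc z)) (gets c i)) (sets c i (suc i)))))
               (inc-frame {vs c i} s lt' (subst (_< 2 ^ D) (sym (gets c i))
                  (≤-<-trans (≤-trans (m≤n+m i (suc c)) (≤-reflexive e)) fits))))
          x y refl

    -- A subprogram sees the occupied registers `vs` as part of the lower ones and works in a frame
    -- of its own above them, so its specification can be used unchanged.
    nest : ∀ {ip ρ g M us out out'} vs → store ip out (frame (frame ρ g vs) (g + length vs) []) ⟶[ M ]
             store ip out' (frame (frame ρ g vs) (g + length vs) us) →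
           store ip out (frame ρ g vs) ⟶[ M ] store ip out' (frame ρ g (vs ++ us))
    nest {ρ = ρ} {g} {us = us} vs = conv
      (store-cong (λ j → trans (cong (λ xs → frame ρ g xs j) (sym (++-identityʳ vs))) (sym (frame-frame ρ g vs [] j))))
      (store-cong (frame-frame ρ g vs us))

-- Arithmetic expressions and output programs

infixl 6 _⊕_ _⊖_
infixl 7 _⊗_

data Exp (k : ℕ) : Set where
  lit         : ℕ → Exp k
  var         : Fin k → Exp k
  _⊕_ _⊖_ _⊗_ : Exp k → Exp k → Exp k
  sum<        : Exp k → Exp (suc k) → Exp k

sumTo : ℕ → (ℕ → ℕ) → ℕ
sumTo zero    f = 0
sumTo (suc n) f = sumTo n f + f n

eval : ∀ {k} → Exp k → Vec ℕ k → ℕ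
eval (lit c)    env = c
eval (var x)    env = lookup env x
eval (a ⊕ b)    env = eval a env + eval b env
eval (a ⊖ b)    env = eval a env ∸ eval b env
eval (a ⊗ b)    env = eval a env * eval b env
eval (sum< a b) env = sumTo (eval a env) (λ i → eval b (i ∷ env))

-- If the variables are at most M and 2 ≤ M, every intermediate value in the evaluation of e is at most
-- M ^ degree e.
degree : ∀ {k} → Exp k → ℕ
degree (lit c)    = c
degree (var x)    = 1
degree (a ⊕ b)    = suc (degree a + degree b)
degree (a ⊖ b)    = degree a + degree b
degree (a ⊗ b)    = degree a + degree b
degree (sum< a b) = degree a + suc (degree a) * degree b

-- An upper bound for the scratch registers of `compile`. The demands of the two arguments are added
-- although the registers of the first are free again, apart from its result, when the second
-- begins.
registers : ∀ {k} → Exp k → ℕ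
registers (lit c)    = 1
registers (var x)    = 1
registers (a ⊕ b)    = registers a + suc (registers b)
registers (a ⊖ b)    = registers a + suc (registers b)
registers (a ⊗ b)    = registers a + (4 + registers b)
registers (sum< a b) = registers a + (4 + registers b)

module _ {M : ℕ} (2≤M : 2 ≤ M) where
  private
    1≤M : 1 ≤ M
    1≤M = ≤-trans (s≤s z≤n) 2≤M

    instance
      M≢0 : NonZero M
      M≢0 = >-nonZero 1≤M

  power-mono : ∀ {a b} → a ≤ b → M ^ a ≤ M ^ b
  power-mono = ^-monoʳ-≤ M

  1≤power : ∀ a → 1 ≤ M ^ a
  1≤power a = power-mono {0} {a} z≤n

  n≤power : ∀ n → n ≤ M ^ n
  n≤power zero    = z≤n
  n≤power (suc n) = ≤-trans (≤-trans (+-mono-≤ (1≤power n) (n≤power n)) (≤-reflexive (cong (M ^ n +_) (sym (+-identityʳ _)))))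
                      (*-monoˡ-≤ (M ^ n) 2≤M)

  sum-power : ∀ {x y a b} → x ≤ M ^ a → y ≤ M ^ b → x + y ≤ M ^ suc (a + b)
  sum-power {a = a} {b} p q = ≤-trans (+-mono-≤ (≤-trans p (power-mono (m≤m+n a b))) (≤-trans q (power-mono (m≤n+m b a))))
    (≤-trans (≤-reflexive (cong (M ^ (a + b) +_) (sym (+-identityʳ _)))) (*-monoˡ-≤ (M ^ (a + b)) 2≤M))

  product-power : ∀ {x y a b} → x ≤ M ^ a → y ≤ M ^ b → x * y ≤ M ^ (a + b)
  product-power {a = a} {b} p q = ≤-trans (*-mono-≤ p q) (≤-reflexive (sym (^-distribˡ-+-* M a b)))

  sumTo-≤ : ∀ n f {B} → (∀ {i} → i < n → f i ≤ B) → sumTo n f ≤ n * B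
  sumTo-≤ zero    f h = z≤n
  sumTo-≤ (suc n) f {B} h = ≤-trans (+-mono-≤ (sumTo-≤ n f (h ∘ m≤n⇒m≤1+n)) (h ≤-refl)) (≤-reflexive (+-comm (n * B) B))

Bounded : ∀ {k} → ℕ → Vec ℕ k → Set
Bounded M env = ∀ x → lookup env x ≤ M

extend : ∀ {k M i} {env : Vec ℕ k} → i ≤ M → Bounded M env → Bounded M (i ∷ env)
extend p b zero    = p
extend p b (suc x) = b x

weaken : ∀ {M : ℕ} d {v} → 2 ≤ M → v ≤ M → v ≤ M ^ suc d
weaken {M} d 2≤M p = ≤-trans p (≤-trans (≤-reflexive (sym (*-identityʳ M))) (*-monoʳ-≤ M (1≤power 2≤M d)))

eval-≤ : ∀ {k M} (e : Exp k) {env} → 2 ≤ M → Bounded M env → eval e env ≤ M ^ degree e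
eval-≤ (lit c) 2≤M b = n≤power 2≤M c
eval-≤ (var x) 2≤M b = weaken 0 2≤M (b x)
eval-≤ (a ⊕ c) 2≤M b = sum-power 2≤M {a = degree a} (eval-≤ a 2≤M b) (eval-≤ c 2≤M b)
eval-≤ (a ⊖ c) {env} 2≤M b = ≤-trans (m∸n≤m (eval a env) (eval c env))
  (≤-trans (eval-≤ a 2≤M b) (power-mono 2≤M (m≤m+n (degree a) (degree c))))
eval-≤ (a ⊗ c) 2≤M b = product-power 2≤M {a = degree a} (eval-≤ a 2≤M b) (eval-≤ c 2≤M b)
eval-≤ {M = M} (sum< a c) {env} 2≤M b =
  ≤-trans (sumTo-≤ 2≤M (eval a env) _ (λ i<n → body (<⇒≤ i<n)))
    (product-power 2≤M {a = degree a} {suc (degree a) * degree c} (eval-≤ a 2≤M b) ≤-refl)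
  where
  body : ∀ {i} → i ≤ eval a env → eval c (i ∷ env) ≤ M ^ (suc (degree a) * degree c)
  body i≤ = ≤-trans
    -- The summation index may exceed `M`, so in the body `M ^ suc (degree a)` takes the place of
    -- `M`. This is the origin of the product in the degree of a sum.
    (eval-≤ {M = M ^ suc (degree a)} c (weaken (degree a) 2≤M 2≤M)
      (extend (≤-trans i≤ (≤-trans (eval-≤ a 2≤M b) (power-mono 2≤M (n≤1+n (degree a))))) (λ x → weaken (degree a) 2≤M (b x))))
    (≤-reflexive (^-*-assoc M (suc (degree a)) (degree c)))

data Gen (k : ℕ) : Set where
  char : CSym → Gen k
  num  : Exp k → Gen k
  _⊙_  : Gen k → Gen k → Gen k
  unless : Exp k → Gen k → Gen k → Gen k
  for  : Exp k → Gen (suc k) → Gen k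

infixr 5 _⊙_

concatTo : ℕ → (ℕ → List CSym) → List CSym
concatTo zero    f = []
concatTo (suc n) f = concatTo n f ++ f n

isZero : ℕ → Bool
isZero zero    = true
isZero (suc _) = false

text : ∀ {k} → Gen k → Vec ℕ k → List CSym
text (char c)        env = [ c ]
text (num e)        env = encNat (eval e env)
text (g ⊙ h)        env = text g env ++ text h env
text (unless e g h) env = if isZero (eval e env) then text g env else text h env
text (for e g)      env = concatTo (eval e env) (λ i → text g (i ∷ env))

gdegree : ∀ {k} → Gen k → ℕ
gdegree (char c)        = 0
gdegree (num e)        = degree e
gdegree (g ⊙ h)        = gdegree g + gdegree h
gdegree (unless e g h) = degree e + (gdegree g + gdegree h)
gdegree (for e g)      = degree e + suc (degree e) * gdegree g

gregisters : ∀ {k} → Gen k → ℕ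
gregisters (char c)        = 0
gregisters (num e)        = registers e
gregisters (g ⊙ h)        = gregisters g + gregisters h
gregisters (unless e g h) = registers e + (gregisters g + gregisters h)
gregisters (for e g)      = registers e + (2 + gregisters g)

registers≥1 : ∀ {k} (e : Exp k) → 1 ≤ registers e
registers≥1 (lit c)    = ≤-refl
registers≥1 (var x)    = ≤-refl
registers≥1 (a ⊕ b)    = ≤-trans (registers≥1 a) (m≤m+n _ _)
registers≥1 (a ⊖ b)    = ≤-trans (registers≥1 a) (m≤m+n _ _)
registers≥1 (a ⊗ b)    = ≤-trans (registers≥1 a) (m≤m+n _ _)
registers≥1 (sum< a b) = ≤-trans (registers≥1 a) (m≤m+n _ _)

bind : ∀ {k} → ℕ → (Fin k → ℕ) → Fin (suc k) → ℕ
bind r m zero    = r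
bind r m (suc x) = m x

-- Compiling expressions and output programs to machines

module Compiler (K : ℕ) where
  open Registers K
  open Arithmetic K

  -- compile e m g puts the value of e into register g; variable x is kept in register m x, and all
  -- registers from g on are free.
  compile : ∀ {k} → Exp k → (Fin k → ℕ) → ℕ → Machine
  compile (lit c)    m g = incs c (g + 0)
  compile (var x)    m g = copy (m x) (g + 0)
  compile (a ⊕ b)    m g = compile a m g ⨟ compile b m (g + 1) ⨟ transfer (g + 1) (g + 0)
  compile (a ⊖ b)    m g = compile a m g ⨟ compile b m (g + 1) ⨟
                           countdown (g + 1) (dec (g + 1) ⨟ ifZero (g + 0) skip (dec (g + 0)))
  compile (a ⊗ b)    m g = compile a m g ⨟ compile b m (g + 1) ⨟
                           countdown (g + 0) (dec (g + 0) ⨟ copy (g + 1) (g + 2) ⨟ transfer (g + 2) (g + 3)) ⨟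
                           clear (g + 1) ⨟ transfer (g + 3) (g + 0)
  compile (sum< a b) m g = compile a m g ⨟
                           countdown (g + 0) (dec (g + 0) ⨟ compile b (bind (g + 2) m) (g + 3) ⨟
                                              transfer (g + 3) (g + 1) ⨟ inc (g + 2)) ⨟
                           clear (g + 2) ⨟ transfer (g + 1) (g + 0)

  generate : ∀ {k} → Gen k → (Fin k → ℕ) → ℕ → Machine
  generate (char c)        m g = emits (csymBits c)
  generate (num e)        m g = compile e m g ⨟ print (g + 0) ⨟ clear (g + 0)
  generate (a ⊙ b)        m g = generate a m g ⨟ generate b m g
  generate (unless e a b) m g = compile e m g ⨟ ifZero (g + 0) (generate a m g) (clear (g + 0) ⨟ generate b m g)
  generate (for e a)      m g = compile e m g ⨟
                                countdown (g + 0) (dec (g + 0) ⨟ generate a (bind (g + 1) m) (g + 2) ⨟ inc (g + 1)) ⨟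
                                clear (g + 1)

  module Correct (w : List Bool) (D : ℕ) where
    open Effects w D
    open Frames w D

    module _ {ip : ℕ} where

      record Stored {k} (ρ : ℕ → ℕ) (g : ℕ) (m : Fin k → ℕ) (env : Vec ℕ k) : Set where
        constructor stored
        field at : ∀ x → m x < g × ρ (m x) ≡ lookup env x
      open Stored

      shift-env : ∀ {k ρ g} {m : Fin k → ℕ} {env} vs → Stored ρ g m env → Stored (frame ρ g vs) (g + length vs) m env
      shift-env {ρ = ρ} {g} vs h .at x = ≤-trans (h .at x .proj₁) (m≤m+n g (length vs)) ,
                                         trans (frame-low ρ g vs (h .at x .proj₁)) (h .at x .proj₂)

      bind-env : ∀ {k ρ g i} {m : Fin k → ℕ} {env} vs j → j < length vs → nth vs j ≡ i → Stored ρ g m env →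
                 Stored (frame ρ g vs) (g + length vs) (bind (g + j) m) (i ∷ env)
      bind-env {ρ = ρ} {g} vs j lt e h .at zero    = +-monoʳ-< g lt , trans (frame-high ρ g vs j) e
      bind-env {ρ = ρ} {g} vs j lt e h .at (suc x) = shift-env vs h .at x

      ∸-step : ∀ a i → (∃ λ v → a ∸ i ≡ suc v × a ∸ suc i ≡ v) ⊎ (a ∸ i ≡ 0 × a ∸ suc i ≡ 0)
      ∸-step zero    zero    = inj₂ (refl , refl)
      ∸-step zero    (suc i) = inj₂ (refl , refl)
      ∸-step (suc a) zero    = inj₁ (a , refl , refl)
      ∸-step (suc a) (suc i) = ∸-step a i

      private
        reg< : ∀ {g i n} → i < n → g + n ≤ K → g + i < K
        reg< {g} p le = ≤-trans (+-monoʳ-< g p) le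

        part : ∀ g {n} a {b} → g + n ≤ K → a + b ≤ n → (g + a) + b ≤ K
        part g a {b} le p = ≤-trans (≤-reflexive (+-assoc g a b)) (≤-trans (+-monoʳ-≤ g p) le)

        part₀ : ∀ g {n b} → g + n ≤ K → b ≤ n → g + b ≤ K
        part₀ g le p = ≤-trans (+-monoʳ-≤ g p) le

      -- The hypothesis on `degree e` keeps every intermediate value below `2 ^ D`, hence within `D`
      -- digits, which is what all register operations ask for.
      compile-⟶ : ∀ {k M out} (e : Exp k) {m env ρ g} → 2 ≤ M → Bounded M env → M ^ degree e < 2 ^ D →
                  g + registers e ≤ K → Stored ρ g m env →
                  store ip out (frame ρ g []) ⟶[ compile e m g ] store ip out (frame ρ g [ eval e env ])
      compile-⟶ {M = M} {out} (lit c) {ρ = ρ} {g} 2≤M b fits regs h =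
        conv (trim λ { zero → refl ; (suc _) → refl }) (trim (λ j → cong (λ x → nth [ x ] j) (+-identityʳ c)))
          (go c 0 (subst (_< 2 ^ D) (sym (+-identityʳ c)) (≤-<-trans (n≤power 2≤M c) fits)))
        where
        go : ∀ c v → c + v < 2 ^ D → store ip out (frame ρ g [ v ]) ⟶[ incs c (g + 0) ] store ip out (frame ρ g [ c + v ])
        go zero    v lt = skip-store
        go (suc c) v lt = inc-frame {vs = [ v ]} 0 (reg< (s≤s z≤n) regs) (≤-<-trans (m≤n+m v (suc c)) lt) ▷
          conv ≋-refl (trim (λ j → cong (λ x → nth [ x ] j) (+-suc c v))) (go c (suc v) (subst (_< 2 ^ D) (sym (+-suc c v)) lt))
      compile-⟶ (var x) {ρ = ρ} {g} 2≤M b fits regs h =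
        fetch-frame {vs = []} 0 (h .at x .proj₁) (reg< (s≤s z≤n) regs) (h .at x .proj₂) refl
          (≤-<-trans (weaken 0 2≤M (b x)) fits)
      compile-⟶ {M = M} {out} (a ⊕ c) {m} {env} {ρ} {g} 2≤M b fits regs h =
        compile-⟶ a 2≤M b (≤-<-trans (power-mono 2≤M (≤-trans (m≤m+n (degree a) (degree c)) (n≤1+n _))) fits)
          (part₀ g regs (m≤m+n (registers a) _)) h
        ▷ nest [ va ] (compile-⟶ c 2≤M b (≤-<-trans (power-mono 2≤M (≤-trans (m≤n+m (degree c) (degree a)) (n≤1+n _))) fits)
            (part g 1 regs (m≤n+m _ (registers a))) (shift-env [ va ] h))
        ▷ conv ≋-refl (trim (λ { zero → +-comm vc va ; (suc zero) → refl ; (suc (suc _)) → refl }))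
           (transfer-frame 1 0 (λ x y → y ∷ x ∷ []) vc va (reg< (r≥ 1 ≤-refl) regs) (reg< (r≥ 0 z≤n) regs)
             (≤-<-trans (≤-trans (≤-reflexive (+-comm vc va)) (eval-≤ (a ⊕ c) 2≤M b)) fits)
             (λ _ _ → refl) (λ _ _ → refl) (λ _ _ _ → refl) (λ _ _ _ → refl))
        where
        va = eval a env
        vc = eval c env
        r≥ : ∀ i → i ≤ 1 → i < registers a + suc (registers c)
        r≥ i p = ≤-trans (s≤s p) (+-mono-≤ (registers≥1 a) (s≤s z≤n))
      compile-⟶ {M = M} {out} (a ⊖ c) {m} {env} {ρ} {g} 2≤M b fits regs h =
        compile-⟶ a 2≤M b (≤-<-trans (power-mono 2≤M (m≤m+n (degree a) (degree c))) fits)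
          (part₀ g regs (m≤m+n (registers a) _)) h
        ▷ nest [ va ] (compile-⟶ c 2≤M b (≤-<-trans (power-mono 2≤M (m≤n+m (degree c) (degree a))) fits)
            (part g 1 regs (m≤n+m _ (registers a))) (shift-env [ va ] h))
        ▷ conv ≋-refl (trim (λ { zero → refl ; (suc zero) → refl ; (suc (suc _)) → refl }))
           -- The first register is lowered once per round and stays at zero when it gets there,
           -- which yields truncated subtraction.
           (countdown-frame 1 (λ x i → (va ∸ i) ∷ x ∷ []) (λ _ _ → out) vc r1 (λ _ _ → refl) body vc 0 (+-identityʳ vc))
        where
        va = eval a env
        vc = eval c env
        r≥ : ∀ i → i ≤ 1 → i < registers a + suc (registers c)
        r≥ i p = ≤-trans (s≤s p) (+-mono-≤ (registers≥1 a) (s≤s z≤n))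
        r0 : g + 0 < K
        r0 = reg< (r≥ 0 z≤n) regs
        r1 : g + 1 < K
        r1 = reg< (r≥ 1 ≤-refl) regs
        fit-a : ∀ {v} → v ≤ va → v < 2 ^ D
        fit-a p = ≤-<-trans (≤-trans p (≤-trans (eval-≤ a 2≤M b) (power-mono 2≤M (m≤m+n (degree a) (degree c))))) fits
        fit-c : ∀ {v} → v ≤ vc → v < 2 ^ D
        fit-c p = ≤-<-trans (≤-trans p (≤-trans (eval-≤ c 2≤M b) (power-mono 2≤M (m≤n+m (degree c) (degree a))))) fits
        body : ∀ x i → suc x + i ≡ vc →
               store ip out (frame ρ g ((va ∸ i) ∷ suc x ∷ [])) ⟶[ dec (g + 1) ⨟ ifZero (g + 0) skip (dec (g + 0)) ]
               store ip out (frame ρ g ((va ∸ suc i) ∷ x ∷ []))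
        body x i e with ∸-step va i
        ... | inj₁ (v , p , q) = dec-frame {vs = (va ∸ i) ∷ suc x ∷ []} 1 r1 refl (fit-c (m+n≤o⇒m≤o (suc x) (≤-reflexive e)))
              ▷ ifZero-no r0 (frame≡ {ip} {vs = (va ∸ i) ∷ x ∷ []} p)
                  (conv ≋-refl (trim (λ { zero → sym q ; (suc zero) → refl ; (suc (suc _)) → refl }))
                    (dec-frame {vs = (va ∸ i) ∷ x ∷ []} 0 r0 p (fit-a (≤-trans (≤-reflexive (sym p)) (m∸n≤m va i)))))
        ... | inj₂ (p , q) = dec-frame {vs = (va ∸ i) ∷ suc x ∷ []} 1 r1 refl (fit-c (m+n≤o⇒m≤o (suc x) (≤-reflexive e)))
              ▷ ifZero-yes r0 (frame≡ {ip} {vs = (va ∸ i) ∷ x ∷ []} p)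
                  (conv ≋-refl (trim (λ { zero → trans p (sym q) ; (suc zero) → refl ; (suc (suc _)) → refl })) skip-store)
      compile-⟶ {M = M} {out} (a ⊗ c) {m} {env} {ρ} {g} 2≤M b fits regs h =
        compile-⟶ a 2≤M b (≤-<-trans (power-mono 2≤M (m≤m+n (degree a) (degree c))) fits)
          (part₀ g regs (m≤m+n (registers a) _)) h
        ▷ nest [ va ] (compile-⟶ c 2≤M b (≤-<-trans (power-mono 2≤M (m≤n+m (degree c) (degree a))) fits)
            (part g 1 regs (≤-trans (s≤s (m≤n+m _ 3)) (m≤n+m _ (registers a)))) (shift-env [ va ] h))
        ▷ conv (trim (λ { zero → refl ; (suc zero) → refl ; (suc (suc zero)) → refl ; (suc (suc (suc zero))) → refl ; (suc (suc (suc (suc _)))) → refl })) ≋-refl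
           (countdown-frame 0 (λ x i → x ∷ vc ∷ 0 ∷ i * vc ∷ []) (λ _ _ → out) va (r 0) (λ _ _ → refl) body va 0 (+-identityʳ va))
        ▷ clear-frame 1 (λ x → 0 ∷ x ∷ 0 ∷ va * vc ∷ []) vc (r 1) (fit-c ≤-refl) (λ _ → refl) (λ _ _ → refl)
        ▷ conv ≋-refl (trim (λ { zero → +-identityʳ (va * vc) ; (suc zero) → refl ; (suc (suc zero)) → refl ; (suc (suc (suc zero))) → refl ; (suc (suc (suc (suc _)))) → refl }))
           (transfer-frame 3 0 (λ x y → y ∷ 0 ∷ 0 ∷ x ∷ []) (va * vc) 0 (r 3) (r 0)
             (≤-<-trans (≤-trans (≤-reflexive (+-identityʳ _)) (eval-≤ (a ⊗ c) 2≤M b)) fits)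
             (λ _ _ → refl) (λ _ _ → refl) (λ _ _ _ → refl) (λ _ _ _ → refl))
        where
        va = eval a env
        vc = eval c env
        r : ∀ i {p : True (i <? 4)} → g + i < K
        r i {p} = reg< (≤-trans (toWitness p) (≤-trans (m≤m+n 4 (registers c)) (m≤n+m _ (registers a)))) regs
        fit-a : ∀ {v} → v ≤ va → v < 2 ^ D
        fit-a p = ≤-<-trans (≤-trans p (≤-trans (eval-≤ a 2≤M b) (power-mono 2≤M (m≤m+n (degree a) (degree c))))) fits
        fit-c : ∀ {v} → v ≤ vc → v < 2 ^ D
        fit-c p = ≤-<-trans (≤-trans p (≤-trans (eval-≤ c 2≤M b) (power-mono 2≤M (m≤n+m (degree c) (degree a))))) fits
        body : ∀ x i → suc x + i ≡ va →
               store ip out (frame ρ g (suc x ∷ vc ∷ 0 ∷ i * vc ∷ []))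
                 ⟶[ dec (g + 0) ⨟ copy (g + 1) (g + 2) ⨟ transfer (g + 2) (g + 3) ]
               store ip out (frame ρ g (x ∷ vc ∷ 0 ∷ suc i * vc ∷ []))
        body x i e =
          dec-frame {vs = suc x ∷ vc ∷ 0 ∷ i * vc ∷ []} 0 (r 0) refl (fit-a (m+n≤o⇒m≤o (suc x) (≤-reflexive e)))
          -- `transfer` empties its source, so each round adds a fresh copy of the second factor to
          -- the product.
          ▷ copy-frame {vs = x ∷ vc ∷ 0 ∷ i * vc ∷ []} 1 2 (r 1) (r 2) (λ ()) refl (fit-c ≤-refl)
          ▷ transfer-frame 2 3 (λ y z → x ∷ vc ∷ y ∷ z ∷ []) vc (i * vc) (r 2) (r 3)
              (≤-<-trans (≤-trans (*-monoˡ-≤ vc (≤-trans (m≤n+m (suc i) x) (≤-reflexive (trans (+-suc x i) e)))) (eval-≤ (a ⊗ c) 2≤M b)) fits)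
              (λ _ _ → refl) (λ _ _ → refl) (λ _ _ _ → refl) (λ _ _ _ → refl)
      compile-⟶ {M = M} {out} (sum< a c) {m} {env} {ρ} {g} 2≤M b fits regs h =
        compile-⟶ a 2≤M b (≤-<-trans (power-mono 2≤M (m≤m+n (degree a) _)) fits)
          (part₀ g regs (m≤m+n (registers a) _)) h
        ▷ conv (trim (λ { zero → refl ; (suc zero) → refl ; (suc (suc zero)) → refl ; (suc (suc (suc _))) → refl })) ≋-refl
           -- The registers hold the rounds left, the partial sum and the index; the frame of the
           -- summand begins above them.
           (countdown-frame 0 (λ x i → x ∷ sumTo i f ∷ i ∷ []) (λ _ _ → out) va (r 0) (λ _ _ → refl) body va 0 (+-identityʳ va))
        ▷ clear-frame 2 (λ x → 0 ∷ sumTo va f ∷ x ∷ []) va (r 2) (fit-a ≤-refl) (λ _ → refl) (λ _ _ → refl)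
        ▷ conv ≋-refl (trim (λ { zero → +-identityʳ (sumTo va f) ; (suc zero) → refl ; (suc (suc zero)) → refl ; (suc (suc (suc _))) → refl }))
           (transfer-frame 1 0 (λ x y → y ∷ x ∷ 0 ∷ []) (sumTo va f) 0 (r 1) (r 0)
             (≤-<-trans (≤-trans (≤-reflexive (+-identityʳ _)) (eval-≤ (sum< a c) 2≤M b)) fits)
             (λ _ _ → refl) (λ _ _ → refl) (λ _ _ _ → refl) (λ _ _ _ → refl))
        where
        va = eval a env
        f : ℕ → ℕ
        f i = eval c (i ∷ env)
        r : ∀ i {p : True (i <? 4)} → g + i < K
        r i {p} = reg< (≤-trans (toWitness p) (≤-trans (m≤m+n 4 (registers c)) (m≤n+m _ (registers a)))) regs
        fit-a : ∀ {v} → v ≤ va → v < 2 ^ D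
        fit-a p = ≤-<-trans (≤-trans p (≤-trans (eval-≤ a 2≤M b) (power-mono 2≤M (m≤m+n (degree a) _)))) fits
        sumTo-mono : ∀ {i j} → i ≤ j → sumTo i f ≤ sumTo j f
        sumTo-mono {j = zero}  z≤n = z≤n
        sumTo-mono {i} {suc j} p with m≤n⇒m<n∨m≡n p
        ... | inj₁ (s≤s q) = ≤-trans (sumTo-mono q) (m≤m+n _ _)
        ... | inj₂ refl    = ≤-refl
        body : ∀ x i → suc x + i ≡ va →
               store ip out (frame ρ g (suc x ∷ sumTo i f ∷ i ∷ []))
                 ⟶[ dec (g + 0) ⨟ compile c (bind (g + 2) m) (g + 3) ⨟ transfer (g + 3) (g + 1) ⨟ inc (g + 2) ]
               store ip out (frame ρ g (x ∷ sumTo (suc i) f ∷ suc i ∷ []))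
        body x i e =
          dec-frame {vs = suc x ∷ sumTo i f ∷ i ∷ []} 0 (r 0) refl (fit-a (m+n≤o⇒m≤o (suc x) (≤-reflexive e)))
          ▷ nest {us = [ f i ]} vs (compile-⟶ {M = M ^ suc (degree a)} c (weaken (degree a) 2≤M 2≤M)
              (extend (≤-trans i≤ (≤-trans (eval-≤ a 2≤M b) (power-mono 2≤M (n≤1+n (degree a))))) (λ y → weaken (degree a) 2≤M (b y)))
              (≤-<-trans (≤-trans (≤-reflexive (^-*-assoc M (suc (degree a)) (degree c))) (power-mono 2≤M (m≤n+m _ (degree a)))) fits)
              (part g 3 regs (≤-trans (s≤s (s≤s (s≤s (n≤1+n _)))) (m≤n+m _ (registers a))))
              (bind-env vs 2 ≤-refl refl h))
          ▷ transfer-frame 3 1 (λ y z → x ∷ z ∷ i ∷ y ∷ []) (f i) (sumTo i f) (r 3) (r 1)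
              (≤-<-trans (≤-trans (≤-reflexive (+-comm (f i) (sumTo i f)))
                (≤-trans (sumTo-mono {suc i} {va} i<) (eval-≤ (sum< a c) 2≤M b))) fits)
              (λ _ _ → refl) (λ _ _ → refl) (λ _ _ _ → refl) (λ _ _ _ → refl)
          ▷ conv ≋-refl (trim (λ { zero → refl ; (suc zero) → +-comm (f i) (sumTo i f) ; (suc (suc zero)) → refl
                                 ; (suc (suc (suc zero))) → refl ; (suc (suc (suc (suc _)))) → refl }))
             (inc-frame {vs = x ∷ f i + sumTo i f ∷ i ∷ 0 ∷ []} 2 (r 2) (fit-a i≤))
          where
          vs : List ℕ
          vs = x ∷ sumTo i f ∷ i ∷ []
          i< : suc i ≤ va
          i< = ≤-trans (m≤n+m (suc i) x) (≤-reflexive (trans (+-suc x i) e))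
          i≤ : i ≤ va
          i≤ = <⇒≤ i<

      textBits : List CSym → List Bool
      textBits cs = concat (map csymBits cs)

      textBits-++ : ∀ cs ds → textBits (cs ++ ds) ≡ textBits cs ++ textBits ds
      textBits-++ cs ds = trans (cong concat (map-++ csymBits cs ds)) (sym (concat-++ (map csymBits cs) (map csymBits ds)))

      private
        out-++ : ∀ {ρ} out cs ds → store ip ((out ++ textBits cs) ++ textBits ds) ρ ≋ store ip (out ++ textBits (cs ++ ds)) ρ
        out-++ out cs ds = store-out (trans (++-assoc out (textBits cs) (textBits ds)) (cong (out ++_) (sym (textBits-++ cs ds))))

      generate-⟶ : ∀ {k M out} (a : Gen k) {m env ρ g} → 2 ≤ M → Bounded M env → M ^ gdegree a < 2 ^ D →
                   g + gregisters a ≤ K → Stored ρ g m env →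
                   store ip out (frame ρ g []) ⟶[ generate a m g ] store ip (out ++ textBits (text a env)) (frame ρ g [])
      generate-⟶ (char c) 2≤M b fits regs h =
        conv ≋-refl (store-out (cong (_ ++_) (sym (++-identityʳ (csymBits c))))) (emits-store (csymBits c))
      generate-⟶ {M = M} {out} (num e) {m} {env} {ρ} {g} 2≤M b fits regs h =
        compile-⟶ e 2≤M b fits regs h
        ▷ conv ≋-refl (store-out (cong (λ v → out ++ textBits (encNat v)) (frame-high ρ g [ eval e env ] 0)))
            (print-store (frame ρ g [ eval e env ]) r0
              (subst (_< 2 ^ D) (sym (frame-high ρ g [ eval e env ] 0)) fit))
        ▷ conv ≋-refl (trim λ { zero → refl ; (suc _) → refl })
            (clear-frame 0 (λ x → [ x ]) (eval e env) r0 fit (λ _ → refl) (λ _ _ → refl))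
        where
        r0 : g + 0 < K
        r0 = reg< (registers≥1 e) regs
        fit : eval e env < 2 ^ D
        fit = ≤-<-trans (eval-≤ e 2≤M b) fits
      generate-⟶ {out = out} (a₁ ⊙ a₂) {env = env} {g = g} 2≤M b fits regs h =
        conv ≋-refl (out-++ out (text a₁ env) (text a₂ env))
          (generate-⟶ a₁ 2≤M b (≤-<-trans (power-mono 2≤M (m≤m+n (gdegree a₁) _)) fits) (part₀ g regs (m≤m+n (gregisters a₁) _)) h
           ▷ generate-⟶ a₂ 2≤M b (≤-<-trans (power-mono 2≤M (m≤n+m _ (gdegree a₁))) fits)
               (part₀ g regs (m≤n+m _ (gregisters a₁))) h)
      generate-⟶ {M = M} {out} (unless e a₁ a₂) {m} {env} {ρ} {g} 2≤M b fits regs h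
        with eval e env in eq | compile-⟶ {out = out} e {m} {env} {ρ} {g} 2≤M b (≤-<-trans (power-mono 2≤M (m≤m+n (degree e) _)) fits)
                                  (part₀ g regs (m≤m+n (registers e) _)) h
      ... | zero  | t = t ▷ ifZero-yes r0 (frame≡ {ip} {vs = [ 0 ]} refl)
            (conv (trim λ { zero → refl ; (suc _) → refl }) ≋-refl
              (generate-⟶ a₁ {env = env} 2≤M b (≤-<-trans (power-mono 2≤M (≤-trans (m≤m+n (gdegree a₁) _) (m≤n+m _ (degree e)))) fits)
                (part₀ g regs (≤-trans (m≤m+n (gregisters a₁) _) (m≤n+m _ (registers e)))) h))
        where
        r0 : g + 0 < K
        r0 = reg< (≤-trans (registers≥1 e) (m≤m+n _ _)) regs
      ... | suc v | t = t ▷ ifZero-no r0 (frame≡ {ip} {vs = [ suc v ]} refl)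
            (conv ≋-refl (trim λ { zero → refl ; (suc _) → refl })
               (clear-frame 0 (λ x → [ x ]) (suc v) r0 fit (λ _ → refl) (λ _ _ → refl))
             ▷ generate-⟶ a₂ {env = env} 2≤M b (≤-<-trans (power-mono 2≤M (≤-trans (m≤n+m (gdegree a₂) (gdegree a₁)) (m≤n+m _ (degree e)))) fits)
                (part₀ g regs (≤-trans (m≤n+m (gregisters a₂) (gregisters a₁)) (m≤n+m _ (registers e)))) h)
        where
        r0 : g + 0 < K
        r0 = reg< (≤-trans (registers≥1 e) (m≤m+n _ _)) regs
        fit : suc v < 2 ^ D
        fit = ≤-<-trans (≤-trans (≤-reflexive (sym eq)) (≤-trans (eval-≤ e 2≤M b) (power-mono 2≤M (m≤m+n (degree e) _)))) fits
      generate-⟶ {M = M} {out} (for e a) {m} {env} {ρ} {g} 2≤M b fits regs h =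
        compile-⟶ e 2≤M b (≤-<-trans (power-mono 2≤M (m≤m+n (degree e) _)) fits) (part₀ g regs (m≤m+n (registers e) _)) h
        ▷ conv (≋-trans (trim (λ { zero → refl ; (suc zero) → refl ; (suc (suc _)) → refl })) (store-out (sym (++-identityʳ out)))) ≋-refl
           (countdown-frame 0 (λ x i → x ∷ i ∷ []) (λ _ i → out ++ textBits (concatTo i f)) v (r 0) (λ _ _ → refl)
             body v 0 (+-identityʳ v))
        ▷ conv ≋-refl (trim (λ { zero → refl ; (suc zero) → refl ; (suc (suc _)) → refl }))
            (clear-frame 1 (λ x → 0 ∷ x ∷ []) v (r 1) (fit ≤-refl) (λ _ → refl) (λ _ _ → refl))
        where
        v = eval e env
        f : ℕ → List CSym
        f i = text a (i ∷ env)
        r : ∀ i {p : True (i <? 2)} → g + i < K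
        r i {p} = reg< (≤-trans (toWitness p) (≤-trans (m≤m+n 2 (gregisters a)) (m≤n+m _ (registers e)))) regs
        fit : ∀ {x} → x ≤ v → x < 2 ^ D
        fit p = ≤-<-trans (≤-trans p (≤-trans (eval-≤ e 2≤M b) (power-mono 2≤M (m≤m+n (degree e) _)))) fits
        body : ∀ x i → suc x + i ≡ v →
               store ip (out ++ textBits (concatTo i f)) (frame ρ g (suc x ∷ i ∷ []))
                 ⟶[ dec (g + 0) ⨟ generate a (bind (g + 1) m) (g + 2) ⨟ inc (g + 1) ]
               store ip (out ++ textBits (concatTo (suc i) f)) (frame ρ g (x ∷ suc i ∷ []))
        body x i eq =
          dec-frame {vs = suc x ∷ i ∷ []} 0 (r 0) refl (fit (m+n≤o⇒m≤o (suc x) (≤-reflexive eq)))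
          ▷ nest {us = []} vs (generate-⟶ {M = M ^ suc (degree e)} a (weaken (degree e) 2≤M 2≤M)
              (extend (≤-trans i≤ (≤-trans (eval-≤ e 2≤M b) (power-mono 2≤M (n≤1+n (degree e))))) (λ y → weaken (degree e) 2≤M (b y)))
              (≤-<-trans (≤-trans (≤-reflexive (^-*-assoc M (suc (degree e)) (gdegree a))) (power-mono 2≤M (m≤n+m _ (degree e)))) fits)
              (part g 2 regs (m≤n+m _ (registers e)))
              (bind-env vs 1 ≤-refl refl h))
          ▷ conv ≋-refl (out-++ out (concatTo i f) (f i)) (inc-frame {vs = vs} 1 (r 1) (fit i≤))
          where
          vs : List ℕ
          vs = x ∷ i ∷ []
          i≤ : i ≤ v
          i≤ = ≤-trans (m≤n+m i (suc x)) (≤-reflexive eq)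

-- Printing a circuit family in logarithmic space

n≤2^⌈log₂n⌉ : ∀ n → n ≤ 2 ^ ⌈log₂ n ⌉
n≤2^⌈log₂n⌉ = <-rec _ go
  where
  go : ∀ n → (∀ {m} → m < n → m ≤ 2 ^ ⌈log₂ m ⌉) → n ≤ 2 ^ ⌈log₂ n ⌉
  go 0 rec = z≤n
  go 1 rec = ≤-refl
  go n@(suc (suc m)) rec = ≤-trans (≤-reflexive (sym (⌊n/2⌋+⌈n/2⌉≡n n)))
    (≤-trans (+-mono-≤ (≤-trans (⌊n/2⌋≤⌈n/2⌉ n) half) half)
      (≤-reflexive (trans (cong (2 ^ (⌈log₂ n ⌉ ∸ 1) +_) (sym (+-identityʳ _))) (cong (2 ^_) (m+[n∸m]≡n {1} {⌈log₂ n ⌉} pos-log)))))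
    where
    pos-log : 1 ≤ ⌈log₂ n ⌉
    pos-log = ≤-trans (≤-reflexive (sym (⌈log₂2^n⌉≡n 1))) (⌈log₂⌉-mono-≤ {2} {n} (s≤s (s≤s z≤n)))
    half : ⌈ n /2⌉ ≤ 2 ^ (⌈log₂ n ⌉ ∸ 1)
    half = subst (λ l → ⌈ n /2⌉ ≤ 2 ^ l) (⌈log₂⌈n/2⌉⌉≡⌈log₂n⌉∸1 n) (rec (⌈n/2⌉<n m))

ones-inside : ∀ {n i} → i < n → readInput (replicate n true) (suc i) ≡ just true
ones-inside {suc n} {zero}  (s≤s p) = refl
ones-inside {suc n} {suc i} (s≤s p) = ones-inside p

ones-end : ∀ n → readInput (replicate n true) (suc n) ≡ nothing
ones-end zero    = refl
ones-end (suc n) = ones-end n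

module Generator (gen : Gen 1) where
  K : ℕ
  K = suc (gregisters gen)

  open Registers K
  open Compiler K

  hasInput : Test
  hasInput i _ = maybe′ (λ _ → true) false i

  advance mark : Machine
  advance = prim (λ _ s → right , s , stay , nothing)
  mark    = prim (λ _ _ → right , just true , stay , nothing)

  generator : Machine
  -- Both end-markers read as `nothing`. So `mark` first leaves the left one, and the loop then
  -- counts input bits into register 0 until it meets the right one.
  generator = mark ⨟ while hasInput (inc 0 ⨟ advance) ⨟ generate gen (λ _ → 0) 1

  module _ (n D : ℕ) where
    private w = replicate n true
    open Arithmetic K
    open Effects w D
    open Frames w D
    open Correct w D

    private
      blank : ℕ → Maybe Bool
      blank _ = nothing

      single : ℕ → ℕ → ℕ
      single i = frame (λ _ → i) 1 []

      at : ℕ → Snapshot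
      at i = store (suc i) [] (single i)

    marked : snap 0 blank 0 [] ⟶[ mark ] at 0
    marked = conv ≋-refl (subst (snap 1 (update blank 0 (just true)) 0 [] ≋_) (sym place≡) (mk≋ refl tape≡ refl refl))
               (prim-⟶ _ (snap 0 blank 0 []) z≤n z≤n)
      where
      R : ℕ → List Bool
      R = digits ∘ single 0
      place≡ : at 0 ≡ snap 1 (flat (cells R)) 0 []
      place≡ = trans (store-def 1 [] (single 0)) (place-def 1 [] R 0 0)
      single≡0 : ∀ r → single 0 r ≡ 0
      single≡0 zero    = frame-low (λ _ → 0) 1 [] (s≤s z≤n)
      single≡0 (suc r) = frame-high (λ _ → 0) 1 [] r
      tape≡ : update blank 0 (just true) ≗ flat (cells R)
      tape≡ = flat-write {T = λ _ _ → nothing} {T' = cells R} 0 (just true) (s≤s z≤n) refl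
        λ { zero    zero    ne → contradiction (refl , refl) ne
          ; (suc i) zero    ne → refl
          ; i       (suc r) ne → cong (λ ds → column ds i) (trans (cong digits (single≡0 r)) digits-zero) }

    input-at : ∀ i → input (at i) ≡ readInput w (suc i)
    input-at i = trans (cong input (store-def (suc i) [] (single i)))
                   (cong input (place-def (suc i) [] (digits ∘ single i) 0 0))

    advance-⟶ : ∀ i ρ → store i [] ρ ⟶[ advance ] store (suc i) [] ρ
    advance-⟶ i ρ rewrite store-def i [] ρ | store-def (suc i) [] ρ
      | place-def i [] (digits ∘ ρ) 0 0 | place-def (suc i) [] (digits ∘ ρ) 0 0 =
      step-idle right stay nothing (snap i (flat (cells (digits ∘ ρ))) 0 []) z≤n z≤n

    read-input : n < 2 ^ D → ∀ i j → i + j ≡ n → at i ⟶[ while hasInput (inc 0 ⨟ advance) ] at n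
    read-input n< i zero    e rewrite trans (sym (+-identityʳ i)) e =
      while-false store≤ (cong (maybe′ (λ _ → true) false) (trans (input-at n) (ones-end n)))
    read-input n< i (suc j) e =
      while-true (cong (maybe′ (λ _ → true) false) (trans (input-at i) (ones-inside i<n)))
        (conv ≋-refl (store-cong incremented) (inc-store (single i) (s≤s z≤n) (subst (_< 2 ^ D) (sym low) (<-trans i<n n<)))
         ▷ advance-⟶ (suc i) (single (suc i)))
        (read-input n< (suc i) j (trans (sym (+-suc i j)) e))
      where
      i<n : i < n
      i<n = ≤-trans (≤-trans (s≤s (m≤m+n i j)) (≤-reflexive (sym (+-suc i j)))) (≤-reflexive e)
      low : single i 0 ≡ i
      low = frame-low (λ _ → i) 1 [] (s≤s z≤n)
      incremented : single i [ 0 ≔ suc (single i 0) ] ≗ single (suc i)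
      incremented zero    = trans (≔-at (single i) 0 (suc (single i 0))) (trans (cong suc low) (sym (frame-low (λ _ → suc i) 1 [] (s≤s z≤n))))
      incremented (suc j) = trans (≔-other (single i) {0} {suc j} (suc (single i 0)) (λ ()))
                       (trans (frame-high (λ _ → i) 1 [] j) (sym (frame-high (λ _ → suc i) 1 [] j)))

    generator-computes : ∀ {M} → 2 ≤ M → n ≤ M → n < 2 ^ D → M ^ gdegree gen < 2 ^ D →
                         ComputesWithin (toTransducer generator) w (concat (map csymBits (text gen (n ∷ [])))) S
    generator-computes {M} 2≤M n≤M n< fits = subst (λ o → ComputesWithin (toTransducer generator) w o S)
      (trans (cong outp (store-def _ _ (single n))) (cong outp (place-def (suc n) _ (digits ∘ single n) 0 0)))
      (transducer-computes generator w S
        (marked ▷ read-input n< 0 n refl ▷ generate-⟶ gen {m = λ _ → 0} {env = n ∷ []} 2≤M bounded fits ≤-refl vars))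
      where
      bounded : Bounded M (n ∷ [])
      bounded zero = n≤M
      vars : Stored (λ _ → n) 1 (λ _ → 0) (n ∷ [])
      vars = stored λ { zero → s≤s z≤n , refl }

  uniform : ∀ C → (∀ n → concat (map encGate (C n)) ≡ text gen (n ∷ [])) → LogspaceUniform C
  uniform C e = toTransducer generator , c , λ n → weaken-space (S≤ ⌈log₂ n ⌉)
    (subst (λ cs → ComputesWithin (toTransducer generator) (replicate n true) (concat (map csymBits cs)) _) (sym (e n))
      -- `M` is a power of two that is at least `n`, and at least 2 even for small `n`. Then `M ^ d`
      -- is `2 ^ (suc ⌈log₂ n ⌉ * d)`; the factor `suc d` instead of `d` leaves room for `n` itself,
      -- and the outer `suc` makes the bounds strict.
      (generator-computes n (suc (suc ⌈log₂ n ⌉ * suc d)) {2 ^ suc ⌈log₂ n ⌉}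
        (2≤ n) (n≤ n) (below (suc ⌈log₂ n ⌉ * suc d) (≤-trans (n≤ n) (^-monoʳ-≤ 2 (m≤m*n (suc ⌈log₂ n ⌉) (suc d)))))
        (below (suc ⌈log₂ n ⌉ * suc d) (≤-trans (≤-reflexive (^-*-assoc 2 (suc ⌈log₂ n ⌉) d)) (^-monoʳ-≤ 2 (*-monoʳ-≤ (suc ⌈log₂ n ⌉) (n≤1+n d)))))))
    where
    d = gdegree gen
    c = (3 + d) * W
    2≤ : ∀ n → 2 ≤ 2 ^ suc ⌈log₂ n ⌉
    2≤ n = ^-monoʳ-≤ 2 {1} {suc ⌈log₂ n ⌉} (s≤s z≤n)
    n≤ : ∀ n → n ≤ 2 ^ suc ⌈log₂ n ⌉
    n≤ n = ≤-trans (n≤2^⌈log₂n⌉ n) (^-monoʳ-≤ 2 (n≤1+n ⌈log₂ n ⌉))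
    below : ∀ m {v} → v ≤ 2 ^ m → v < 2 ^ suc m
    below m p = ≤-<-trans p (^-monoʳ-< 2 (s≤s (s≤s z≤n)) {m} ≤-refl)
    weaken-space : ∀ {M w y s s'} → s ≤ s' → ComputesWithin M w y s → ComputesWithin M w y s'
    weaken-space le (t , h , o , b) = t , h , o , λ t' p → ≤-trans (b t' p) le
    S≤ : ∀ l → suc (suc (suc l * suc d)) * W ≤ c * l + c
    S≤ l = begin
      suc (suc (suc l * suc d)) * W   ≤⟨ *-monoˡ-≤ W lemma ⟩
      ((3 + d) * l + (3 + d)) * W     ≡⟨ *-distribʳ-+ W ((3 + d) * l) (3 + d) ⟩
      (3 + d) * l * W + (3 + d) * W   ≡⟨ cong (_+ (3 + d) * W) (trans (*-assoc (3 + d) l W) (trans (cong ((3 + d) *_) (*-comm l W)) (sym (*-assoc (3 + d) W l)))) ⟩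
      c * l + c                       ∎
      where
      open ≤-Reasoning
      lemma : suc (suc (suc l * suc d)) ≤ (3 + d) * l + (3 + d)
      lemma = begin
        2 + (suc d + l * suc d)     ≡⟨ +-comm 2 (suc d + l * suc d) ⟩
        suc d + l * suc d + 2       ≡⟨ cong (_+ 2) (+-comm (suc d) (l * suc d)) ⟩
        l * suc d + suc d + 2       ≡⟨ +-assoc (l * suc d) (suc d) 2 ⟩
        l * suc d + (suc d + 2)     ≤⟨ +-mono-≤ (≤-trans (≤-reflexive (*-comm l (suc d))) (*-monoˡ-≤ l (m≤n+m (suc d) 2))) (≤-reflexive (cong suc (+-comm d 2))) ⟩
        (3 + d) * l + (3 + d)       ∎

-- Bounded formulas, and circuits given gate by gate

infix  5 _≐_ _≺_
infixr 4 _∧ᶜ_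
infixr 3 _∨ᶜ_

data Frm (k : ℕ) : Set where
  _≐_ _≺_   : Exp k → Exp k → Frm k
  _∧ᶜ_ _∨ᶜ_ : Frm k → Frm k → Frm k
  some<     : Exp k → Frm (suc k) → Frm k

Holds : ∀ {k} → Frm k → Vec ℕ k → Set
Holds (a ≐ b)     env = eval a env ≡ eval b env
Holds (a ≺ b)     env = eval a env < eval b env
Holds (φ ∧ᶜ ψ)    env = Holds φ env × Holds ψ env
Holds (φ ∨ᶜ ψ)    env = Holds φ env ⊎ Holds ψ env
Holds (some< a φ) env = ∃ λ i → i < eval a env × Holds φ (i ∷ env)

-- Any nonzero value stands for truth. Thus disjunction and bounded search are plain sums,
-- conjunction is a product, and `a ≐ b` becomes 1 minus the distance of `a` and `b`, truncated at
-- zero.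
characteristic : ∀ {k} → Frm k → Exp k
characteristic (a ≐ b)     = lit 1 ⊖ ((a ⊖ b) ⊕ (b ⊖ a))
characteristic (a ≺ b)     = b ⊖ a
characteristic (φ ∧ᶜ ψ)    = characteristic φ ⊗ characteristic ψ
characteristic (φ ∨ᶜ ψ)    = characteristic φ ⊕ characteristic ψ
characteristic (some< a φ) = sum< a (characteristic φ)

sumTo≢0 : ∀ n f → (∃ λ i → i < n × f i ≢ 0) → sumTo n f ≢ 0
sumTo≢0 (suc n) f (i , i< , ne) e with m≤n⇒m<n∨m≡n i<
... | inj₁ (s≤s q) = sumTo≢0 n f (i , q , ne) (m+n≡0⇒m≡0 _ e)
... | inj₂ refl    = ne (m+n≡0⇒n≡0 (sumTo n f) e)

sumTo≢0⁻¹ : ∀ n f → sumTo n f ≢ 0 → ∃ λ i → i < n × f i ≢ 0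
sumTo≢0⁻¹ zero    f ne = contradiction refl ne
sumTo≢0⁻¹ (suc n) f ne with f n ≟ 0
... | no ne' = n , ≤-refl , ne'
... | yes e with sumTo≢0⁻¹ n f (λ e' → ne (cong₂ _+_ e' e))
...   | i , i< , ne' = i , m≤n⇒m≤1+n i< , ne'

holds⇒ : ∀ {k} (φ : Frm k) env → Holds φ env → eval (characteristic φ) env ≢ 0
holds⇒ (a ≐ b) env e rewrite e | n∸n≡0 (eval b env) = λ ()
holds⇒ (a ≺ b) env lt e = <⇒≱ lt (m∸n≡0⇒m≤n e)
holds⇒ (φ ∧ᶜ ψ) env (p , q) e with m*n≡0⇒m≡0∨n≡0 (eval (characteristic φ) env) e
... | inj₁ z = holds⇒ φ env p z
... | inj₂ z = holds⇒ ψ env q z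
holds⇒ (φ ∨ᶜ ψ) env (inj₁ p) e = holds⇒ φ env p (m+n≡0⇒m≡0 _ e)
holds⇒ (φ ∨ᶜ ψ) env (inj₂ q) e = holds⇒ ψ env q (m+n≡0⇒n≡0 (eval (characteristic φ) env) e)
holds⇒ (some< a φ) env (i , i< , p) = sumTo≢0 (eval a env) _ (i , i< , holds⇒ φ (i ∷ env) p)

holds⇐ : ∀ {k} (φ : Frm k) env → eval (characteristic φ) env ≢ 0 → Holds φ env
holds⇐ (a ≐ b) env ne with eval a env ≟ eval b env
... | yes e = e
... | no ne' = contradiction (m≤n⇒m∸n≡0 {1} (n≢0⇒n>0 λ z → ne' (≤-antisym (m∸n≡0⇒m≤n (m+n≡0⇒m≡0 _ z))
                 (m∸n≡0⇒m≤n (m+n≡0⇒n≡0 (eval a env ∸ eval b env) z))))) ne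
holds⇐ (a ≺ b) env ne = ≰⇒> λ le → ne (m≤n⇒m∸n≡0 le)
holds⇐ (φ ∧ᶜ ψ) env ne = holds⇐ φ env (λ z → ne (cong (_* eval (characteristic ψ) env) z)) ,
                         holds⇐ ψ env (λ z → ne (trans (cong (eval (characteristic φ) env *_) z) (*-zeroʳ (eval (characteristic φ) env))))
holds⇐ (φ ∨ᶜ ψ) env ne with eval (characteristic φ) env ≟ 0
... | no ne' = inj₁ (holds⇐ φ env ne')
... | yes z  = inj₂ (holds⇐ ψ env λ z' → ne (cong₂ _+_ z z'))
holds⇐ (some< a φ) env ne with sumTo≢0⁻¹ (eval a env) _ ne
... | i , i< , ne' = i , i< , holds⇐ φ (i ∷ env) ne'

fails : ∀ {k} → Frm k → Vec ℕ k → Bool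
fails φ env = isZero (eval (characteristic φ) env)

fails-false : ∀ {k} (φ : Frm k) env → Holds φ env → fails φ env ≡ false
fails-false φ env h with eval (characteristic φ) env | holds⇒ φ env h
... | zero  | ne = contradiction refl ne
... | suc _ | _  = refl

fails⁻¹ : ∀ {k} (φ : Frm k) env → fails φ env ≡ false → Holds φ env
fails⁻¹ φ env e with eval (characteristic φ) env | holds⇐ φ env
... | suc _ | h = h λ ()

collect : (ℕ → Bool) → ℕ → List ℕ
collect p zero    = []
collect p (suc m) = collect p m ++ (if p m then [] else [ m ])

collect-< : ∀ p m → All (_< m) (collect p m)
collect-< p zero    = []
collect-< p (suc m) = Allₚ.++⁺ (All.map m≤n⇒m≤1+n (collect-< p m)) tail
  where
  tail : All (_< suc m) (if p m then [] else [ m ])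
  tail with p m
  ... | true  = []
  ... | false = ≤-refl ∷ []

anyL-++ : ∀ xs ys → anyL (xs ++ ys) ≡ anyL xs ∨ anyL ys
anyL-++ []           ys = refl
anyL-++ (true ∷ xs)  ys = refl
anyL-++ (false ∷ xs) ys = anyL-++ xs ys

allL-++ : ∀ xs ys → allL (xs ++ ys) ≡ allL xs ∧ allL ys
allL-++ []           ys = refl
allL-++ (true ∷ xs)  ys = allL-++ xs ys
allL-++ (false ∷ xs) ys = refl

any-collect⇐ : ∀ (f : ℕ → Bool) p m {y} → y < m → p y ≡ false → f y ≡ true → anyL (map f (collect p m)) ≡ true
any-collect⇐ f p (suc m) {y} lt py fy
  rewrite map-++ f (collect p m) (if p m then [] else [ m ]) | anyL-++ (map f (collect p m)) (map f (if p m then [] else [ m ]))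
  with m≤n⇒m<n∨m≡n lt
... | inj₁ (s≤s q) rewrite any-collect⇐ f p m q py fy = refl
... | inj₂ refl rewrite py | fy = ∨-true (anyL (map f (collect p m)))
  where
  ∨-true : ∀ b → b ∨ true ≡ true
  ∨-true true  = refl
  ∨-true false = refl

any-collect⇒ : ∀ (f : ℕ → Bool) p m → anyL (map f (collect p m)) ≡ true → ∃ λ y → y < m × p y ≡ false × f y ≡ true
any-collect⇒ f p (suc m) e
  rewrite map-++ f (collect p m) (if p m then [] else [ m ]) | anyL-++ (map f (collect p m)) (map f (if p m then [] else [ m ]))
  with anyL (map f (collect p m)) in eq | p m in pm
... | true  | _     = case any-collect⇒ f p m eq of λ (y , lt , py , fy) → y , m≤n⇒m≤1+n lt , py , fy
... | false | false = m , ≤-refl , pm , trans (sym (∨-identityʳ (f m))) e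

all-collect⇐ : ∀ (f : ℕ → Bool) p m → (∀ {y} → y < m → p y ≡ false → f y ≡ true) → allL (map f (collect p m)) ≡ true
all-collect⇐ f p zero    h = refl
all-collect⇐ f p (suc m) h
  rewrite map-++ f (collect p m) (if p m then [] else [ m ]) | allL-++ (map f (collect p m)) (map f (if p m then [] else [ m ]))
    | all-collect⇐ f p m (h ∘ m≤n⇒m≤1+n)
  with p m in pm
... | true = refl
... | false rewrite h ≤-refl pm = refl

all-collect⇒ : ∀ (f : ℕ → Bool) p m → allL (map f (collect p m)) ≡ true → ∀ {y} → y < m → p y ≡ false → f y ≡ true
all-collect⇒ f p (suc m) e {y} lt py
  rewrite map-++ f (collect p m) (if p m then [] else [ m ]) | allL-++ (map f (collect p m)) (map f (if p m then [] else [ m ]))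
  with allL (map f (collect p m)) in eq | m≤n⇒m<n∨m≡n lt
... | true | inj₁ (s≤s q) = all-collect⇒ f p m eq q py
... | true | inj₂ refl rewrite py with f y
...   | true = refl

module Build (gate : ℕ → Gate) where
  build : ℕ → Circuit
  build zero    = []
  build (suc m) = build m ++ [ gate m ]

  length-build : ∀ m → length (build m) ≡ m
  length-build zero    = refl
  length-build (suc m) = trans (length-snoc (build m) (gate m)) (cong suc (length-build m))

  build-WF : ∀ {n} → (∀ x → GateWF n x (gate x)) → ∀ m → GatesWF n 0 (build m)
  build-WF {n} wf zero    = tt
  build-WF {n} wf (suc m) = snoc 0 (build m) (build-WF wf m) (subst (λ j → GateWF n j (gate m)) (sym (length-build m)) (wf m))
    where
    snoc : ∀ j c {g} → GatesWF n j c → GateWF n (j + length c) g → GatesWF n j (c ++ [ g ])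
    snoc j []      _        q = subst (λ i → GateWF n i _) (+-identityʳ j) q , tt
    snoc j (_ ∷ c) {g} (p , ps) q = p , snoc (suc j) c ps (subst (λ i → GateWF n i g) (+-suc j (length c)) q)

  build-enc : ∀ m → concat (map encGate (build m)) ≡ concatTo m (encGate ∘ gate)
  build-enc zero    = refl
  build-enc (suc m) rewrite map-++ encGate (build m) [ gate m ] | sym (concat-++ (map encGate (build m)) [ encGate (gate m) ])
    | build-enc m | ++-identityʳ (encGate (gate m)) = refl

  -- Values and depths of gates are both left folds that append one entry per gate. An entry never
  -- changes once it is written, so a later table can be read as the function `entry'`.
  module Fold {A : Set} (d : A) (f : List A → Gate → A) where
    table : ℕ → List A
    table m = foldl (λ vs g → vs ++ [ f vs g ]) [] (build m)

    entry' : ℕ → A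
    entry' x = f (table x) (gate x)

    table-suc : ∀ m → table (suc m) ≡ table m ++ [ entry' m ]
    table-suc m = foldl-++ (λ vs g → vs ++ [ f vs g ]) [] (build m) [ gate m ]

    table-length : ∀ m → length (table m) ≡ m
    table-length zero    = refl
    table-length (suc m) = trans (cong length (table-suc m)) (trans (length-snoc (table m) (entry' m)) (cong suc (table-length m)))

    lookupD-++ˡ : ∀ xs ys {i} → i < length xs → lookupD d (xs ++ ys) i ≡ lookupD d xs i
    lookupD-++ˡ (x ∷ xs) ys {zero}  _       = refl
    lookupD-++ˡ (x ∷ xs) ys {suc i} (s≤s p) = lookupD-++ˡ xs ys p

    lookupD-end : ∀ xs y → lookupD d (xs ++ [ y ]) (length xs) ≡ y
    lookupD-end []       y = refl
    lookupD-end (x ∷ xs) y = lookupD-end xs y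

    table-lookup : ∀ m {x} → x < m → lookupD d (table m) x ≡ entry' x
    table-lookup (suc m) {x} lt rewrite table-suc m with m≤n⇒m<n∨m≡n lt
    ... | inj₁ (s≤s q) = trans (lookupD-++ˡ (table m) [ entry' m ] (subst (x <_) (sym (table-length m)) q)) (table-lookup m q)
    ... | inj₂ refl    = trans (cong (lookupD d (table m ++ [ entry' m ])) (sym (table-length m))) (lookupD-end (table m) (entry' m))

  module Values (w : List Bool) = Fold false (evalGate w)
  module Depths = Fold 0 gateDepth

  lastD-snoc : ∀ {A : Set} (d : A) xs x → lastD d (xs ++ [ x ]) ≡ x
  lastD-snoc d []       x = refl
  lastD-snoc d (y ∷ xs) x = lastD-snoc y xs x

  eval-build : ∀ w m → evalCircuit (build (suc m)) w ≡ Values.entry' w m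
  eval-build w m = trans (cong (lastD false) (Values.table-suc w m)) (lastD-snoc false (Values.table w m) _)

  depth-build : ∀ m {B} → (∀ x → x < m → Depths.entry' x ≤ B) → depth (build m) ≤ B
  depth-build m {B} h = go m h
    where
    maxL-snoc : ∀ xs {x} → maxL xs ≤ B → x ≤ B → maxL (xs ++ [ x ]) ≤ B
    maxL-snoc []       p q = ⊔-lub q z≤n
    maxL-snoc (y ∷ xs) p q = ⊔-lub (m⊔n≤o⇒m≤o y (maxL xs) p) (maxL-snoc xs (m⊔n≤o⇒n≤o y (maxL xs) p) q)
    go : ∀ m → (∀ x → x < m → Depths.entry' x ≤ B) → maxL (Depths.table m) ≤ B
    go zero    h = z≤n
    go (suc m) h = subst (λ xs → maxL xs ≤ B) (sym (Depths.table-suc m)) (maxL-snoc (Depths.table m) (go m λ x p → h x (m≤n⇒m≤1+n p)) (h m ≤-refl))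

maxL-map : ∀ (f : ℕ → ℕ) {B} js → All (λ j → f j ≤ B) js → maxL (map f js) ≤ B
maxL-map f []       []       = z≤n
maxL-map f (j ∷ js) (p ∷ ps) = ⊔-lub p (maxL-map f js ps)

collect-all : ∀ {C : ℕ → Set} p m → (∀ {y} → y < m → p y ≡ false → C y) → All C (collect p m)
collect-all p zero    h = []
collect-all {C} p (suc m) h = Allₚ.++⁺ (collect-all p m (h ∘ m≤n⇒m≤1+n)) tail
  where
  tail : All C (if p m then [] else [ m ])
  tail with p m in pm
  ... | true  = []
  ... | false = h ≤-refl pm ∷ []

-- Alternating graphs unrolled into circuits

AllBelow : ∀ {r} → ℕ → Vec ℕ r → Set
AllBelow N = VAll.All (_< N)

evalAll : ∀ {k r} → Vec (Exp k) r → Vec ℕ k → Vec ℕ r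
evalAll es env = Vec.map (λ e → eval e env) es

-- The layer `s` is the leading digit in base `N`, so all nodes of a lower layer are numbered before
-- those of a higher one. This makes the numbering a topological order.
code : ∀ {r} → ℕ → ℕ → Vec ℕ r → ℕ
code N s []       = s
code N s (d ∷ ds) = d + N * code N s ds

codeE : ∀ {k r} → Exp k → Exp k → Vec (Exp k) r → Exp k
codeE N s []       = s
codeE N s (d ∷ ds) = d ⊕ N ⊗ codeE N s ds

eval-code : ∀ {k r} N s (ds : Vec (Exp k) r) env → eval (codeE N s ds) env ≡ code (eval N env) (eval s env) (evalAll ds env)
eval-code N s []       env = refl
eval-code N s (d ∷ ds) env = cong (λ c → eval d env + eval N env * c) (eval-code N s ds env)

code-< : ∀ {r N s s'} (ds ds' : Vec ℕ r) → AllBelow N ds' → s' < s → code N s' ds' < code N s ds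
code-< []       []         _              lt = lt
code-< {N = N} {s} {s'} (d ∷ ds) (d' ∷ ds') (p VAll.∷ ps) lt =
  ≤-trans (+-monoˡ-< (N * code N s' ds') p) (≤-trans (≤-reflexive (sym (*-suc N (code N s' ds'))))
    (≤-trans (*-monoʳ-≤ N (code-< ds ds' ps lt)) (m≤n+m (N * code N s ds) d)))

digit-unique : ∀ N {d d' q q'} → d < N → d' < N → d + N * q ≡ d' + N * q' → d ≡ d' × q ≡ q'
digit-unique N {d} {d'} {q} {q'} p p' e with <-cmp q q'
... | tri≈ _ refl _ = +-cancelʳ-≡ (N * q) d d' e , refl
... | tri< lt _ _ = contradiction e (<⇒≢ (≤-trans (+-monoˡ-< (N * q) p)
                      (≤-trans (≤-reflexive (sym (*-suc N q))) (≤-trans (*-monoʳ-≤ N lt) (m≤n+m (N * q') d')))))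
... | tri> _ _ lt = contradiction (sym e) (<⇒≢ (≤-trans (+-monoˡ-< (N * q') p')
                      (≤-trans (≤-reflexive (sym (*-suc N q'))) (≤-trans (*-monoʳ-≤ N lt) (m≤n+m (N * q) d)))))

code-injective : ∀ {r N s s'} (ds ds' : Vec ℕ r) → AllBelow N ds → AllBelow N ds' → code N s ds ≡ code N s' ds' → s ≡ s' × ds ≡ ds'
code-injective []       []         _             _               e = e , refl
code-injective {N = N} (d ∷ ds) (d' ∷ ds') (p VAll.∷ ps) (p' VAll.∷ ps') e with digit-unique N p p' e
... | refl , e' with code-injective ds ds' ps ps' e'
...   | refl , refl = refl , refl

-- A relation, because expressions contain no division: halving is recognised by doubling.
Half : ℕ → ℕ → Set
Half s s' = s ≡ s' + s' ⊎ s ≡ suc (s' + s')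

half : ∀ s → Half s ⌊ s /2⌋
half zero          = inj₁ refl
half (suc zero)    = inj₂ refl
half (suc (suc s)) with half s
... | inj₁ e = inj₁ (trans (cong (2 +_) e) (cong suc (sym (+-suc ⌊ s /2⌋ ⌊ s /2⌋))))
... | inj₂ e = inj₂ (trans (cong (2 +_) e) (cong (2 +_) (sym (+-suc ⌊ s /2⌋ ⌊ s /2⌋))))

double-≤ : ∀ {s s'} → Half s s' → s' + s' ≤ s
double-≤ (inj₁ refl) = ≤-refl
double-≤ (inj₂ refl) = n≤1+n _

half-< : ∀ {s s'} → 0 < s → Half s s' → s' < s
half-< {s' = zero}   0<s h = 0<s
half-< {s} {suc s'} 0<s h = ≤-trans (s≤s (m≤n+m (suc s') s')) (double-≤ {s} {suc s'} h)

half-below : ∀ {s s'} h → Half s s' → s < 2 ^ suc h → s' < 2 ^ h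
half-below {s} {s'} h hf lt = ≰⇒> λ le → <⇒≱ lt
  (≤-trans (≤-reflexive (cong (2 ^ h +_) (+-identityʳ (2 ^ h)))) (≤-trans (+-mono-≤ le le) (double-≤ {s} {s'} hf)))

half-above : ∀ {s s'} h → Half s s' → 2 ^ suc h ≤ s → 2 ^ h ≤ s'
half-above {s} {s'} h hf le = ≮⇒≥ λ lt → <⇒≱ (≤-trans (s≤s (bound hf)) (≤-trans (≤-reflexive (cong suc (sym (+-suc s' s'))))
  (≤-trans (+-mono-≤ lt lt) (≤-reflexive (cong (2 ^ h +_) (sym (+-identityʳ (2 ^ h)))))))) le
  where
  bound : Half s s' → s ≤ suc (s' + s')
  bound (inj₁ refl) = n≤1+n _
  bound (inj₂ refl) = ≤-refl

someVec : ∀ r {k} → Fin k → ℕ → Frm (r + k) → Frm k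
someVec zero    n c φ = φ
someVec (suc r) n c φ = someVec r n c (some< (var (r ↑ʳ n) ⊕ lit (suc c)) φ)

someVec⇒ : ∀ r {k} (n : Fin k) c φ env → Holds (someVec r n c φ) env →
           ∃ λ v → AllBelow (lookup env n + suc c) v × Holds φ (v Vec.++ env)
someVec⇒ zero    n c φ env h = [] , VAll.[] , h
someVec⇒ (suc r) n c φ env h with someVec⇒ r n c _ env h
... | v , ps , i , p , h' = i ∷ v , subst (λ m → i < m + suc c) (Vecₚ.lookup-++ʳ v env n) p VAll.∷ ps , h'

someVec⇐ : ∀ r {k} (n : Fin k) c φ env {v} → AllBelow (lookup env n + suc c) v → Holds φ (v Vec.++ env) →
           Holds (someVec r n c φ) env
someVec⇐ zero    n c φ env {[]}    VAll.[]        h = h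
someVec⇐ (suc r) n c φ env {i ∷ v} (p VAll.∷ ps) h =
  someVec⇐ r n c _ env ps (i , subst (λ m → i < m + suc c) (sym (Vecₚ.lookup-++ʳ v env n)) p , h)

variables : ∀ {k r} → (Fin r → Fin k) → Vec (Exp k) r
variables h = Vec.tabulate (var ∘ h)

evalAll-variables : ∀ {k r} (h : Fin r → Fin k) env v → (∀ i → lookup env (h i) ≡ lookup v i) → evalAll (variables h) env ≡ v
evalAll-variables h env v e = trans (sym (Vecₚ.tabulate-∘ (λ e → eval e env) (var ∘ h)))
                                (trans (Vecₚ.tabulate-cong e) (Vecₚ.tabulate∘lookup v))

Lit : List Bool → ℕ → Set
Lit w y = (y < length w × lookupD false w y ≡ true) ⊎
          (∃ λ j → j < length w × y ≡ length w + j × lookupD false w j ≡ false)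

-- Alternating graphs whose nodes are vectors of r numbers below n + suc slack, given both by formulas
-- and by the relations these define. The leaf y stands for the input bit y if y < n, and for the
-- negation of bit j if y = n + j.
record Graph (r : ℕ) : Set₁ where
  field
    slack     : ℕ
    andF      : ∀ {k} → Exp k → Vec (Exp k) r → Frm k
    edgeF     : ∀ {k} → Exp k → Vec (Exp k) r → Vec (Exp k) r → Frm k
    leafF     : ∀ {k} → Exp k → Vec (Exp k) r → Exp k → Frm k
    And       : ℕ → Vec ℕ r → Set
    Edge      : ℕ → Vec ℕ r → Vec ℕ r → Set
    Leaf      : ℕ → Vec ℕ r → ℕ → Set
    and-spec  : ∀ {k} n f (env : Vec ℕ k) → Holds (andF n f) env ≡ And (eval n env) (evalAll f env)
    edge-spec : ∀ {k} n f g (env : Vec ℕ k) → Holds (edgeF n f g) env ≡ Edge (eval n env) (evalAll f env) (evalAll g env)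
    leaf-spec : ∀ {k} n f y (env : Vec ℕ k) → Holds (leafF n f y) env ≡ Leaf (eval n env) (evalAll f env) (eval y env)
    leaf-<    : ∀ {n f y} → Leaf n f y → y < n + n

module Unroll {r : ℕ} (gr : Graph r) (topE : Exp 1) where
  open Graph gr

  N : ℕ → ℕ
  N n = n + suc slack

  top : ℕ → ℕ
  top n = eval topE (n ∷ [])

  -- All fields are the largest digit in base `N n`. In layer `top n` this node has the largest
  -- number of all, so it is the last gate and therefore the output.
  root : ℕ → Vec ℕ r
  root n = Vec.replicate r (n + slack)

  -- Acceptance in the graph before unrolling, by a tree of height at most the index. Nothing is
  -- accepted at height 0, and leaves count at conjunctive nodes only.
  data Acc (w : List Bool) : ℕ → Vec ℕ r → Set where
    by-or  : ∀ {h f g} → ¬ And (length w) f → Edge (length w) f g → AllBelow (N (length w)) g → Acc w h g → Acc w (suc h) f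
    by-and : ∀ {h f} → And (length w) f → (∀ {g} → Edge (length w) f g → AllBelow (N (length w)) g → Acc w h g) →
             (∀ {y} → Leaf (length w) f y → Lit w y) → Acc w (suc h) f

  private
    NE : ∀ {k} → Exp k → Exp k
    NE n = n ⊕ lit (suc slack)

    nodeE : ∀ {k} → Exp k → Exp k → Vec (Exp k) r → Exp k
    nodeE n s f = (n ⊕ n) ⊕ codeE (NE n) s f

  node : ℕ → ℕ → Vec ℕ r → ℕ
  node n s f = n + n + code (N n) s f

  private
    eval-node : ∀ {k} n s (f : Vec (Exp k) r) env → eval (nodeE n s f) env ≡ node (eval n env) (eval s env) (evalAll f env)
    eval-node n s f env = cong (eval n env + eval n env +_) (eval-code (NE n) s f env)

    f₁ : ∀ k → Vec (Exp (r + k)) r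
    f₁ k = variables (_↑ˡ k)

    f₂ : ∀ k → Vec (Exp (r + (r + k))) r
    f₂ k = variables (λ i → r ↑ʳ (i ↑ˡ k))

    v₁ : ∀ {k} → Fin k → Exp (r + k)
    v₁ i = var (r ↑ʳ i)

    v₂ : ∀ {k} → Fin k → Exp (r + (r + k))
    v₂ i = var (r ↑ʳ (r ↑ʳ i))

    eval-f₁ : ∀ {k} (f : Vec ℕ r) (env : Vec ℕ k) → evalAll (f₁ k) (f Vec.++ env) ≡ f
    eval-f₁ {k} f env = evalAll-variables (_↑ˡ k) (f Vec.++ env) f (Vecₚ.lookup-++ˡ f env)

    eval-f₂ : ∀ {k} (g f : Vec ℕ r) (env : Vec ℕ k) → evalAll (f₂ k) (g Vec.++ (f Vec.++ env)) ≡ f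
    eval-f₂ {k} g f env = evalAll-variables (λ i → r ↑ʳ (i ↑ˡ k)) (g Vec.++ (f Vec.++ env)) f
      (λ i → trans (Vecₚ.lookup-++ʳ g (f Vec.++ env) (i ↑ˡ k)) (Vecₚ.lookup-++ˡ f env i))

    eval-v₁ : ∀ {k} (f : Vec ℕ r) (env : Vec ℕ k) i → eval (v₁ i) (f Vec.++ env) ≡ lookup env i
    eval-v₁ f env i = Vecₚ.lookup-++ʳ f env i

    eval-v₂ : ∀ {k} (g f : Vec ℕ r) (env : Vec ℕ k) i → eval (v₂ i) (g Vec.++ (f Vec.++ env)) ≡ lookup env i
    eval-v₂ g f env i = trans (Vecₚ.lookup-++ʳ g (f Vec.++ env) (r ↑ʳ i)) (Vecₚ.lookup-++ʳ f env i)

    halfF : ∀ {k} → Exp k → Exp k → Frm k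
    halfF s s' = s ≐ s' ⊕ s' ∨ᶜ s ≐ lit 1 ⊕ (s' ⊕ s')

    -- Free variables: x, n; bound: s and the fields of the node.
    andTest : Frm 2
    andTest = some< (lit 1 ⊕ var (# 0)) (someVec r (# 2) slack
      (v₁ (# 1) ≐ nodeE (v₁ (# 2)) (v₁ (# 0)) (f₁ 3) ∧ᶜ lit 0 ≺ v₁ (# 0) ∧ᶜ andF (v₁ (# 2)) (f₁ 3)))

    -- Free variables: y, x, n.
    leafTest edgeTest childTest : Frm 3
    leafTest = some< (lit 1 ⊕ var (# 1)) (someVec r (# 3) slack
      (v₁ (# 2) ≐ nodeE (v₁ (# 3)) (v₁ (# 0)) (f₁ 4) ∧ᶜ lit 0 ≺ v₁ (# 0) ∧ᶜ
       andF (v₁ (# 3)) (f₁ 4) ∧ᶜ leafF (v₁ (# 3)) (f₁ 4) (v₁ (# 1))))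
    edgeTest = some< (lit 1 ⊕ var (# 1)) (some< (lit 1 ⊕ var (# 2)) (someVec r (# 4) slack (someVec r (r ↑ʳ # 4) slack
      (v₂ (# 3) ≐ nodeE (v₂ (# 4)) (v₂ (# 1)) (f₂ 5) ∧ᶜ lit 0 ≺ v₂ (# 1) ∧ᶜ
       v₂ (# 2) ≐ nodeE (v₂ (# 4)) (v₂ (# 0)) (f₁ (r + 5)) ∧ᶜ halfF (v₂ (# 1)) (v₂ (# 0)) ∧ᶜ
       edgeF (v₂ (# 4)) (f₂ 5) (f₁ (r + 5))))))
    childTest = leafTest ∨ᶜ edgeTest

  -- Since `0 < s` is demanded here and of every child, a node in layer 0 becomes an empty
  -- disjunction, which is false.
  AndAt : ℕ → ℕ → Set
  AndAt n x = ∃₂ λ s f → AllBelow (N n) f × x ≡ node n s f × 0 < s × And n f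

  LeafAt : ℕ → ℕ → ℕ → Set
  LeafAt n x y = ∃₂ λ s f → AllBelow (N n) f × x ≡ node n s f × 0 < s × And n f × Leaf n f y

  EdgeAt : ℕ → ℕ → ℕ → Set
  EdgeAt n x y = ∃₂ λ s f → AllBelow (N n) f × x ≡ node n s f × 0 < s ×
                 ∃₂ λ s' g → AllBelow (N n) g × y ≡ node n s' g × Half s s' × Edge n f g

  s≤node : ∀ n s f → s ≤ node n s f
  s≤node n s f = ≤-trans (go f) (m≤n+m _ (n + n))
    where
    go : ∀ {r} (f : Vec ℕ r) → s ≤ code (N n) s f
    go []      = ≤-refl
    go (d ∷ f) = ≤-trans (go f) (≤-trans (m≤n*m (code (N n) s f) (N n) {{>-nonZero (≤-trans (s≤s z≤n) (m≤n+m (suc slack) n))}})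
                   (m≤n+m _ d))

  private
    node-cong : ∀ {n n' s s' f f'} → n ≡ n' → s ≡ s' → f ≡ f' → node n s f ≡ node n' s' f'
    node-cong refl refl refl = refl

    And-cong : ∀ {n n' f f'} → n ≡ n' → f ≡ f' → And n f → And n' f'
    And-cong refl refl a = a

    Leaf-cong : ∀ {n n' f f' y y'} → n ≡ n' → f ≡ f' → y ≡ y' → Leaf n f y → Leaf n' f' y'
    Leaf-cong refl refl refl a = a

    Edge-cong : ∀ {n n' f f' g g'} → n ≡ n' → f ≡ f' → g ≡ g' → Edge n f g → Edge n' f' g'
    Edge-cong refl refl refl a = a

    Half-cong : ∀ {s s₁ s' s₁'} → s ≡ s₁ → s' ≡ s₁' → Half s s' → Half s₁ s₁'
    Half-cong refl refl a = a

    cast : ∀ {A B : Set} → A ≡ B → A → B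
    cast refl a = a

    andTest⇒ : ∀ n x → Holds andTest (x ∷ n ∷ []) → AndAt n x
    andTest⇒ n x (s , _ , h) with someVec⇒ r (# 2) slack _ (s ∷ x ∷ n ∷ []) h
    ... | f , b , e , p , a = s , f , b ,
          trans (sym (V (# 1))) (trans e (trans (eval-node (v₁ (# 2)) (v₁ (# 0)) (f₁ 3) (f Vec.++ env)) (node-cong (V (# 2)) (V (# 0)) (eval-f₁ f env)))) ,
          subst (0 <_) (V (# 0)) p ,
          And-cong (V (# 2)) (eval-f₁ f env) (cast (and-spec (v₁ (# 2)) (f₁ 3) (f Vec.++ env)) a)
      where
      env = s ∷ x ∷ n ∷ []
      V : ∀ i → eval (v₁ i) (f Vec.++ env) ≡ lookup env i
      V = eval-v₁ f env

    andTest⇐ : ∀ n x → AndAt n x → Holds andTest (x ∷ n ∷ [])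
    andTest⇐ n x (s , f , b , refl , p , a) = s , s≤s (s≤node n s f) , someVec⇐ r (# 2) slack _ env b
      ( trans (V (# 1)) (sym (trans (eval-node (v₁ (# 2)) (v₁ (# 0)) (f₁ 3) (f Vec.++ env)) (node-cong (V (# 2)) (V (# 0)) (eval-f₁ f env))))
      , subst (0 <_) (sym (V (# 0))) p
      , cast (sym (and-spec (v₁ (# 2)) (f₁ 3) (f Vec.++ env))) (And-cong (sym (V (# 2))) (sym (eval-f₁ f env)) a))
      where
      env = s ∷ node n s f ∷ n ∷ []
      V : ∀ i → eval (v₁ i) (f Vec.++ env) ≡ lookup env i
      V = eval-v₁ f env

    leafTest⇒ : ∀ n x y → Holds leafTest (y ∷ x ∷ n ∷ []) → LeafAt n x y
    leafTest⇒ n x y (s , _ , h) with someVec⇒ r (# 3) slack _ (s ∷ y ∷ x ∷ n ∷ []) h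
    ... | f , b , e , p , a , l = s , f , b ,
          trans (sym (V (# 2))) (trans e (trans (eval-node (v₁ (# 3)) (v₁ (# 0)) (f₁ 4) (f Vec.++ env)) (node-cong (V (# 3)) (V (# 0)) (eval-f₁ f env)))) ,
          subst (0 <_) (V (# 0)) p ,
          And-cong (V (# 3)) (eval-f₁ f env) (cast (and-spec (v₁ (# 3)) (f₁ 4) (f Vec.++ env)) a) ,
          Leaf-cong (V (# 3)) (eval-f₁ f env) (V (# 1)) (cast (leaf-spec (v₁ (# 3)) (f₁ 4) (v₁ (# 1)) (f Vec.++ env)) l)
      where
      env = s ∷ y ∷ x ∷ n ∷ []
      V : ∀ i → eval (v₁ i) (f Vec.++ env) ≡ lookup env i
      V = eval-v₁ f env

    leafTest⇐ : ∀ n x y → LeafAt n x y → Holds leafTest (y ∷ x ∷ n ∷ [])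
    leafTest⇐ n x y (s , f , b , refl , p , a , l) = s , s≤s (s≤node n s f) , someVec⇐ r (# 3) slack _ env b
      ( trans (V (# 2)) (sym (trans (eval-node (v₁ (# 3)) (v₁ (# 0)) (f₁ 4) (f Vec.++ env)) (node-cong (V (# 3)) (V (# 0)) (eval-f₁ f env))))
      , subst (0 <_) (sym (V (# 0))) p
      , cast (sym (and-spec (v₁ (# 3)) (f₁ 4) (f Vec.++ env))) (And-cong (sym (V (# 3))) (sym (eval-f₁ f env)) a)
      , cast (sym (leaf-spec (v₁ (# 3)) (f₁ 4) (v₁ (# 1)) (f Vec.++ env)))
          (Leaf-cong (sym (V (# 3))) (sym (eval-f₁ f env)) (sym (V (# 1))) l))
      where
      env = s ∷ y ∷ node n s f ∷ n ∷ []
      V : ∀ i → eval (v₁ i) (f Vec.++ env) ≡ lookup env i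
      V = eval-v₁ f env

    edgeTest⇒ : ∀ n x y → Holds edgeTest (y ∷ x ∷ n ∷ []) → EdgeAt n x y
    edgeTest⇒ n x y (s , _ , s' , _ , h) with someVec⇒ r (# 4) slack _ (s' ∷ s ∷ y ∷ x ∷ n ∷ []) h
    ... | f , b , h' with someVec⇒ r (r ↑ʳ # 4) slack _ (f Vec.++ (s' ∷ s ∷ y ∷ x ∷ n ∷ [])) h'
    ...   | g , b' , e , p , e' , hf , d = s , f , b ,
          trans (sym (V (# 3))) (trans e (trans (eval-node (v₂ (# 4)) (v₂ (# 1)) (f₂ 5) env₂) (node-cong (V (# 4)) (V (# 1)) (eval-f₂ g f env)))) ,
          subst (0 <_) (V (# 1)) p ,
          s' , g , subst (λ m → AllBelow (N m) g) (Vecₚ.lookup-++ʳ f env (# 4)) b' ,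
          trans (sym (V (# 2))) (trans e' (trans (eval-node (v₂ (# 4)) (v₂ (# 0)) (f₁ (r + 5)) env₂) (node-cong (V (# 4)) (V (# 0)) (eval-f₁ g (f Vec.++ env))))) ,
          Half-cong (V (# 1)) (V (# 0)) hf ,
          Edge-cong (V (# 4)) (eval-f₂ g f env) (eval-f₁ g (f Vec.++ env)) (cast (edge-spec (v₂ (# 4)) (f₂ 5) (f₁ (r + 5)) env₂) d)
      where
      env = s' ∷ s ∷ y ∷ x ∷ n ∷ []
      env₂ = g Vec.++ (f Vec.++ env)
      V : ∀ i → eval (v₂ i) env₂ ≡ lookup env i
      V = eval-v₂ g f env

    edgeTest⇐ : ∀ n x y → EdgeAt n x y → Holds edgeTest (y ∷ x ∷ n ∷ [])
    edgeTest⇐ n x y (s , f , b , refl , p , s' , g , b' , refl , hf , d) =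
      s , s≤s (s≤node n s f) , s' , s≤s (≤-trans (<⇒≤ (half-< {s} {s'} p hf)) (s≤node n s f)) ,
      someVec⇐ r (# 4) slack _ env b (someVec⇐ r (r ↑ʳ # 4) slack _ (f Vec.++ env)
        (subst (λ m → AllBelow (N m) g) (sym (Vecₚ.lookup-++ʳ f env (# 4))) b')
        ( trans (V (# 3)) (sym (trans (eval-node (v₂ (# 4)) (v₂ (# 1)) (f₂ 5) env₂) (node-cong (V (# 4)) (V (# 1)) (eval-f₂ g f env))))
        , subst (0 <_) (sym (V (# 1))) p
        , trans (V (# 2)) (sym (trans (eval-node (v₂ (# 4)) (v₂ (# 0)) (f₁ (r + 5)) env₂) (node-cong (V (# 4)) (V (# 0)) (eval-f₁ g (f Vec.++ env)))))
        , Half-cong (sym (V (# 1))) (sym (V (# 0))) hf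
        , cast (sym (edge-spec (v₂ (# 4)) (f₂ 5) (f₁ (r + 5)) env₂))
            (Edge-cong (sym (V (# 4))) (sym (eval-f₂ g f env)) (sym (eval-f₁ g (f Vec.++ env))) d)))
      where
      env = s' ∷ s ∷ node n s' g ∷ node n s f ∷ n ∷ []
      env₂ = g Vec.++ (f Vec.++ env)
      V : ∀ i → eval (v₂ i) env₂ ≡ lookup env i
      V = eval-v₂ g f env

  opaque
    noChild : ℕ → ℕ → ℕ → Bool
    noChild n x y = fails childTest (y ∷ x ∷ n ∷ [])

    noAnd : ℕ → ℕ → Bool
    noAnd n x = fails andTest (x ∷ n ∷ [])

    childE : Exp 3
    childE = characteristic childTest

    andE : Exp 2
    andE = characteristic andTest

    noChild-def : ∀ n x y → isZero (eval childE (y ∷ x ∷ n ∷ [])) ≡ noChild n x y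
    noChild-def n x y = refl

    noAnd-def : ∀ n x → isZero (eval andE (x ∷ n ∷ [])) ≡ noAnd n x
    noAnd-def n x = refl

    child⇒ : ∀ n x y → noChild n x y ≡ false → LeafAt n x y ⊎ EdgeAt n x y
    child⇒ n x y e = Sum.map (leafTest⇒ n x y) (edgeTest⇒ n x y) (fails⁻¹ childTest (y ∷ x ∷ n ∷ []) e)

    child⇐ : ∀ n x y → LeafAt n x y ⊎ EdgeAt n x y → noChild n x y ≡ false
    child⇐ n x y h = fails-false childTest (y ∷ x ∷ n ∷ []) (Sum.map (leafTest⇐ n x y) (edgeTest⇐ n x y) h)

    and⇒ : ∀ n x → noAnd n x ≡ false → AndAt n x
    and⇒ n x e = andTest⇒ n x (fails⁻¹ andTest (x ∷ n ∷ []) e)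

    and⇐ : ∀ n x → AndAt n x → noAnd n x ≡ false
    and⇐ n x h = fails-false andTest (x ∷ n ∷ []) (andTest⇐ n x h)

^-distribʳ-* : ∀ o m n → (m * n) ^ o ≡ m ^ o * n ^ o
^-distribʳ-* zero    m n = refl
^-distribʳ-* (suc o) m n = trans (cong (m * n *_) (^-distribʳ-* o m n))
  (trans (*-assoc m n (m ^ o * n ^ o)) (trans (cong (m *_) (trans (sym (*-assoc n (m ^ o) (n ^ o)))
    (trans (cong (_* n ^ o) (*-comm n (m ^ o))) (*-assoc (m ^ o) n (n ^ o))))) (sym (*-assoc m (m ^ o) (n * n ^ o)))))

-- The circuit of an unrolled graph: values, depth and size

module Realise {r : ℕ} (gr : Graph r) (topE : Exp 1) where
  open Graph gr
  open Unroll gr topE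

  kids : ℕ → ℕ → List ℕ
  kids n x = collect (noChild n x) x

  -- Inputs come below `n`, their negations from `n` up to `n + n`, and the nodes after that. The
  -- comparisons are zero tests of truncated differences, exactly those which `gateG` performs when
  -- it prints the gate.
  gate : ℕ → ℕ → Gate
  gate n x = if isZero (n ∸ x) then
               (if isZero ((n + n) ∸ x) then (if noAnd n x then org (kids n x) else andg (kids n x)) else notg (x ∸ n))
             else inp x

  lastE sizeE : Exp 1
  lastE = (var (# 0) ⊕ var (# 0)) ⊕ codeE (var (# 0) ⊕ lit (suc slack)) topE (Vec.replicate r (var (# 0) ⊕ lit slack))
  sizeE = lit 1 ⊕ lastE

  lastGate : ℕ → ℕ
  lastGate n = eval lastE (n ∷ [])

  lastGate-node : ∀ n → lastGate n ≡ node n (top n) (root n)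
  lastGate-node n = cong (n + n +_) (trans
    (eval-code (var (# 0) ⊕ lit (suc slack)) topE (Vec.replicate r (var (# 0) ⊕ lit slack)) (n ∷ []))
    (cong (code (N n) (top n)) (Vecₚ.map-replicate (λ e → eval e (n ∷ [])) _ r)))

  circuit : ℕ → Circuit
  circuit n = Build.build (gate n) (suc (lastGate n))

  noText : ∀ {k} → Gen k
  noText = for (lit 0) (char cSep)

  kidsG : Gen 2
  kidsG = for (var (# 0)) (unless childE noText (num (var (# 0)) ⊙ char cSep)) ⊙ char cEnd

  gateG : Gen 2
  gateG = unless (var (# 1) ⊖ var (# 0))
            (unless (var (# 1) ⊕ var (# 1) ⊖ var (# 0))
              (unless andE (char cOr ⊙ kidsG) (char cAnd ⊙ kidsG))
              (char cNot ⊙ num (var (# 0) ⊖ var (# 1)) ⊙ char cEnd))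
            (char cIn ⊙ num (var (# 0)) ⊙ char cEnd)

  circuitG : Gen 1
  circuitG = for sizeE gateG

  concatTo-cong : ∀ m {f g : ℕ → List CSym} → (∀ i → f i ≡ g i) → concatTo m f ≡ concatTo m g
  concatTo-cong zero    e = refl
  concatTo-cong (suc m) e = cong₂ _++_ (concatTo-cong m e) (e m)

  collect-text : ∀ p m → concat (map (λ j → encNat j ++ [ cSep ]) (collect p m)) ≡
                         concatTo m (λ y → if p y then [] else encNat y ++ [ cSep ])
  collect-text p zero    = refl
  collect-text p (suc m) rewrite map-++ (λ j → encNat j ++ [ cSep ]) (collect p m) (if p m then [] else [ m ])
    | sym (concat-++ (map (λ j → encNat j ++ [ cSep ]) (collect p m)) (map (λ j → encNat j ++ [ cSep ]) (if p m then [] else [ m ])))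
    | collect-text p m with p m
  ... | true  = refl
  ... | false = cong (concatTo m _ ++_) (++-identityʳ (encNat m ++ [ cSep ]))

  kids-text : ∀ n x → concat (map (λ j → encNat j ++ [ cSep ]) (kids n x)) ++ [ cEnd ] ≡ text kidsG (x ∷ n ∷ [])
  kids-text n x = cong (_++ [ cEnd ]) (trans (collect-text (noChild n x) x)
    (concatTo-cong x λ y → cong (λ b → if b then [] else encNat y ++ [ cSep ]) (sym (noChild-def n x y))))

  gate-text : ∀ n x → encGate (gate n x) ≡ text gateG (x ∷ n ∷ [])
  gate-text n x with isZero (n ∸ x)
  ... | false = refl
  ... | true with isZero ((n + n) ∸ x)
  ...   | false = refl
  ...   | true rewrite noAnd-def n x with noAnd n x
  ...     | true  = cong (cOr ∷_) (kids-text n x)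
  ...     | false = cong (cAnd ∷_) (kids-text n x)

  circuit-text : ∀ n → concat (map encGate (circuit n)) ≡ text circuitG (n ∷ [])
  circuit-text n = trans (Build.build-enc (gate n) (suc (lastGate n))) (concatTo-cong (suc (lastGate n)) (gate-text n))

  isZero-true : ∀ {m} → m ≡ 0 → isZero m ≡ true
  isZero-true refl = refl

  isZero-false : ∀ {m} → 0 < m → isZero m ≡ false
  isZero-false (s≤s _) = refl

  gate-inp : ∀ n {x} → x < n → gate n x ≡ inp x
  gate-inp n lt rewrite isZero-false (m<n⇒0<n∸m lt) = refl

  gate-not : ∀ n {x} → n ≤ x → x < n + n → gate n x ≡ notg (x ∸ n)
  gate-not n le lt rewrite isZero-true (m≤n⇒m∸n≡0 le) | isZero-false (m<n⇒0<n∸m lt) = refl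

  gate-inner : ∀ n {x} → n + n ≤ x → gate n x ≡ (if noAnd n x then org (kids n x) else andg (kids n x))
  gate-inner n {x} le rewrite isZero-true (m≤n⇒m∸n≡0 (≤-trans (m≤m+n n n) le)) | isZero-true (m≤n⇒m∸n≡0 le) = refl

  data Region (n x : ℕ) : Set where
    input   : x < n → Region n x
    negated : n ≤ x → x < n + n → Region n x
    inner   : n + n ≤ x → Region n x

  region : ∀ n x → Region n x
  region n x with x <? n
  ... | yes lt = input lt
  ... | no ge with x <? n + n
  ...   | yes lt  = negated (≮⇒≥ ge) lt
  ...   | no ge'  = inner (≮⇒≥ ge')

  gate-WF : ∀ n x → GateWF n x (gate n x)
  gate-WF n x with region n x
  ... | input lt rewrite gate-inp n lt = lt
  ... | negated le lt rewrite gate-not n le lt = ∸-monoʳ-< {x} {n} {0} (n≢0⇒n>0 λ { refl → n≮0 lt }) le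
  ... | inner le rewrite gate-inner n le with noAnd n x
  ...   | true  = collect-< (noChild n x) x
  ...   | false = collect-< (noChild n x) x

  circuit-WF : ∀ n → WellFormed n (circuit n)
  circuit-WF n = ≤-trans (s≤s z≤n) (≤-reflexive (sym (Build.length-build (gate n) (suc (lastGate n))))) ,
                 Build.build-WF (gate n) (gate-WF n) (suc (lastGate n))

  leaf-≤ : ∀ n s f → n + n ≤ node n s f
  leaf-≤ n s f = m≤m+n (n + n) _

  node-injective : ∀ n {s s'} f f' → AllBelow (N n) f → AllBelow (N n) f' → node n s f ≡ node n s' f' → s ≡ s' × f ≡ f'
  node-injective n f f' b b' e = code-injective f f' b b' (+-cancelˡ-≡ (n + n) _ _ e)

  node-< : ∀ n {s s'} f g → AllBelow (N n) g → s' < s → node n s' g < node n s f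
  node-< n f g b lt = +-monoʳ-< (n + n) (code-< f g b lt)

  module _ (w : List Bool) where
    private
      n = length w
      module V = Build.Values (gate n) w

    opaque
      value : ℕ → Bool
      value = V.entry'

      value-def : ∀ x → V.entry' x ≡ value x
      value-def x = refl

    opaque
      unfolding value

      value-lit⇒ : ∀ {y} → y < n + n → value y ≡ true → Lit w y
      value-lit⇒ {y} lt e with region n y
      ... | input lt' rewrite gate-inp n lt' = inj₁ (lt' , e)
      ... | inner le = contradiction lt (≤⇒≯ le)
      ... | negated le _ rewrite gate-not n le lt =
        inj₂ (y ∸ n , j<n , sym (m+[n∸m]≡n le) ,
              not-true (trans (cong not (sym look)) e))
        where
        j<n : y ∸ n < n
        j<n = +-cancelˡ-< n (y ∸ n) n (subst (_< n + n) (sym (m+[n∸m]≡n le)) lt)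
        j<y : y ∸ n < y
        j<y = <-≤-trans j<n le
        look : lookupD false (V.table y) (y ∸ n) ≡ lookupD false w (y ∸ n)
        look = trans (V.table-lookup y j<y) (cong (evalGate w (V.table (y ∸ n))) (gate-inp n j<n))
        not-true : ∀ {b} → not b ≡ true → b ≡ false
        not-true {false} _ = refl

      value-lit⇐ : ∀ {y} → Lit w y → value y ≡ true
      value-lit⇐ {y} (inj₁ (lt , e)) rewrite gate-inp n lt = e
      value-lit⇐ {y} (inj₂ (j , j<n , refl , e)) rewrite gate-not n {n + j} (m≤m+n n j) (+-monoʳ-< n j<n) | m+n∸m≡n n j =
        cong not (trans (V.table-lookup (n + j) (<-≤-trans j<n (m≤m+n n j))) (trans (cong (evalGate w (V.table j)) (gate-inp n j<n)) e))

      lookup-kid : ∀ x {y} → y < x → lookupD false (V.table x) y ≡ value y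
      lookup-kid x = V.table-lookup x

      or-value⇒ : ∀ {x} → n + n ≤ x → noAnd n x ≡ true → value x ≡ true → ∃ λ y → y < x × noChild n x y ≡ false × value y ≡ true
      or-value⇒ {x} le na e rewrite gate-inner n le | na with any-collect⇒ (lookupD false (V.table x)) (noChild n x) x e
      ... | y , lt , c , v = y , lt , c , trans (sym (lookup-kid x lt)) v

      or-value⇐ : ∀ {x y} → n + n ≤ x → noAnd n x ≡ true → y < x → noChild n x y ≡ false → value y ≡ true → value x ≡ true
      or-value⇐ {x} le na lt c v rewrite gate-inner n le | na =
        any-collect⇐ (lookupD false (V.table x)) (noChild n x) x lt c (trans (lookup-kid x lt) v)

      and-value⇒ : ∀ {x y} → n + n ≤ x → noAnd n x ≡ false → value x ≡ true → y < x → noChild n x y ≡ false → value y ≡ true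
      and-value⇒ {x} le na e lt c rewrite gate-inner n le | na =
        trans (sym (lookup-kid x lt)) (all-collect⇒ (lookupD false (V.table x)) (noChild n x) x e lt c)

      and-value⇐ : ∀ {x} → n + n ≤ x → noAnd n x ≡ false → (∀ {y} → y < x → noChild n x y ≡ false → value y ≡ true) → value x ≡ true
      and-value⇐ {x} le na h rewrite gate-inner n le | na =
        all-collect⇐ (lookupD false (V.table x)) (noChild n x) x (λ lt c → trans (lookup-kid x lt) (h lt c))

    -- A layer below `2 ^ h` reaches layer 0 after at most `h` halvings, and at layer 0 nothing is
    -- true; so a true gate has a tree of height `h`.
    value⇒Acc : ∀ h s f → AllBelow (N n) f → s < 2 ^ h → value (node n s f) ≡ true → Acc w h f
    value⇒Acc h s f b lt e with noAnd n (node n s f) in na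
    value⇒Acc h s f b lt e | true with or-value⇒ (leaf-≤ n s f) na e
    ... | y , y< , c , v with child⇒ n (node n s f) y c
    ...   | inj₁ (s₁ , f₁ , b₁ , eq , p , a , _) = contradiction (trans (sym na) (and⇐ n (node n s f) (s₁ , f₁ , b₁ , eq , p , a))) λ ()
    ...   | inj₂ (s₁ , f₁ , b₁ , eq , p , s' , g , b' , refl , hf , d) with node-injective n f f₁ b b₁ eq
    ...     | refl , refl = go h lt
      where
      go : ∀ h → s < 2 ^ h → Acc w h f
      go zero    lt = contradiction p (<⇒≱ lt)
      go (suc h) lt = by-or (λ a → contradiction (trans (sym na) (and⇐ n (node n s f) (s , f , b , refl , p , a))) λ ())
                        d b' (value⇒Acc h s' g b' (half-below h hf lt) v)
    value⇒Acc h s f b lt e | false with and⇒ n (node n s f) na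
    ... | s₁ , f₁ , b₁ , eq , p , a with node-injective n f f₁ b b₁ eq
    ...   | refl , refl = go h lt
      where
      go : ∀ h → s < 2 ^ h → Acc w h f
      go zero    lt = contradiction p (<⇒≱ lt)
      go (suc h) lt = by-and a
        (λ {g} d b' → value⇒Acc h ⌊ s /2⌋ g b' (half-below h (half s) lt)
          (and-value⇒ (leaf-≤ n s f) na e (node-< n f g b' (half-< {s} p (half s)))
            (child⇐ n (node n s f) _ (inj₂ (s , f , b , refl , p , ⌊ s /2⌋ , g , b' , refl , half s , d)))))
        (λ {y} l → value-lit⇒ (leaf-< l)
          (and-value⇒ (leaf-≤ n s f) na e (≤-trans (leaf-< l) (leaf-≤ n s f))
            (child⇐ n (node n s f) y (inj₁ (s , f , b , refl , p , a , l)))))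

    -- Starting from a layer of at least `2 ^ h`, the layer is still positive after `h` halvings,
    -- which leaves room for a tree of height `suc h`.
    Acc⇒value : ∀ h s f → AllBelow (N n) f → 2 ^ h ≤ s → Acc w (suc h) f → value (node n s f) ≡ true
    Acc⇒value (suc h) s f b le (by-or {g = g} ¬a d b' acc) =
      or-value⇐ (leaf-≤ n s f) na (node-< n f g b' (half-< {s} p (half s)))
        (child⇐ n (node n s f) _ (inj₂ (s , f , b , refl , p , ⌊ s /2⌋ , g , b' , refl , half s , d)))
        (Acc⇒value h ⌊ s /2⌋ g b' (half-above h (half s) le) acc)
      where
      p : 0 < s
      p = ≤-trans (m^n>0 2 (suc h)) le
      na : noAnd n (node n s f) ≡ true
      na with noAnd n (node n s f) in eq
      ... | true  = refl
      ... | false with and⇒ n (node n s f) eq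
      ...   | s₁ , f₁ , b₁ , e , _ , a with node-injective n f f₁ b b₁ e
      ...     | refl , refl = contradiction a ¬a
    Acc⇒value h s f b le (by-and a k l) =
      and-value⇐ (leaf-≤ n s f) (and⇐ n (node n s f) (s , f , b , refl , p , a)) λ {y} _ c → child (child⇒ n (node n s f) y c)
      where
      p : 0 < s
      p = ≤-trans (m^n>0 2 h) le
      below : ∀ h {s' g} → 2 ^ h ≤ s → Half s s' → AllBelow (N n) g → Acc w h g → value (node n s' g) ≡ true
      below (suc h) {s'} {g} le hf b' acc = Acc⇒value h s' g b' (half-above h hf le) acc
      child : ∀ {y} → LeafAt n (node n s f) y ⊎ EdgeAt n (node n s f) y → value y ≡ true
      child (inj₁ (s₁ , f₁ , b₁ , e , _ , _ , lf)) with node-injective n f f₁ b b₁ e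
      ... | refl , refl = value-lit⇐ (l lf)
      child (inj₂ (s₁ , f₁ , b₁ , e , _ , s' , g , b' , refl , hf , d)) with node-injective n f f₁ b b₁ e
      ... | refl , refl = below h le hf b' (k d b')

  module _ (n : ℕ) where
    private
      module Dp = Build.Depths (gate n)

    gateDepth-≤ : ∀ x → n + n ≤ x → ∀ {B} → (∀ {y} → y < x → noChild n x y ≡ false → Dp.entry' y ≤ B) → Dp.entry' x ≤ suc B
    gateDepth-≤ x le h rewrite gate-inner n le with noAnd n x
    ... | true  = s≤s (maxL-map _ (kids n x) (collect-all (noChild n x) x λ lt c → ≤-trans (≤-reflexive (Dp.table-lookup x lt)) (h lt c)))
    ... | false = s≤s (maxL-map _ (kids n x) (collect-all (noChild n x) x λ lt c → ≤-trans (≤-reflexive (Dp.table-lookup x lt)) (h lt c)))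

    literal-depth : ∀ {y} → y < n + n → Dp.entry' y ≤ 1
    literal-depth {y} lt with region n y
    ... | input lt' rewrite gate-inp n lt' = z≤n
    ... | inner le = contradiction lt (≤⇒≯ le)
    ... | negated le _ rewrite gate-not n le lt = s≤s (≤-reflexive (trans (Dp.table-lookup y j<y) (cong (gateDepth (Dp.table (y ∸ n))) (gate-inp n j<n))))
      where
      j<n : y ∸ n < n
      j<n = +-cancelˡ-< n (y ∸ n) n (subst (_< n + n) (sym (m+[n∸m]≡n le)) lt)
      j<y : y ∸ n < y
      j<y = <-≤-trans j<n le

    -- Each edge halves the layer and costs one level. The additional level pays for a negated
    -- input, or for an empty gate in layer 0.
    depth-≤ : ∀ h x → (∀ {s f} → AllBelow (N n) f → x ≡ node n s f → s < 2 ^ h) → Dp.entry' x ≤ suc h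
    depth-≤ h x bound with region n x
    ... | input lt      = ≤-trans (literal-depth (<-≤-trans lt (m≤m+n n n))) (s≤s z≤n)
    ... | negated _ lt  = ≤-trans (literal-depth lt) (s≤s z≤n)
    ... | inner le      = gateDepth-≤ x le λ {y} _ c → child h bound (child⇒ n x y c)
      where
      child : ∀ h → (∀ {s f} → AllBelow (N n) f → x ≡ node n s f → s < 2 ^ h) → ∀ {y} → LeafAt n x y ⊎ EdgeAt n x y → Dp.entry' y ≤ h
      child zero bound (inj₁ (s , f , b , e , p , _)) = contradiction p (<⇒≱ (bound b e))
      child zero bound (inj₂ (s , f , b , e , p , _)) = contradiction p (<⇒≱ (bound b e))
      child (suc h) bound (inj₁ (_ , _ , _ , _ , _ , _ , l)) = ≤-trans (literal-depth (leaf-< l)) (s≤s z≤n)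
      child (suc h) bound {y} (inj₂ (s , f , b , e , p , s' , g , b' , e' , hf , d)) = depth-≤ h y λ {s₁} {f₁} b₁ e₁ →
        subst (_< 2 ^ h) (node-injective n g f₁ b' b₁ (trans (sym e') e₁) .proj₁) (half-below h hf (bound b e))

    root-below : AllBelow (N n) (root n)
    root-below = replicate-all r
      where
      replicate-all : ∀ m → AllBelow (N n) (Vec.replicate m (n + slack))
      replicate-all zero    = VAll.[]
      replicate-all (suc m) = ≤-reflexive (sym (+-suc n slack)) VAll.∷ replicate-all m

    circuit-depth : ∀ h → top n < 2 ^ h → depth (circuit n) ≤ suc h
    circuit-depth h lt = Build.depth-build (gate n) (suc (lastGate n)) λ x x< → depth-≤ h x λ {s} {f} b e →
      ≤-<-trans (≮⇒≥ λ s> → <⇒≱ (≤-<-trans (≤-reflexive (lastGate-node n)) (<-≤-trans (node-< n f (root n) root-below s>) (≤-reflexive (sym e)))) (s≤s⁻¹ x<)) lt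

  private
    size-≤ : ∀ n → size (circuit n) ≤ (n + 2) ^ degree sizeE
    size-≤ n = ≤-trans (≤-reflexive (Build.length-build (gate n) (suc (lastGate n))))
      (eval-≤ sizeE (m≤n+m 2 n) λ { zero → m≤m+n n 2 })

  polySize : PolySize circuit
  polySize = c , λ n → ≤-trans (size-≤ n) (bound n)
    where
    d = degree sizeE
    -- For positive `n` one has `n + 2 ≤ 3 * n`, whence the factor `3 ^ d`; for `n = 0` the additive
    -- constant covers `2 ^ d`.
    c = 3 ^ d + d
    bound : ∀ n → (n + 2) ^ d ≤ c * n ^ c + c
    bound zero = ≤-trans (^-monoˡ-≤ d (s≤s (s≤s (z≤n {1})))) (≤-trans (m≤m+n (3 ^ d) d) (m≤n+m c (c * 0 ^ c)))
    bound n@(suc m) = begin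
      (n + 2) ^ d        ≤⟨ ^-monoˡ-≤ d (≤-trans (+-monoʳ-≤ n 2≤n+n) (≤-reflexive (cong (n +_) (cong (n +_) (sym (+-identityʳ n)))))) ⟩
      (3 * n) ^ d        ≡⟨ ^-distribʳ-* d 3 n ⟩
      3 ^ d * n ^ d      ≤⟨ *-mono-≤ (m≤m+n (3 ^ d) d) (^-monoʳ-≤ n (m≤n+m d (3 ^ d))) ⟩
      c * n ^ c          ≤⟨ m≤m+n _ c ⟩
      c * n ^ c + c      ∎
      where
      open ≤-Reasoning
      2≤n+n : 2 ≤ n + n
      2≤n+n = +-mono-≤ {1} {n} {1} {n} (s≤s z≤n) (s≤s z≤n)

  logDepth : LogDepth circuit
  logDepth = 3 + d , λ n → ≤-trans (circuit-depth n (suc (suc ⌈log₂ n ⌉ * d)) (top-< n)) (bound ⌈log₂ n ⌉)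
    where
    d = degree topE
    top-< : ∀ n → top n < 2 ^ suc (suc ⌈log₂ n ⌉ * d)
    top-< n = ≤-<-trans (≤-trans (eval-≤ topE {n ∷ []} (^-monoʳ-≤ 2 {1} {suc ⌈log₂ n ⌉} (s≤s z≤n))
                (λ { zero → ≤-trans (n≤2^⌈log₂n⌉ n) (^-monoʳ-≤ 2 (n≤1+n ⌈log₂ n ⌉)) }))
                (≤-reflexive (^-*-assoc 2 (suc ⌈log₂ n ⌉) d))) (^-monoʳ-< 2 (s≤s (s≤s z≤n)) {suc ⌈log₂ n ⌉ * d} ≤-refl)
    bound : ∀ l → suc (suc (suc l * d)) ≤ (3 + d) * l + (3 + d)
    bound l = begin
      2 + (d + l * d)           ≤⟨ +-monoʳ-≤ 2 (+-monoʳ-≤ d (≤-trans (≤-reflexive (*-comm l d)) (*-monoˡ-≤ l (m≤n+m d 3)))) ⟩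
      2 + (d + (3 + d) * l)     ≤⟨ n≤1+n _ ⟩
      3 + d + (3 + d) * l       ≡⟨ +-comm (3 + d) ((3 + d) * l) ⟩
      (3 + d) * l + (3 + d)     ∎
      where open ≤-Reasoning

  inAC¹ : ∀ {L : List Bool → Set} →
          (∀ w → L w → ∃ λ h → 2 ^ h ≤ top (length w) × Acc w (suc h) (root (length w))) →
          (∀ w h → Acc w h (root (length w)) → L w) → InAC¹ L
  inAC¹ {L} complete sound = circuit , Generator.uniform circuitG circuit circuit-text , circuit-WF , polySize , logDepth ,
    λ w → mk⇔ (to w) (from w)
    where
    accepted : ∀ w → evalCircuit (circuit (length w)) w ≡ value w (node (length w) (top (length w)) (root (length w)))
    accepted w = trans (Build.eval-build (gate (length w)) w (lastGate (length w))) (trans (value-def w (lastGate (length w))) (cong (value w) (lastGate-node (length w))))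
    to : ∀ w → evalCircuit (circuit (length w)) w ≡ true → L w
    -- Soundness holds for trees of any height, so the crude estimate `top < 2 ^ top` is good enough
    -- here.
    to w e = sound w (top (length w)) (value⇒Acc w (top (length w)) (top (length w)) (root (length w)) (root-below (length w))
               (n<2^n (top (length w))) (trans (sym (accepted w)) e))
      where
      n<2^n : ∀ n → n < 2 ^ n
      n<2^n zero    = s≤s z≤n
      n<2^n (suc n) = ≤-trans (+-mono-≤ (m^n>0 2 n) (n<2^n n)) (≤-reflexive (cong (2 ^ n +_) (sym (+-identityʳ (2 ^ n)))))
    from : ∀ w → L w → evalCircuit (circuit (length w)) w ≡ true
    from w l with complete w l
    ... | h , le , acc = trans (accepted w) (Acc⇒value w h (top (length w)) (root (length w)) (root-below (length w)) le acc)

-- Formulas and their encoding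

data UOp : Set where
  oX oF oG oY oP oH : UOp

data BOp : Set where
  oAnd oOr : BOp

-- Operators are grouped by arity, so that encodings, paths and frames treat all unary and all
-- binary ones uniformly.
data Fm (k : ℕ) : Set where
  at  : Bool → Fin k → Fm k
  un  : UOp → Fm k → Fm k
  bin : BOp → Fm k → Fm k → Fm k

atSym : Bool → Sym
atSym true  = sAtom
atSym false = sNAtom

unSym : UOp → Sym
unSym oX = sX
unSym oF = sF
unSym oG = sG
unSym oY = sY
unSym oP = sP
unSym oH = sH

binSym : BOp → Sym
binSym oAnd = sAnd
binSym oOr  = sOr

enc : ∀ {k} → Fm k → List Sym
enc (at s p)    = atSym s ∷ replicate (toℕ p) s1 ++ [ sEnd ]
enc (un o f)    = unSym o ∷ enc f
enc (bin o f g) = binSym o ∷ enc f ++ enc g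

toFormula : ∀ {k} → Fm k → Formula k
toFormula (at true p)    = atom p
toFormula (at false p)   = natom p
toFormula (un oX f)      = X (toFormula f)
toFormula (un oF f)      = F (toFormula f)
toFormula (un oG f)      = G (toFormula f)
toFormula (un oY f)      = Y (toFormula f)
toFormula (un oP f)      = P (toFormula f)
toFormula (un oH f)      = H (toFormula f)
toFormula (bin oAnd f g) = toFormula f ∧ᶠ toFormula g
toFormula (bin oOr f g)  = toFormula f ∨ᶠ toFormula g

fromFormula : ∀ {k} → Formula k → Fm k
fromFormula (atom p)  = at true p
fromFormula (natom p) = at false p
fromFormula (φ ∧ᶠ ψ)  = bin oAnd (fromFormula φ) (fromFormula ψ)
fromFormula (φ ∨ᶠ ψ)  = bin oOr (fromFormula φ) (fromFormula ψ)
fromFormula (X φ)     = un oX (fromFormula φ)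
fromFormula (F φ)     = un oF (fromFormula φ)
fromFormula (G φ)     = un oG (fromFormula φ)
fromFormula (Y φ)     = un oY (fromFormula φ)
fromFormula (P φ)     = un oP (fromFormula φ)
fromFormula (H φ)     = un oH (fromFormula φ)

to∘from : ∀ {k} (φ : Formula k) → toFormula (fromFormula φ) ≡ φ
to∘from (atom p)  = refl
to∘from (natom p) = refl
to∘from (φ ∧ᶠ ψ)  = cong₂ _∧ᶠ_ (to∘from φ) (to∘from ψ)
to∘from (φ ∨ᶠ ψ)  = cong₂ _∨ᶠ_ (to∘from φ) (to∘from ψ)
to∘from (X φ)     = cong X (to∘from φ)
to∘from (F φ)     = cong F (to∘from φ)
to∘from (G φ)     = cong G (to∘from φ)
to∘from (Y φ)     = cong Y (to∘from φ)
to∘from (P φ)     = cong P (to∘from φ)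
to∘from (H φ)     = cong H (to∘from φ)

enc-toFormula : ∀ {k} (f : Fm k) → encFormula (toFormula f) ≡ enc f
enc-toFormula (at true p)    = refl
enc-toFormula (at false p)   = refl
enc-toFormula (un oX f)      = cong (sX ∷_) (enc-toFormula f)
enc-toFormula (un oF f)      = cong (sF ∷_) (enc-toFormula f)
enc-toFormula (un oG f)      = cong (sG ∷_) (enc-toFormula f)
enc-toFormula (un oY f)      = cong (sY ∷_) (enc-toFormula f)
enc-toFormula (un oP f)      = cong (sP ∷_) (enc-toFormula f)
enc-toFormula (un oH f)      = cong (sH ∷_) (enc-toFormula f)
enc-toFormula (bin oAnd f g) = cong (sAnd ∷_) (cong₂ _++_ (enc-toFormula f) (enc-toFormula g))
enc-toFormula (bin oOr f g)  = cong (sOr ∷_) (cong₂ _++_ (enc-toFormula f) (enc-toFormula g))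


-- This is the binary value of the four bits of a symbol. It lets a single field of a node name a
-- symbol.
symCode : Sym → ℕ
symCode s0     = 0
symCode s1     = 1
symCode sRow   = 2
symCode sMid   = 3
symCode sAtom  = 4
symCode sNAtom = 5
symCode sAnd   = 6
symCode sOr    = 7
symCode sX     = 8
symCode sF     = 9
symCode sG     = 10
symCode sY     = 11
symCode sP     = 12
symCode sH     = 13
symCode sEnd   = 14

binary : List Bool → ℕ
binary = foldl (λ v b → (if b then 1 else 0) + (v + v)) 0

binary-symBits : ∀ σ → binary (symBits σ) ≡ symCode σ
binary-symBits s0     = refl
binary-symBits s1     = refl
binary-symBits sRow   = refl
binary-symBits sMid   = refl
binary-symBits sAtom  = refl
binary-symBits sNAtom = refl
binary-symBits sAnd   = refl
binary-symBits sOr    = refl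
binary-symBits sX     = refl
binary-symBits sF     = refl
binary-symBits sG     = refl
binary-symBits sY     = refl
binary-symBits sP     = refl
binary-symBits sH     = refl
binary-symBits sEnd   = refl

symbols : List Sym
symbols = s0 ∷ s1 ∷ sRow ∷ sMid ∷ sAtom ∷ sNAtom ∷ sAnd ∷ sOr ∷ sX ∷ sF ∷ sG ∷ sY ∷ sP ∷ sH ∷ sEnd ∷ []

symDecode : ℕ → Sym
symDecode = lookupD s0 symbols

symDecode-symCode : ∀ σ → symDecode (symCode σ) ≡ σ
symDecode-symCode s0     = refl
symDecode-symCode s1     = refl
symDecode-symCode sRow   = refl
symDecode-symCode sMid   = refl
symDecode-symCode sAtom  = refl
symDecode-symCode sNAtom = refl
symDecode-symCode sAnd   = refl
symDecode-symCode sOr    = refl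
symDecode-symCode sX     = refl
symDecode-symCode sF     = refl
symDecode-symCode sG     = refl
symDecode-symCode sY     = refl
symDecode-symCode sP     = refl
symDecode-symCode sH     = refl
symDecode-symCode sEnd   = refl

symCode-injective : ∀ {σ τ} → symCode σ ≡ symCode τ → σ ≡ τ
symCode-injective {σ} {τ} e = trans (sym (symDecode-symCode σ)) (trans (cong symDecode e) (symDecode-symCode τ))

∈symbols : ∀ σ → σ ∈ symbols
∈symbols s0     = here refl
∈symbols s1     = there (here refl)
∈symbols sRow   = there (there (here refl))
∈symbols sMid   = there (there (there (here refl)))
∈symbols sAtom  = there (there (there (there (here refl))))
∈symbols sNAtom = there (there (there (there (there (here refl)))))
∈symbols sAnd   = there (there (there (there (there (there (here refl))))))
∈symbols sOr    = there (there (there (there (there (there (there (here refl)))))))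
∈symbols sX     = there (there (there (there (there (there (there (there (here refl))))))))
∈symbols sF     = there (there (there (there (there (there (there (there (there (here refl)))))))))
∈symbols sG     = there (there (there (there (there (there (there (there (there (there (here refl))))))))))
∈symbols sY     = there (there (there (there (there (there (there (there (there (there (there (here refl)))))))))))
∈symbols sP     = there (there (there (there (there (there (there (there (there (there (there (there (here refl))))))))))))
∈symbols sH     = there (there (there (there (there (there (there (there (there (there (there (there (there (here refl)))))))))))))
∈symbols sEnd   = there (there (there (there (there (there (there (there (there (there (there (there (there (there (here refl))))))))))))))

symBits-length : ∀ σ → length (symBits σ) ≡ 4
symBits-length s0     = refl
symBits-length s1     = refl
symBits-length sRow   = refl
symBits-length sMid   = refl
symBits-length sAtom  = refl
symBits-length sNAtom = refl
symBits-length sAnd   = refl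
symBits-length sOr    = refl
symBits-length sX     = refl
symBits-length sF     = refl
symBits-length sG     = refl
symBits-length sY     = refl
symBits-length sP     = refl
symBits-length sH     = refl
symBits-length sEnd   = refl

∷-inj : ∀ {σ τ : Sym} {xs ys : List Sym} → σ ∷ xs ≡ τ ∷ ys → σ ≡ τ × xs ≡ ys
∷-inj refl = refl , refl

ones-injective : ∀ m m' {xs ys : List Sym} → replicate m s1 ++ sEnd ∷ xs ≡ replicate m' s1 ++ sEnd ∷ ys → m ≡ m' × xs ≡ ys
ones-injective zero    zero     refl = refl , refl
ones-injective (suc m) (suc m') e    = map₁ (cong suc) (ones-injective m m' (∷-inj e .proj₂))

unSym-injective : ∀ {o o'} → unSym o ≡ unSym o' → o ≡ o'
unSym-injective {oX} {oX} _ = refl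
unSym-injective {oF} {oF} _ = refl
unSym-injective {oG} {oG} _ = refl
unSym-injective {oY} {oY} _ = refl
unSym-injective {oP} {oP} _ = refl
unSym-injective {oH} {oH} _ = refl

binSym-injective : ∀ {o o'} → binSym o ≡ binSym o' → o ≡ o'
binSym-injective {oAnd} {oAnd} _ = refl
binSym-injective {oOr}  {oOr}  _ = refl

atSym-injective : ∀ {s s'} → atSym s ≡ atSym s' → s ≡ s'
atSym-injective {true}  {true}  _ = refl
atSym-injective {false} {false} _ = refl

-- An invariant that tells the leading symbols of the three kinds of formulas apart without
-- comparing them pair by pair.
arity : Sym → ℕ
arity sAnd = 2
arity sOr  = 2
arity sX   = 1
arity sF   = 1
arity sG   = 1
arity sY   = 1
arity sP   = 1
arity sH   = 1
arity _    = 0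

arity-at : ∀ s → arity (atSym s) ≡ 0
arity-at true  = refl
arity-at false = refl

arity-un : ∀ o → arity (unSym o) ≡ 1
arity-un oX = refl
arity-un oF = refl
arity-un oG = refl
arity-un oY = refl
arity-un oP = refl
arity-un oH = refl

arity-bin : ∀ o → arity (binSym o) ≡ 2
arity-bin oAnd = refl
arity-bin oOr  = refl

at≢un : ∀ {s o} → atSym s ≢ unSym o
at≢un {s} {o} e = contradiction (trans (sym (arity-at s)) (trans (cong arity e) (arity-un o))) λ ()

at≢bin : ∀ {s o} → atSym s ≢ binSym o
at≢bin {s} {o} e = contradiction (trans (sym (arity-at s)) (trans (cong arity e) (arity-bin o))) λ ()

un≢bin : ∀ {o o'} → unSym o ≢ binSym o'
un≢bin {o} {o'} e = contradiction (trans (sym (arity-un o)) (trans (cong arity e) (arity-bin o'))) λ ()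

-- Polish notation is a prefix code. The remainders `xs` and `ys` are there for the binary case,
-- where the second argument follows the first.
enc-prefix : ∀ {k} (f f' : Fm k) xs ys → enc f ++ xs ≡ enc f' ++ ys → f ≡ f' × xs ≡ ys
enc-prefix (at s p) (at s' p') xs ys e with ∷-inj e
... | e₁ , e₂ with ones-injective (toℕ p) (toℕ p')
                    (trans (sym (++-assoc (replicate (toℕ p) s1) [ sEnd ] xs)) (trans e₂ (++-assoc (replicate (toℕ p') s1) [ sEnd ] ys)))
...   | e₃ , e₄ = cong₂ at (atSym-injective e₁) (toℕ-injective e₃) , e₄
enc-prefix (un o f) (un o' f') xs ys e with ∷-inj e
... | e₁ , e₂ with enc-prefix f f' xs ys e₂
...   | e₃ , e₄ = cong₂ un (unSym-injective e₁) e₃ , e₄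
enc-prefix (bin o f g) (bin o' f' g') xs ys e with ∷-inj e
... | e₁ , e₂ with enc-prefix f f' (enc g ++ xs) (enc g' ++ ys)
                    (trans (sym (++-assoc (enc f) (enc g) xs)) (trans e₂ (++-assoc (enc f') (enc g') ys)))
...   | refl , e₃ with enc-prefix g g' xs ys e₃
...     | refl , e₄ = cong (λ o → bin o f g) (binSym-injective e₁) , e₄
enc-prefix (at s p)    (un o f)     xs ys e = contradiction (∷-inj e .proj₁) at≢un
enc-prefix (at s p)    (bin o f g)  xs ys e = contradiction (∷-inj e .proj₁) at≢bin
enc-prefix (un o f)    (at s p)     xs ys e = contradiction (sym (∷-inj e .proj₁)) at≢un
enc-prefix (un o f)    (bin o' g h) xs ys e = contradiction (∷-inj e .proj₁) un≢bin
enc-prefix (bin o f g) (at s p)     xs ys e = contradiction (sym (∷-inj e .proj₁)) at≢bin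
enc-prefix (bin o f g) (un o' h)    xs ys e = contradiction (sym (∷-inj e .proj₁)) un≢bin

enc-injective : ∀ {k} (f f' : Fm k) → enc f ≡ enc f' → f ≡ f'
enc-injective f f' e = enc-prefix f f' [] [] (cong (_++ []) e) .proj₁

enc≥1 : ∀ {k} (f : Fm k) → 1 ≤ length (enc f)
enc≥1 (at s p)    = s≤s z≤n
enc≥1 (un o f)    = s≤s z≤n
enc≥1 (bin o f g) = s≤s z≤n


-- Symbols read from the input word

record SymAt (w : List Bool) (u : ℕ) (σ : Sym) : Set where
  constructor symAt
  field
    inside : 4 * u + 4 ≤ length w
    digit  : ∀ {t} → t < 4 → lookupD false w (4 * u + t) ≡ lookupD false (symBits σ) t
open SymAt public

SymAt-unique : ∀ {w u σ τ} → SymAt w u σ → SymAt w u τ → σ ≡ τ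
SymAt-unique {σ = σ} {τ} (symAt _ p) (symAt _ q) = symCode-injective
  (trans (sym (binary-symBits σ)) (trans (cong binary (ext (symBits σ) (symBits τ) (symBits-length σ) (symBits-length τ)
    λ lt → trans (sym (p lt)) (q lt))) (binary-symBits τ)))
  where
  ext : ∀ {m} xs ys → length xs ≡ m → length ys ≡ m → (∀ {t} → t < m → lookupD false xs t ≡ lookupD false ys t) → xs ≡ ys
  ext []       []       _    _  h = refl
  ext (x ∷ xs) (y ∷ ys) refl e  h = cong₂ _∷_ (h (s≤s z≤n)) (ext xs ys refl (suc-injective e) λ lt → h (s≤s lt))
  ext []       (y ∷ ys) refl () h
  ext (x ∷ xs) []       refl () h

SymAt? : ∀ w u σ → Dec (SymAt w u σ)
SymAt? w u σ with 4 * u + 4 ≤? length w | allUpTo? (λ t → lookupD false w (4 * u + t) Data.Bool.≟ lookupD false (symBits σ) t) 4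
  where import Data.Bool
... | yes p | yes q = yes (symAt p q)
... | no ¬p | _     = no λ s → ¬p (s .inside)
... | _     | no ¬q = no λ s → ¬q (s .digit)

Match : List Bool → ℕ → List Sym → Set
Match w u []       = ⊤
Match w u (σ ∷ σs) = SymAt w u σ × Match w (suc u) σs

Match-++⁻ : ∀ {w} u xs {ys} → Match w u (xs ++ ys) → Match w u xs × Match w (u + length xs) ys
Match-++⁻ {w} u []       {ys} m       = tt , subst (λ i → Match w i ys) (sym (+-identityʳ u)) m
Match-++⁻ {w} u (x ∷ xs) {ys} (p , m) with Match-++⁻ (suc u) xs m
... | m₁ , m₂ = (p , m₁) , subst (λ i → Match w i ys) (sym (+-suc u (length xs))) m₂

Match-++⁺ : ∀ {w} u xs {ys} → Match w u xs → Match w (u + length xs) ys → Match w u (xs ++ ys)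
Match-++⁺ {w} u []       {ys} _       m = subst (λ i → Match w i ys) (+-identityʳ u) m
Match-++⁺ {w} u (x ∷ xs) {ys} (p , m₁) m₂ = p , Match-++⁺ (suc u) xs m₁ (subst (λ i → Match w i ys) (+-suc u (length xs)) m₂)

Match-unique : ∀ {w} u xs ys → Match w u xs → Match w u ys → length xs ≡ length ys → xs ≡ ys
Match-unique u []       []       _       _        _ = refl
Match-unique u (x ∷ xs) (y ∷ ys) (p , m) (p' , m') e =
  cong₂ _∷_ (SymAt-unique p p') (Match-unique (suc u) xs ys m m' (suc-injective e))

bitsOf : List Sym → List Bool
bitsOf σs = concat (map symBits σs)

length-bitsOf : ∀ σs → length (bitsOf σs) ≡ 4 * length σs
length-bitsOf []       = refl
length-bitsOf (σ ∷ σs) = trans (length-++ (symBits σ)) (trans (cong₂ _+_ (symBits-length σ) (length-bitsOf σs)) (sym (*-suc 4 (length σs))))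

private
  lookupD-++ʳ : ∀ (xs ys : List Bool) i → lookupD false (xs ++ ys) (length xs + i) ≡ lookupD false ys i
  lookupD-++ʳ []       ys i = refl
  lookupD-++ʳ (x ∷ xs) ys i = lookupD-++ʳ xs ys i

  lookupD-++ˡ : ∀ (xs ys : List Bool) {i} → i < length xs → lookupD false (xs ++ ys) i ≡ lookupD false xs i
  lookupD-++ˡ (x ∷ xs) ys {zero}  _       = refl
  lookupD-++ˡ (x ∷ xs) ys {suc i} (s≤s p) = lookupD-++ˡ xs ys p

match-bitsOf : ∀ σs → Match (bitsOf σs) 0 σs
match-bitsOf σs = go [] σs refl
  where
  w = bitsOf σs
  go : ∀ pre post → pre ++ post ≡ σs → Match w (length pre) post
  go pre []         e = tt
  go pre (σ ∷ post) e = symAt bound digits' ,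
    subst (λ u → Match w u post) (trans (length-++ pre) (+-comm (length pre) 1)) (go (pre ++ [ σ ]) post (trans (++-assoc pre [ σ ] post) e))
    where
    w≡ : w ≡ bitsOf pre ++ (symBits σ ++ bitsOf post)
    w≡ = trans (cong bitsOf (sym e)) (trans (cong concat (map-++ symBits pre (σ ∷ post))) (sym (concat-++ (map symBits pre) _)))
    len : length (bitsOf pre) ≡ 4 * length pre
    len = length-bitsOf pre
    bound : 4 * length pre + 4 ≤ length w
    bound = ≤-trans (+-mono-≤ (≤-reflexive (sym len)) (≤-trans (≤-reflexive (sym (symBits-length σ)))
              (≤-trans (m≤m+n _ _) (≤-reflexive (sym (length-++ (symBits σ)))))))
              (≤-reflexive (trans (sym (length-++ (bitsOf pre))) (cong length (sym w≡))))
    digits' : ∀ {t} → t < 4 → lookupD false w (4 * length pre + t) ≡ lookupD false (symBits σ) t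
    digits' {t} lt = trans (cong₂ (λ v i → lookupD false v (i + t)) w≡ (sym len)) (trans (lookupD-++ʳ (bitsOf pre) _ t)
                     (lookupD-++ˡ (symBits σ) (bitsOf post) (subst (t <_) (sym (symBits-length σ)) lt)))

match-total : ∀ w σs → Match w 0 σs → 4 * length σs ≡ length w → bitsOf σs ≡ w
match-total w σs m e = ext (bitsOf σs) w (trans (length-bitsOf σs) e) λ {i} lt →
  pointwise i (subst (i <_) (length-bitsOf σs) lt)
  where
  ext : ∀ (xs ys : List Bool) → length xs ≡ length ys → (∀ {t} → t < length xs → lookupD false xs t ≡ lookupD false ys t) → xs ≡ ys
  ext []       []       _ h = refl
  ext (x ∷ xs) (y ∷ ys) e h = cong₂ _∷_ (h (s≤s z≤n)) (ext xs ys (suc-injective e) λ lt → h (s≤s lt))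
  both : ∀ {v} u xs → Match v u xs → ∀ {i j t} → j ≡ u + i → i < length xs → t < 4 → Match w u xs →
         lookupD false v (4 * j + t) ≡ lookupD false w (4 * j + t)
  both {v} u (x ∷ xs) (symAt _ p , m) {zero}  e lt t< (symAt _ p' , m') with trans e (+-identityʳ u)
  ... | refl = trans (p t<) (sym (p' t<))
  both {v} u (x ∷ xs) (_ , m) {suc i} e (s≤s lt) t< (_ , m') = both (suc u) xs m (trans e (+-suc u i)) lt t< m'
  pointwise : ∀ i → i < 4 * length σs → lookupD false (bitsOf σs) i ≡ lookupD false w i
  pointwise i lt = subst (λ j → lookupD false (bitsOf σs) j ≡ lookupD false w j) (sym i≡)
    (both 0 σs (match-bitsOf σs) refl q< (m%n<n i 4) m)
    where
    i≡ : i ≡ 4 * (i / 4) + i % 4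
    i≡ = trans (m≡m%n+[m/n]*n i 4) (trans (+-comm (i % 4) _) (cong (_+ i % 4) (*-comm (i / 4) 4)))
    q< : i / 4 < length σs
    q< = *-cancelˡ-< 4 _ _ (≤-<-trans (≤-trans (m≤m+n _ (i % 4)) (≤-reflexive (sym i≡))) lt)

-- Truth on a trace written in the input word

module PathSemantics (w : List Bool) (k len : ℕ) where

  After : UOp → (ℕ → Set) → ℕ → Set
  After oX V x = suc x < len × V (suc x)
  After oY V x = ∃ λ q → x ≡ suc q × V q
  After oF V x = ∃ λ q → x ≤ q × q < len × V q
  After oG V x = ∀ {q} → x ≤ q → q < len → V q
  After oP V x = ∃ λ q → q ≤ x × V q
  After oH V x = ∀ {q} → q ≤ x → V q

  -- Truth at the 0-based position x < len of the trace written in the input word.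
  Val : Fm k → ℕ → Set
  Val (at s p)       x = SymAt w (x * suc k + toℕ p) (bitSym s)
  Val (un o f)       x = After o (Val f) x
  Val (bin oAnd f g) x = Val f x × Val g x
  Val (bin oOr f g)  x = Val f x ⊎ Val g x

  After? : ∀ o {V : ℕ → Set} → (∀ x → Dec (V x)) → ∀ x → Dec (After o V x)
  After? oX V? x with suc x <? len | V? (suc x)
  ... | yes p | yes q = yes (p , q)
  ... | no ¬p | _     = no λ (p , _) → ¬p p
  ... | _     | no ¬q = no λ (_ , q) → ¬q q
  After? oY V? zero    = no λ ()
  After? oY V? (suc x) with V? x
  ... | yes p = yes (x , refl , p)
  ... | no ¬p = no λ { (_ , refl , p) → ¬p p }
  After? oF V? x with anyUpTo? (λ q → (x ≤? q) ×-dec V? q) len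
  ... | yes (q , p , p' , v) = yes (q , p' , p , v)
  ... | no ¬p = no λ (q , p , p' , v) → ¬p (q , p' , p , v)
  After? oG V? x with allUpTo? (λ q → (x ≤? q) →-dec V? q) len
  ... | yes h = yes λ p p' → h p' p
  ... | no ¬h = no λ h → ¬h λ p p' → h p' p
  After? oP V? x with anyUpTo? V? (suc x)
  ... | yes (q , s≤s p , v) = yes (q , p , v)
  ... | no ¬p = no λ (q , p , v) → ¬p (q , s≤s p , v)
  After? oH V? x with allUpTo? V? (suc x)
  ... | yes h = yes λ p → h (s≤s p)
  ... | no ¬h = no λ h → ¬h λ { (s≤s p) → h p }

  -- Decidability serves to find the interval on which a formula with leading `F`, `G`, `P` or `H`
  -- holds.
  Val? : ∀ f x → Dec (Val f x)
  Val? (at s p)       x = SymAt? w (x * suc k + toℕ p) (bitSym s)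
  Val? (un o f)       x = After? o (Val? f) x
  Val? (bin oAnd f g) x = Val? f x ×-dec Val? g x
  Val? (bin oOr f g)  x = Val? f x ⊎-dec Val? g x

  module _ (π : Trace k len) (written : ∀ {x} p → x < len → SymAt w (x * suc k + toℕ p) (bitSym (val π (suc x) p))) where

    bitSym-injective : ∀ {a b} → bitSym a ≡ bitSym b → a ≡ b
    bitSym-injective {false} {false} _ = refl
    bitSym-injective {true}  {true}  _ = refl

    sat⇒ : ∀ f {x} → x < len → Sat π (suc x) (toFormula f) → Val f x
    sat⇒ (at true p)  {x} lt e = subst (λ b → SymAt w (x * suc k + toℕ p) (bitSym b)) e (written p lt)
    sat⇒ (at false p) {x} lt e = subst (λ b → SymAt w (x * suc k + toℕ p) (bitSym b)) e (written p lt)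
    sat⇒ (un oX f) lt (p , s) = p , sat⇒ f p s
    sat⇒ (un oF f) lt (suc j , s≤s p , q , s) = j , p , q , sat⇒ f q s
    sat⇒ (un oG f) lt h = λ p p' → sat⇒ f p' (h (suc _) (s≤s p) p')
    sat⇒ (un oY f) {suc x} lt (p , s) = x , refl , sat⇒ f (<-trans ≤-refl lt) s
    sat⇒ (un oY f) {zero} lt (s≤s () , s)
    sat⇒ (un oP f) lt (suc j , p , s≤s q , s) = j , q , sat⇒ f (≤-<-trans q lt) s
    sat⇒ (un oH f) lt h = λ p → sat⇒ f (≤-<-trans p lt) (h (suc _) (s≤s z≤n) (s≤s p))
    sat⇒ (bin oAnd f g) lt (s , s') = sat⇒ f lt s , sat⇒ g lt s'
    sat⇒ (bin oOr f g) lt (inj₁ s) = inj₁ (sat⇒ f lt s)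
    sat⇒ (bin oOr f g) lt (inj₂ s) = inj₂ (sat⇒ g lt s)

    sat⇐ : ∀ f {x} → x < len → Val f x → Sat π (suc x) (toFormula f)
    sat⇐ (at true p)  lt v = bitSym-injective (SymAt-unique (written p lt) v)
    sat⇐ (at false p) lt v = bitSym-injective (SymAt-unique (written p lt) v)
    sat⇐ (un oX f) lt (p , v) = p , sat⇐ f p v
    sat⇐ (un oF f) lt (q , p , p' , v) = suc q , s≤s p , p' , sat⇐ f p' v
    sat⇐ (un oG f) lt h = λ { (suc j) (s≤s p) p' → sat⇐ f p' (h p p') }
    sat⇐ (un oY f) lt (q , refl , v) = s≤s (s≤s z≤n) , sat⇐ f (<-trans ≤-refl lt) v
    sat⇐ (un oP f) lt (q , p , v) = suc q , s≤s z≤n , s≤s p , sat⇐ f (≤-<-trans p lt) v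
    sat⇐ (un oH f) lt h = λ { (suc j) _ (s≤s p) → sat⇐ f (≤-<-trans p lt) (h p) }
    sat⇐ (bin oAnd f g) lt (v , v') = sat⇐ f lt v , sat⇐ g lt v'
    sat⇐ (bin oOr f g) lt (inj₁ v) = inj₁ (sat⇐ f lt v)
    sat⇐ (bin oOr f g) lt (inj₂ v) = inj₂ (sat⇐ g lt v)

-- The proof system as an alternating graph

_≼_ : ∀ {m} → Exp m → Exp m → Frm m
a ≼ b = a ≺ lit 1 ⊕ b

infix 5 _≼_

eqs : ∀ {m r} → Vec (Exp m) r → Vec (Exp m) r → Frm m
eqs []       []         = lit 0 ≐ lit 0
eqs (e ∷ es) (e' ∷ es') = e ≐ e' ∧ᶜ eqs es es'

either : ∀ {A : Set} {m} → List A → (A → Frm m) → Frm m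
either []       φ = lit 0 ≺ lit 0
either (x ∷ xs) φ = φ x ∨ᶜ either xs φ

either⇐ : ∀ {A : Set} {m} {xs : List A} {x} (φ : A → Frm m) env → x ∈ xs → Holds (φ x) env → Holds (either xs φ) env
either⇐ φ env (here refl) h = inj₁ h
either⇐ φ env (there x∈)  h = inj₂ (either⇐ φ env x∈ h)

either⇒ : ∀ {A : Set} {m} (xs : List A) (φ : A → Frm m) env → Holds (either xs φ) env → ∃ λ x → x ∈ xs × Holds (φ x) env
either⇒ (x ∷ xs) φ env (inj₁ h) = x , here refl , h
either⇒ (x ∷ xs) φ env (inj₂ h) with either⇒ xs φ env h
... | y , y∈ , h' = y , there y∈ , h'

-- The nodes of the graph. An item u v i j stands for the claim that the symbols from u up to v encode a
-- formula which holds at every position x < ℓ with i ≤ x < j; positions are counted from 0, the alphabet has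
-- k propositions and the trace length ℓ. The node seqV k ℓ a₁ a₂ a₃ a₄ u v i j is to be accepted if the item
-- u v i j follows from the item a₁ a₂ a₃ a₄, where an item with a₁ = a₂ is no hypothesis at all.

module _ {A : Set} (c : ℕ → A) where
  seqV : (k ℓ a₁ a₂ a₃ a₄ u v i j : A) → Vec A 15
  seqV k ℓ a₁ a₂ a₃ a₄ u v i j = c 0 ∷ k ∷ ℓ ∷ a₁ ∷ a₂ ∷ a₃ ∷ a₄ ∷ u ∷ v ∷ i ∷ j ∷ c 0 ∷ c 0 ∷ c 0 ∷ c 0 ∷ []

  trueV : Vec A 15
  trueV = c 1 ∷ c 0 ∷ c 0 ∷ c 0 ∷ c 0 ∷ c 0 ∷ c 0 ∷ c 0 ∷ c 0 ∷ c 0 ∷ c 0 ∷ c 0 ∷ c 0 ∷ c 0 ∷ c 0 ∷ []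

  -- A conjunctive node between a sequent and the premises of one rule. The tag `t` is 2 for a cut,
  -- 3 for splitting an interval, 4 and 5 for unary and binary operators, 6 for literals. The last
  -- four fields hold guesses: the interpolant of a cut, the code of an operator, or the end of a
  -- first argument together with an interval for the second.
  ruleV : ℕ → (k ℓ a₁ a₂ a₃ a₄ u v i j e₁ e₂ e₃ e₄ : A) → Vec A 15
  ruleV t k ℓ a₁ a₂ a₃ a₄ u v i j e₁ e₂ e₃ e₄ =
    c t ∷ k ∷ ℓ ∷ a₁ ∷ a₂ ∷ a₃ ∷ a₄ ∷ u ∷ v ∷ i ∷ j ∷ e₁ ∷ e₂ ∷ e₃ ∷ e₄ ∷ []

  -- The symbol with code σ is at position u; x only records why this node was asked for.
  symV : (u σ x : A) → Vec A 15
  symV u σ x = c 7 ∷ c 0 ∷ c 0 ∷ c 0 ∷ c 0 ∷ c 0 ∷ c 0 ∷ u ∷ σ ∷ c 0 ∷ c 0 ∷ x ∷ c 0 ∷ c 0 ∷ c 0 ∷ []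

  -- A disjunctive node: one of the two bits is written at `u`. Edges are tested without
  -- quantifiers, so the row and column that determine `u` travel with the child.
  cellV : (u x y : A) → Vec A 15
  cellV u x y = c 8 ∷ c 0 ∷ c 0 ∷ c 0 ∷ c 0 ∷ c 0 ∷ c 0 ∷ u ∷ c 0 ∷ c 0 ∷ c 0 ∷ x ∷ y ∷ c 0 ∷ c 0 ∷ []

  goalV : (k ℓ q : A) → Vec A 15
  goalV k ℓ q = c 9 ∷ k ∷ ℓ ∷ c 0 ∷ c 0 ∷ c 0 ∷ c 0 ∷ q ∷ c 0 ∷ c 0 ∷ c 0 ∷ c 0 ∷ c 0 ∷ c 0 ∷ c 0 ∷ []

uops : List UOp
uops = oX ∷ oF ∷ oG ∷ oY ∷ oP ∷ oH ∷ []

bops : List BOp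
bops = oAnd ∷ oOr ∷ []

module _ {m : ℕ} where
  within : (i j i' j' : Exp m) → Frm m
  within i j i' j' = j ≼ i ∨ᶜ i' ≼ i ∧ᶜ j ≼ j'

  -- The truth of f on [ i' , j' ) entails that of o f at i.
  unCond : UOp → (ℓ i i' j' : Exp m) → Frm m
  unCond oX ℓ i i' j' = lit 1 ⊕ i ≺ ℓ ∧ᶜ i' ≼ lit 1 ⊕ i ∧ᶜ lit 1 ⊕ i ≺ j'
  unCond oY ℓ i i' j' = i' ≺ i ∧ᶜ i ≼ j'
  unCond oF ℓ i i' j' = i ≼ i' ∧ᶜ i' ≺ j' ∧ᶜ i' ≺ ℓ
  unCond oG ℓ i i' j' = i' ≼ i ∧ᶜ ℓ ≼ j'
  unCond oP ℓ i i' j' = i' ≼ i ∧ᶜ i' ≺ j'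
  unCond oH ℓ i i' j' = i' ≼ lit 0 ∧ᶜ i ≺ j'

  -- For a disjunction a single argument has to cover the whole interval. If different positions
  -- need different arguments, the interval is split beforehand.
  binCond : BOp → (i j i₁ j₁ i₂ j₂ : Exp m) → Frm m
  binCond oAnd i j i₁ j₁ i₂ j₂ = within i j i₁ j₁ ∧ᶜ within i j i₂ j₂
  binCond oOr  i j i₁ j₁ i₂ j₂ = within i j i₁ j₁ ∨ᶜ within i j i₂ j₂

  andFrm : Exp m → Vec (Exp m) 15 → Frm m
  andFrm n (t ∷ k ∷ ℓ ∷ a₁ ∷ a₂ ∷ a₃ ∷ a₄ ∷ u ∷ v ∷ i ∷ j ∷ e₁ ∷ e₂ ∷ e₃ ∷ e₄ ∷ []) =
    t ≐ lit 1 ∨ᶜ t ≐ lit 2 ∨ᶜ t ≐ lit 3 ∨ᶜ t ≐ lit 4 ∨ᶜ t ≐ lit 5 ∨ᶜ t ≐ lit 6 ∨ᶜ t ≐ lit 9 ∨ᶜ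
    -- A symbol node that reaches beyond the input is not conjunctive. As a disjunctive node without
    -- edges it is never accepted.
    t ≐ lit 7 ∧ᶜ lit 4 ⊗ u ⊕ lit 4 ≼ n

  literal : Exp m → Exp m → Bool → ℕ → Exp m
  literal n u true  t = lit 4 ⊗ u ⊕ lit t
  literal n u false t = n ⊕ (lit 4 ⊗ u ⊕ lit t)

  bitFrm : (n u y : Exp m) → Sym → ℕ → Frm m
  bitFrm n u y σ d = y ≐ literal n u (lookupD false (symBits σ) d) d

  symFrm : (n u v y : Exp m) → Sym → Frm m
  symFrm n u v y σ = v ≐ lit (symCode σ) ∧ᶜ either (0 ∷ 1 ∷ 2 ∷ 3 ∷ []) (bitFrm n u y σ)

  leafFrm : Exp m → Vec (Exp m) 15 → Exp m → Frm m
  leafFrm n (t ∷ k ∷ ℓ ∷ a₁ ∷ a₂ ∷ a₃ ∷ a₄ ∷ u ∷ v ∷ i ∷ j ∷ e₁ ∷ e₂ ∷ e₃ ∷ e₄ ∷ []) y =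
    t ≐ lit 7 ∧ᶜ lit 4 ⊗ u ⊕ lit 4 ≼ n ∧ᶜ either symbols (symFrm n u v y)

  seqEdge cutEdge splitEdge unEdge binEdge atomEdge cellEdge goalEdge rootEdge : Exp m → (f g : Vec (Exp m) 15) → Frm m
  seqEdge n (_ ∷ k ∷ ℓ ∷ a₁ ∷ a₂ ∷ a₃ ∷ a₄ ∷ u ∷ v ∷ i ∷ j ∷ _)
          g@(_ ∷ _ ∷ _ ∷ _ ∷ _ ∷ _ ∷ _ ∷ _ ∷ _ ∷ i' ∷ j' ∷ d₁ ∷ d₂ ∷ d₃ ∷ d₄ ∷ []) =
    (u ≺ v ∧ᶜ a₁ ≐ u ∧ᶜ a₂ ≐ v ∧ᶜ within i j a₃ a₄ ∧ᶜ eqs g (trueV lit)) ∨ᶜ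
    eqs g (ruleV lit 2 k ℓ a₁ a₂ a₃ a₄ u v i j d₁ d₂ d₃ d₄) ∨ᶜ
    (i ≺ j ∧ᶜ eqs g (ruleV lit 3 k ℓ a₁ a₂ a₃ a₄ u v i j (lit 0) (lit 0) (lit 0) (lit 0))) ∨ᶜ
    -- The unary rule concludes truth at the one position `i`, or only well-formedness if `j ≤ i`.
    (lit 1 ⊕ u ≼ v ∧ᶜ either uops (λ o → d₁ ≐ lit (symCode (unSym o)) ∧ᶜ (j ≼ i ∨ᶜ j ≐ lit 1 ⊕ i ∧ᶜ unCond o ℓ i i' j')) ∧ᶜ
     eqs g (ruleV lit 4 k ℓ a₁ a₂ a₃ a₄ u v i' j' d₁ (lit 0) (lit 0) (lit 0))) ∨ᶜ
    (lit 1 ⊕ u ≼ v ∧ᶜ either bops (λ o → d₄ ≐ lit (symCode (binSym o)) ∧ᶜ binCond o i j i' j' d₂ d₃) ∧ᶜ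
     eqs g (ruleV lit 5 k ℓ a₁ a₂ a₃ a₄ u v i' j' d₁ d₂ d₃ d₄)) ∨ᶜ
    -- The codes 4 and 5 are those of the two literals. A literal takes two symbols plus its index
    -- in unary, so the bounds on `v` say that the index is below `k`; the bound on `ℓ` keeps trace
    -- positions in the range of a field.
    ((d₁ ≐ lit 4 ∨ᶜ d₁ ≐ lit 5) ∧ᶜ lit 2 ⊕ u ≼ v ∧ᶜ v ≺ lit 2 ⊕ u ⊕ k ∧ᶜ ℓ ⊗ (lit 1 ⊕ k) ≼ n ∧ᶜ
     eqs g (ruleV lit 6 k ℓ (lit 0) (lit 0) (lit 0) (lit 0) u v i j d₁ (lit 0) (lit 0) (lit 0)))
  cutEdge n (_ ∷ k ∷ ℓ ∷ a₁ ∷ a₂ ∷ a₃ ∷ a₄ ∷ u ∷ v ∷ i ∷ j ∷ e₁ ∷ e₂ ∷ e₃ ∷ e₄ ∷ []) g =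
    eqs g (seqV lit k ℓ a₁ a₂ a₃ a₄ e₁ e₂ e₃ e₄) ∨ᶜ eqs g (seqV lit k ℓ e₁ e₂ e₃ e₄ u v i j)
  splitEdge n (_ ∷ k ∷ ℓ ∷ a₁ ∷ a₂ ∷ a₃ ∷ a₄ ∷ u ∷ v ∷ i ∷ j ∷ _)
            g@(_ ∷ _ ∷ _ ∷ _ ∷ _ ∷ _ ∷ _ ∷ _ ∷ _ ∷ x ∷ _) =
    i ≼ x ∧ᶜ x ≺ j ∧ᶜ eqs g (seqV lit k ℓ a₁ a₂ a₃ a₄ u v x (lit 1 ⊕ x))
  unEdge n (_ ∷ k ∷ ℓ ∷ a₁ ∷ a₂ ∷ a₃ ∷ a₄ ∷ u ∷ v ∷ i ∷ j ∷ σ ∷ _) g =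
    eqs g (seqV lit k ℓ a₁ a₂ a₃ a₄ (lit 1 ⊕ u) v i j) ∨ᶜ eqs g (symV lit u σ (lit 0))
  binEdge n (_ ∷ k ∷ ℓ ∷ a₁ ∷ a₂ ∷ a₃ ∷ a₄ ∷ u ∷ v ∷ i ∷ j ∷ m' ∷ i' ∷ j' ∷ σ ∷ []) g =
    eqs g (seqV lit k ℓ a₁ a₂ a₃ a₄ (lit 1 ⊕ u) m' i j) ∨ᶜ eqs g (seqV lit k ℓ a₁ a₂ a₃ a₄ m' v i' j') ∨ᶜ
    eqs g (symV lit u σ (lit 0))
  atomEdge n (_ ∷ k ∷ ℓ ∷ _ ∷ _ ∷ _ ∷ _ ∷ u ∷ v ∷ i ∷ j ∷ σ ∷ _)
           g@(_ ∷ _ ∷ _ ∷ _ ∷ _ ∷ _ ∷ _ ∷ p ∷ _ ∷ _ ∷ _ ∷ x ∷ _) =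
    eqs g (symV lit u σ (lit 0)) ∨ᶜ
    (u ≺ p ∧ᶜ lit 1 ⊕ p ≺ v ∧ᶜ eqs g (symV lit p (lit 1) (lit 0))) ∨ᶜ
    (lit 1 ⊕ p ≐ v ∧ᶜ eqs g (symV lit p (lit 14) (lit 0))) ∨ᶜ
    (i ≼ x ∧ᶜ x ≺ j ∧ᶜ x ≺ ℓ ∧ᶜ p ≐ x ⊗ (lit 1 ⊕ k) ⊕ (v ⊖ (lit 2 ⊕ u)) ∧ᶜ eqs g (symV lit p (lit 5 ⊖ σ) x))
  cellEdge n (_ ∷ _ ∷ _ ∷ _ ∷ _ ∷ _ ∷ _ ∷ u ∷ _) g = eqs g (symV lit u (lit 0) (lit 0)) ∨ᶜ eqs g (symV lit u (lit 1) (lit 0))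
  goalEdge n (_ ∷ k ∷ ℓ ∷ _ ∷ _ ∷ _ ∷ _ ∷ q ∷ _) g@(_ ∷ _ ∷ _ ∷ _ ∷ _ ∷ _ ∷ _ ∷ p ∷ _ ∷ _ ∷ _ ∷ x ∷ y ∷ _) =
    (x ≺ ℓ ∧ᶜ y ≺ k ∧ᶜ p ≐ x ⊗ (lit 1 ⊕ k) ⊕ y ∧ᶜ eqs g (cellV lit p x y)) ∨ᶜ
    (x ≺ ℓ ∧ᶜ p ≐ x ⊗ (lit 1 ⊕ k) ⊕ k ∧ᶜ eqs g (symV lit p (lit 2) x)) ∨ᶜ
    eqs g (symV lit (ℓ ⊗ (lit 1 ⊕ k)) (lit 3) (lit 0)) ∨ᶜ
    eqs g (seqV lit k ℓ (lit 0) (lit 0) (lit 0) (lit 0) (lit 1 ⊕ ℓ ⊗ (lit 1 ⊕ k)) q (lit 0) (lit 1))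
  rootEdge n f g@(_ ∷ k ∷ ℓ ∷ _ ∷ _ ∷ _ ∷ _ ∷ q ∷ _) =
    -- `q` is the number of symbols of the word, four bits each. Traces are nonempty in the problem,
    -- hence `1 ≤ ℓ`.
    lit 4 ⊗ q ≐ n ∧ᶜ lit 1 ≼ ℓ ∧ᶜ lit 1 ⊕ ℓ ⊗ (lit 1 ⊕ k) ≼ q ∧ᶜ eqs g (goalV lit k ℓ q)

  edgeFrm : Exp m → (f g : Vec (Exp m) 15) → Frm m
  edgeFrm n f@(t ∷ _) g =
    (t ≐ lit 0 ∧ᶜ seqEdge n f g) ∨ᶜ (t ≐ lit 2 ∧ᶜ cutEdge n f g) ∨ᶜ (t ≐ lit 3 ∧ᶜ splitEdge n f g) ∨ᶜ
    (t ≐ lit 4 ∧ᶜ unEdge n f g) ∨ᶜ (t ≐ lit 5 ∧ᶜ binEdge n f g) ∨ᶜ (t ≐ lit 6 ∧ᶜ atomEdge n f g) ∨ᶜ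
    (t ≐ lit 8 ∧ᶜ cellEdge n f g) ∨ᶜ (t ≐ lit 9 ∧ᶜ goalEdge n f g) ∨ᶜ (t ≐ lit 20 ⊕ n ∧ᶜ rootEdge n f g)

constants : ∀ {r} → Vec ℕ r → Vec (Exp 0) r
constants = Vec.map lit

-- The relations are the formulas themselves at constant expressions, so the specifications hold by
-- `refl` once the vectors are split into fields.
pathGraph : Graph 15
pathGraph = record
  -- This leaves room for the tags up to 9 and the symbol codes up to 14 even for short inputs, and
  -- it sets the tag `20 + n` of the root apart from the others.
  { slack     = 20
  ; andF      = andFrm
  ; edgeF     = edgeFrm
  ; leafF     = leafFrm
  ; And       = λ n f → Holds (andFrm (lit n) (constants f)) []
  ; Edge      = λ n f g → Holds (edgeFrm (lit n) (constants f) (constants g)) []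
  ; Leaf      = λ n f y → Holds (leafFrm (lit n) (constants f) (lit y)) []
  ; and-spec  = λ { n (_ ∷ _ ∷ _ ∷ _ ∷ _ ∷ _ ∷ _ ∷ _ ∷ _ ∷ _ ∷ _ ∷ _ ∷ _ ∷ _ ∷ _ ∷ []) env → refl }
  ; edge-spec = λ { n (_ ∷ _ ∷ _ ∷ _ ∷ _ ∷ _ ∷ _ ∷ _ ∷ _ ∷ _ ∷ _ ∷ _ ∷ _ ∷ _ ∷ _ ∷ [])
                      (_ ∷ _ ∷ _ ∷ _ ∷ _ ∷ _ ∷ _ ∷ _ ∷ _ ∷ _ ∷ _ ∷ _ ∷ _ ∷ _ ∷ _ ∷ []) env → refl }
  ; leaf-spec = λ { n (_ ∷ _ ∷ _ ∷ _ ∷ _ ∷ _ ∷ _ ∷ _ ∷ _ ∷ _ ∷ _ ∷ _ ∷ _ ∷ _ ∷ _ ∷ []) y env → refl }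
  ; leaf-<    = λ {n} {f} → leaf-below n f
  }
  where
  leaf-below : ∀ n f {y} → Holds (leafFrm (lit n) (constants f) (lit y)) [] → y < n + n
  leaf-below n (t ∷ k ∷ ℓ ∷ a₁ ∷ a₂ ∷ a₃ ∷ a₄ ∷ u ∷ v ∷ i ∷ j ∷ e₁ ∷ e₂ ∷ e₃ ∷ e₄ ∷ []) {y} (_ , s≤s bd , h)
    with either⇒ symbols (symFrm (lit n) (lit u) (lit v) (lit y)) [] h
  ... | σ , _ , _ , h' with either⇒ (0 ∷ 1 ∷ 2 ∷ 3 ∷ []) (bitFrm (lit n) (lit u) (lit y) σ) [] h'
  ...   | d , d∈ , e = go (lookupD false (symBits σ) d) e
    where
    d<4 : d < 4
    d<4 = below d∈
      where
      below : ∀ {d : ℕ} → d ∈ (0 ∷ 1 ∷ 2 ∷ 3 ∷ []) → d < 4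
      below (here refl) = s≤s z≤n
      below (there (here refl)) = s≤s (s≤s z≤n)
      below (there (there (here refl))) = s≤s (s≤s (s≤s z≤n))
      below (there (there (there (here refl)))) = ≤-refl
    lt : 4 * u + d < n
    lt = <-≤-trans (+-monoʳ-< (4 * u) d<4) bd
    go : ∀ b → y ≡ eval (literal (lit n) (lit u) b d) [] → y < n + n
    go true  refl = <-≤-trans lt (m≤m+n n n)
    go false refl = +-monoʳ-< n lt

module PathRules (topE : Exp 1) (w : List Bool) where
  open Unroll pathGraph topE public
  open PathSemantics w

  n : ℕ
  n = length w

  opaque
    Edge : Vec ℕ 15 → Vec ℕ 15 → Set
    Edge = Graph.Edge pathGraph n

    And : Vec ℕ 15 → Set
    And = Graph.And pathGraph n

  HasEdges : ℕ → Set
  HasEdges 1 = ⊥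
  HasEdges 7 = ⊥
  HasEdges _ = ⊤

  -- The disjunct of `edgeFrm` that belongs to a tag: for a known tag, matching on an edge leaves
  -- one case instead of nine.
  EdgeFrom : ℕ → (f g : Vec ℕ 15) → Set
  EdgeFrom t f g = Holds (choose t (lit n) (constants f) (constants g)) []
    where
    choose : ℕ → Exp 0 → (f g : Vec (Exp 0) 15) → Frm 0
    choose 0 = seqEdge
    choose 2 = cutEdge
    choose 3 = splitEdge
    choose 4 = unEdge
    choose 5 = binEdge
    choose 6 = atomEdge
    choose 8 = cellEdge
    choose 9 = goalEdge
    choose _ = rootEdge

  opaque
    unfolding Edge And

    edge-from : ∀ {t f g} → Edge (t ∷ f) g → EdgeFrom t (t ∷ f) g
    edge-from (inj₁ (refl , e)) = e
    edge-from (inj₂ (inj₁ (refl , e))) = e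
    edge-from (inj₂ (inj₂ (inj₁ (refl , e)))) = e
    edge-from (inj₂ (inj₂ (inj₂ (inj₁ (refl , e))))) = e
    edge-from (inj₂ (inj₂ (inj₂ (inj₂ (inj₁ (refl , e)))))) = e
    edge-from (inj₂ (inj₂ (inj₂ (inj₂ (inj₂ (inj₁ (refl , e))))))) = e
    edge-from (inj₂ (inj₂ (inj₂ (inj₂ (inj₂ (inj₂ (inj₁ (refl , e)))))))) = e
    edge-from (inj₂ (inj₂ (inj₂ (inj₂ (inj₂ (inj₂ (inj₂ (inj₁ (refl , e))))))))) = e
    edge-from (inj₂ (inj₂ (inj₂ (inj₂ (inj₂ (inj₂ (inj₂ (inj₂ (refl , e))))))))) = e

    from-seq : ∀ {f g} → EdgeFrom 0 (0 ∷ f) g → Edge (0 ∷ f) g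
    from-seq e = inj₁ (refl , e)

    from-cut : ∀ {f g} → EdgeFrom 2 (2 ∷ f) g → Edge (2 ∷ f) g
    from-cut e = inj₂ (inj₁ (refl , e))

    from-split : ∀ {f g} → EdgeFrom 3 (3 ∷ f) g → Edge (3 ∷ f) g
    from-split e = inj₂ (inj₂ (inj₁ (refl , e)))

    from-un : ∀ {f g} → EdgeFrom 4 (4 ∷ f) g → Edge (4 ∷ f) g
    from-un e = inj₂ (inj₂ (inj₂ (inj₁ (refl , e))))

    from-bin : ∀ {f g} → EdgeFrom 5 (5 ∷ f) g → Edge (5 ∷ f) g
    from-bin e = inj₂ (inj₂ (inj₂ (inj₂ (inj₁ (refl , e)))))

    from-atom : ∀ {f g} → EdgeFrom 6 (6 ∷ f) g → Edge (6 ∷ f) g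
    from-atom e = inj₂ (inj₂ (inj₂ (inj₂ (inj₂ (inj₁ (refl , e))))))

    from-cell : ∀ {f g} → EdgeFrom 8 (8 ∷ f) g → Edge (8 ∷ f) g
    from-cell e = inj₂ (inj₂ (inj₂ (inj₂ (inj₂ (inj₂ (inj₁ (refl , e)))))))

    from-goal : ∀ {f g} → EdgeFrom 9 (9 ∷ f) g → Edge (9 ∷ f) g
    from-goal e = inj₂ (inj₂ (inj₂ (inj₂ (inj₂ (inj₂ (inj₂ (inj₁ (refl , e))))))))

    from-root : ∀ {f g} → EdgeFrom (20 + n) (20 + n ∷ f) g → Edge (20 + n ∷ f) g
    from-root e = inj₂ (inj₂ (inj₂ (inj₂ (inj₂ (inj₂ (inj₂ (inj₂ (refl , e))))))))


    or-children : ∀ {h f} → ¬ And f → Acc w h f → ∃₂ λ h' g → h ≡ suc h' × Edge f g × AllBelow (N n) g × Acc w h' g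
    or-children ¬a (by-or _ e b acc) = _ , _ , refl , e , b , acc
    or-children ¬a (by-and a _ _)    = contradiction a ¬a

    and-children : ∀ {h f g} → And f → Acc w h f → Edge f g → AllBelow (N n) g → ∃ λ h' → h ≡ suc h' × Acc w h' g
    and-children a (by-or ¬a _ _ _) e b = contradiction a ¬a
    and-children a (by-and _ k _)   e b = _ , refl , k e b

    seq-or : ∀ {f} → ¬ And (0 ∷ f)
    seq-or {_ ∷ _ ∷ _ ∷ _ ∷ _ ∷ _ ∷ _ ∷ _ ∷ _ ∷ _ ∷ _ ∷ _ ∷ _ ∷ _ ∷ []}
      (inj₂ (inj₂ (inj₂ (inj₂ (inj₂ (inj₂ (inj₂ (() , _))))))))

    cell-or : ∀ {f} → ¬ And (8 ∷ f)
    cell-or {_ ∷ _ ∷ _ ∷ _ ∷ _ ∷ _ ∷ _ ∷ _ ∷ _ ∷ _ ∷ _ ∷ _ ∷ _ ∷ _ ∷ []}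
      (inj₂ (inj₂ (inj₂ (inj₂ (inj₂ (inj₂ (inj₂ (() , _))))))))

    root-or : ∀ {f} → ¬ And (20 + n ∷ f)
    root-or {_ ∷ _ ∷ _ ∷ _ ∷ _ ∷ _ ∷ _ ∷ _ ∷ _ ∷ _ ∷ _ ∷ _ ∷ _ ∷ _ ∷ []}
      (inj₂ (inj₂ (inj₂ (inj₂ (inj₂ (inj₂ (inj₂ (() , _))))))))

    true-and : And (trueV id)
    true-and = inj₁ refl

    cut-and : ∀ {f} → And (2 ∷ f)
    cut-and {_ ∷ _ ∷ _ ∷ _ ∷ _ ∷ _ ∷ _ ∷ _ ∷ _ ∷ _ ∷ _ ∷ _ ∷ _ ∷ _ ∷ []} = inj₂ (inj₁ refl)

    split-and : ∀ {f} → And (3 ∷ f)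
    split-and {_ ∷ _ ∷ _ ∷ _ ∷ _ ∷ _ ∷ _ ∷ _ ∷ _ ∷ _ ∷ _ ∷ _ ∷ _ ∷ _ ∷ []} = inj₂ (inj₂ (inj₁ refl))

    un-and : ∀ {f} → And (4 ∷ f)
    un-and {_ ∷ _ ∷ _ ∷ _ ∷ _ ∷ _ ∷ _ ∷ _ ∷ _ ∷ _ ∷ _ ∷ _ ∷ _ ∷ _ ∷ []} = inj₂ (inj₂ (inj₂ (inj₁ refl)))

    bin-and : ∀ {f} → And (5 ∷ f)
    bin-and {_ ∷ _ ∷ _ ∷ _ ∷ _ ∷ _ ∷ _ ∷ _ ∷ _ ∷ _ ∷ _ ∷ _ ∷ _ ∷ _ ∷ []} = inj₂ (inj₂ (inj₂ (inj₂ (inj₁ refl))))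

    atom-and : ∀ {f} → And (6 ∷ f)
    atom-and {_ ∷ _ ∷ _ ∷ _ ∷ _ ∷ _ ∷ _ ∷ _ ∷ _ ∷ _ ∷ _ ∷ _ ∷ _ ∷ _ ∷ []} = inj₂ (inj₂ (inj₂ (inj₂ (inj₂ (inj₁ refl)))))

    goal-and : ∀ {f} → And (9 ∷ f)
    goal-and {_ ∷ _ ∷ _ ∷ _ ∷ _ ∷ _ ∷ _ ∷ _ ∷ _ ∷ _ ∷ _ ∷ _ ∷ _ ∷ _ ∷ []} = inj₂ (inj₂ (inj₂ (inj₂ (inj₂ (inj₂ (inj₁ refl))))))

    sym-and : ∀ {u σ x} → 4 * u + 4 ≤ n → And (symV id u σ x)
    sym-and le = inj₂ (inj₂ (inj₂ (inj₂ (inj₂ (inj₂ (inj₂ (refl , s≤s le)))))))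

    sym-and⁻ : ∀ {u σ x} → And (symV id u σ x) → 4 * u + 4 ≤ n
    sym-and⁻ (inj₂ (inj₂ (inj₂ (inj₂ (inj₂ (inj₂ (inj₂ (_ , s≤s le)))))))) = le

    has-edges : ∀ {t f g} → Edge (t ∷ f) g → HasEdges t
    has-edges (inj₁ (refl , _)) = tt
    has-edges (inj₂ (inj₁ (refl , _))) = tt
    has-edges (inj₂ (inj₂ (inj₁ (refl , _)))) = tt
    has-edges (inj₂ (inj₂ (inj₂ (inj₁ (refl , _))))) = tt
    has-edges (inj₂ (inj₂ (inj₂ (inj₂ (inj₁ (refl , _)))))) = tt
    has-edges (inj₂ (inj₂ (inj₂ (inj₂ (inj₂ (inj₁ (refl , _))))))) = tt
    has-edges (inj₂ (inj₂ (inj₂ (inj₂ (inj₂ (inj₂ (inj₁ (refl , _)))))))) = tt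
    has-edges (inj₂ (inj₂ (inj₂ (inj₂ (inj₂ (inj₂ (inj₂ (inj₁ (refl , _))))))))) = tt
    has-edges (inj₂ (inj₂ (inj₂ (inj₂ (inj₂ (inj₂ (inj₂ (inj₂ (refl , _))))))))) = tt

  opaque
    unfolding Edge And

    or-node : ∀ {h f g} → ¬ And f → Edge f g → AllBelow (N n) g → Acc w h g → Acc w (suc h) f
    or-node = by-or

    no-leaf : ∀ {t f y} → t ≢ 7 → ¬ Graph.Leaf pathGraph n (t ∷ f) y
    no-leaf {f = _ ∷ _ ∷ _ ∷ _ ∷ _ ∷ _ ∷ _ ∷ _ ∷ _ ∷ _ ∷ _ ∷ _ ∷ _ ∷ _ ∷ []} ne (e , _) = ne e

    and-node : ∀ {h t f} → t ≢ 7 → And (t ∷ f) → (∀ {g} → EdgeFrom t (t ∷ f) g → AllBelow (N n) g → Acc w h g) → Acc w (suc h) (t ∷ f)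
    and-node {f = f} ne a k = by-and a (λ e b → k (edge-from e) b) (λ l → ⊥-elim (no-leaf {f = f} ne l))

    true-acc : ∀ {h} → Acc w (suc h) (trueV id)
    true-acc = by-and true-and (λ e _ → ⊥-elim (has-edges e)) (λ { (() , _) })

    sym-sound : ∀ {h u x} σ → Acc w h (symV id u (symCode σ) x) → SymAt w u σ
    sym-sound σ (by-or _ e _ _) = ⊥-elim (has-edges e)
    sym-sound {u = u} {x} σ (by-and a _ l) = symAt bound bits'
      where
      bound : 4 * u + 4 ≤ n
      bound = sym-and⁻ {u} {symCode σ} {x} a
      value : ∀ {t} (b : Bool) → t < 4 → Lit w (eval (literal (lit n) (lit u) b t) []) → lookupD false w (4 * u + t) ≡ b
      value true  t< (inj₁ (_ , e)) = e
      -- The leaf is a number below `n`, so it cannot be a negated bit `n + j`.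
      value {t} true  t< (inj₂ (j , _ , e , _)) = contradiction (≤-trans (m≤m+n n j) (≤-reflexive (sym e)))
        (<⇒≱ (<-≤-trans (+-monoʳ-< (4 * u) t<) bound))
      value false t< (inj₁ (lt , _)) = contradiction (m≤m+n n _) (<⇒≱ lt)
      value false t< (inj₂ (j , _ , e , e')) rewrite +-cancelˡ-≡ n _ j e = e'
      digit∈ : ∀ {t} → t < 4 → t ∈ (0 ∷ 1 ∷ 2 ∷ 3 ∷ [])
      digit∈ {0} _ = here refl
      digit∈ {1} _ = there (here refl)
      digit∈ {2} _ = there (there (here refl))
      digit∈ {3} _ = there (there (there (here refl)))
      digit∈ {suc (suc (suc (suc _)))} (s≤s (s≤s (s≤s (s≤s ()))))
      bits' : ∀ {t} → t < 4 → lookupD false w (4 * u + t) ≡ lookupD false (symBits σ) t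
      bits' {t} t< = value _ t< (l (refl , s≤s bound ,
        either⇐ (symFrm (lit n) (lit u) (lit (symCode σ)) (lit y)) [] (∈symbols σ)
          (refl , either⇐ (bitFrm (lit n) (lit u) (lit y) σ) [] (digit∈ t<) refl)))
        where
        y : ℕ
        y = eval (literal (lit n) (lit u) (lookupD false (symBits σ) t) t) []

    sym-complete : ∀ {h u σ x} → SymAt w u σ → Acc w (suc h) (symV id u (symCode σ) x)
    sym-complete {h} {u} {σ} {x} s = by-and (sym-and {u} {symCode σ} {x} (s .inside)) (λ e _ → ⊥-elim (has-edges e)) leaves
      where
      digit< : ∀ {t : ℕ} → t ∈ (0 ∷ 1 ∷ 2 ∷ 3 ∷ []) → t < 4
      digit< (here refl) = s≤s z≤n
      digit< (there (here refl)) = s≤s (s≤s z≤n)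
      digit< (there (there (here refl))) = s≤s (s≤s (s≤s z≤n))
      digit< (there (there (there (here refl)))) = ≤-refl
      leaves : ∀ {y} → Graph.Leaf pathGraph n (symV id u (symCode σ) x) y → Lit w y
      leaves {y} (_ , _ , h) with either⇒ symbols (symFrm (lit n) (lit u) (lit (symCode σ)) (lit y)) [] h
      ... | τ , _ , eq , h' with symCode-injective {σ} {τ} eq
      ...   | refl with either⇒ (0 ∷ 1 ∷ 2 ∷ 3 ∷ []) (bitFrm (lit n) (lit u) (lit y) σ) [] h'
      ...     | t , t∈ , e = go (lookupD false (symBits σ) t) (s .digit (digit< t∈)) e
        where
        lt : 4 * u + t < n
        lt = <-≤-trans (+-monoʳ-< (4 * u) (digit< t∈)) (s .inside)
        go : ∀ b → lookupD false w (4 * u + t) ≡ b → y ≡ eval (literal (lit n) (lit u) b t) [] → Lit w y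
        go true  e refl = inj₁ (lt , e)
        go false e refl = inj₂ (4 * u + t , lt , refl , e)

    acc-mono : ∀ {h f} → Acc w h f → Acc w (suc h) f
    acc-mono (by-or ¬a e b acc) = by-or ¬a e b (acc-mono acc)
    acc-mono (by-and a k l)     = by-and a (λ e b → acc-mono (k e b)) l

eqs⇒ : ∀ {r} (es fs : Vec ℕ r) → Holds (eqs (constants es) (constants fs)) [] → es ≡ fs
eqs⇒ []       []         _        = refl
eqs⇒ (e ∷ es) (.e ∷ fs)  (refl , h) = cong (e ∷_) (eqs⇒ es fs h)

eqs-eval : ∀ {r} (es : Vec ℕ r) (fs : Vec (Exp 0) r) → Holds (eqs (constants es) fs) [] → es ≡ evalAll fs []
eqs-eval []       []       _          = refl
eqs-eval (e ∷ es) (f ∷ fs) (refl , h) = cong (e ∷_) (eqs-eval es fs h)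

eqs-refl : ∀ {r} (es : Vec ℕ r) → Holds (eqs (constants es) (constants es)) []
eqs-refl []       = refl
eqs-refl (e ∷ es) = refl , eqs-refl es

record Item : Set where
  constructor item
  field from upto lo hi : ℕ
open Item public

-- Traces recovered from the input word

module _ {w : List Bool} where

  match-row⁺ : ∀ {k} u (v : Vec Bool k) → (∀ y → SymAt w (u + toℕ y) (bitSym (lookup v y))) → Match w u (map bitSym (Vec.toList v))
  match-row⁺ u []      h = tt
  match-row⁺ u (b ∷ v) h = subst (λ i → SymAt w i (bitSym b)) (+-identityʳ u) (h zero) ,
                           match-row⁺ (suc u) v λ y → subst (λ i → SymAt w i (bitSym (lookup v y))) (+-suc u (toℕ y)) (h (suc y))

  match-row⁻ : ∀ {k} u (v : Vec Bool k) → Match w u (map bitSym (Vec.toList v)) → ∀ y → SymAt w (u + toℕ y) (bitSym (lookup v y))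
  match-row⁻ u (b ∷ v) (s , m) zero    = subst (λ i → SymAt w i (bitSym b)) (sym (+-identityʳ u)) s
  match-row⁻ u (b ∷ v) (s , m) (suc y) = subst (λ i → SymAt w i (bitSym (lookup v y))) (sym (+-suc u (toℕ y))) (match-row⁻ (suc u) v m y)

  length-row : ∀ {k} (v : Vec Bool k) → length (map bitSym (Vec.toList v)) ≡ k
  length-row []      = refl
  length-row (b ∷ v) = cong suc (length-row v)

  length-encTrace : ∀ {k len} (π : Trace k len) → length (encTrace π) ≡ len * suc k
  length-encTrace []            = refl
  length-encTrace {k} (r ∷ π) = trans (length-++ (map bitSym (Vec.toList r)))
    (trans (cong₂ _+_ (length-row r) (cong suc (length-encTrace π))) (+-suc k _))

  match-cons⁻ : ∀ {k len} u (r : Vec Bool k) (π : Trace k len) → Match w u (encTrace (r ∷ π)) →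
                Match w u (map bitSym (Vec.toList r)) × SymAt w (u + k) sRow × Match w (suc (u + k)) (encTrace π)
  match-cons⁻ u r π m with Match-++⁻ u (map bitSym (Vec.toList r)) m
  ... | m₁ , m₂ rewrite length-row r = m₁ , m₂

  match-cons⁺ : ∀ {k len} u (r : Vec Bool k) (π : Trace k len) →
                Match w u (map bitSym (Vec.toList r)) → SymAt w (u + k) sRow → Match w (suc (u + k)) (encTrace π) →
                Match w u (encTrace (r ∷ π))
  match-cons⁺ u r π m s m' = Match-++⁺ u (map bitSym (Vec.toList r)) m
    (subst (λ i → Match w (u + i) (sRow ∷ encTrace π)) (sym (length-row r)) (s , m'))

  next-row : ∀ u k x y → suc (u + k) + (x * suc k + y) ≡ u + (suc x * suc k + y)
  next-row u k x y = trans (cong (_+ (x * suc k + y)) (sym (+-suc u k)))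
    (trans (+-assoc u (suc k) (x * suc k + y)) (cong (u +_) (sym (+-assoc (suc k) (x * suc k) y))))

  match-cell : ∀ {k len} u (π : Trace k len) → Match w u (encTrace π) →
               ∀ {x} y → x < len → SymAt w (u + (x * suc k + toℕ y)) (bitSym (val π (suc x) y))
  match-cell u (r ∷ π) m {zero}  y lt = match-row⁻ u r (match-cons⁻ u r π m .proj₁) y
  match-cell {k} u (r ∷ π) m {suc x} y (s≤s lt) =
    subst (λ i → SymAt w i (bitSym (val π (suc x) y))) (next-row u k x (toℕ y))
      (match-cell (suc (u + k)) π (match-cons⁻ u r π m .proj₂ .proj₂) y lt)

  match-rowEnd : ∀ {k len} u (π : Trace k len) → Match w u (encTrace π) → ∀ {x} → x < len → SymAt w (u + (x * suc k + k)) sRow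
  match-rowEnd u (r ∷ π) m {zero}  lt = match-cons⁻ u r π m .proj₂ .proj₁
  match-rowEnd {k} u (r ∷ π) m {suc x} (s≤s lt) =
    subst (λ i → SymAt w i sRow) (next-row u k x k) (match-rowEnd (suc (u + k)) π (match-cons⁻ u r π m .proj₂ .proj₂) lt)

  module _ (k : ℕ) where
    readBit : ℕ → Bool
    readBit u = does (SymAt? w u s1)

    readTrace : ∀ len → ℕ → Trace k len
    readTrace zero      u = []
    readTrace (suc len) u = Vec.tabulate (λ y → readBit (u + toℕ y)) ∷ readTrace len (suc (u + k))

    readBit-correct : ∀ {u} → SymAt w u s0 ⊎ SymAt w u s1 → SymAt w u (bitSym (readBit u))
    readBit-correct {u} c with SymAt? w u s1 | c
    ... | yes s | _      = s
    ... | no ¬s | inj₁ s = s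
    ... | no ¬s | inj₂ s = contradiction s ¬s

    match-readTrace : ∀ len u →
      (∀ {x y} → x < len → y < k → SymAt w (u + (x * suc k + y)) s0 ⊎ SymAt w (u + (x * suc k + y)) s1) →
      (∀ {x} → x < len → SymAt w (u + (x * suc k + k)) sRow) → Match w u (encTrace (readTrace len u))
    match-readTrace zero      u cell end = tt
    match-readTrace (suc len) u cell end = match-cons⁺ u row (readTrace len (suc (u + k)))
      (match-row⁺ u row λ y → subst (λ b → SymAt w (u + toℕ y) (bitSym b)) (sym (Vecₚ.lookup∘tabulate _ y))
        (readBit-correct (cell (s≤s z≤n) (toℕ<n y))))
      (end (s≤s z≤n))
      (match-readTrace len (suc (u + k))
        (λ {x} {y} p q → subst (λ i → SymAt w i s0 ⊎ SymAt w i s1) (sym (next-row u k x y)) (cell (s≤s p) q))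
        (λ {x} p → subst (λ i → SymAt w i sRow) (sym (next-row u k x k)) (end (s≤s p))))
      where
      row : Vec Bool k
      row = Vec.tabulate (λ y → readBit (u + toℕ y))

-- Soundness of the proof system

module Soundness (topE : Exp 1) (w : List Bool) where
  open PathRules topE w
  open PathSemantics w

  -- The formula is supplied even if the interval is empty. In this way an item without positions
  -- certifies syntax.
  Fact : ℕ → ℕ → Item → Set
  Fact k ℓ (item u v i j) = Σ (Fm k) λ f → Match w u (enc f) × v ≡ u + length (enc f) ×
                            (∀ {x} → i ≤ x → x < j → x < ℓ → Val k ℓ f x)

  sequent : ℕ → ℕ → Item → Item → Vec ℕ 15
  sequent k ℓ (item a₁ a₂ a₃ a₄) (item u v i j) = seqV id k ℓ a₁ a₂ a₃ a₄ u v i j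

  rule : ℕ → ℕ → ℕ → Item → Item → (d₁ d₂ d₃ d₄ : ℕ) → Vec ℕ 15
  rule t k ℓ (item a₁ a₂ a₃ a₄) (item u v i j) = ruleV id t k ℓ a₁ a₂ a₃ a₄ u v i j

  Hypothesis : ℕ → ℕ → Item → Set
  Hypothesis k ℓ A = from A ≡ upto A ⊎ Fact k ℓ A

  within⇒ : ∀ {i j i' j' x} → Holds (within (lit i) (lit j) (lit i') (lit j')) [] → i ≤ x → x < j → i' ≤ x × x < j'
  within⇒ (inj₁ (s≤s j≤i)) p q = contradiction (<-≤-trans q j≤i) (≤⇒≯ p)
  within⇒ (inj₂ (s≤s i'≤i , s≤s j≤j')) p q = ≤-trans i'≤i p , <-≤-trans q j≤j'

  after⇒ : ∀ o {k ℓ i i' j'} {V : ℕ → Set} → Holds (unCond o (lit ℓ) (lit i) (lit i') (lit j')) [] → i < ℓ →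
           (∀ {y} → i' ≤ y → y < j' → y < ℓ → V y) → After k ℓ o V i
  after⇒ oX (p , s≤s q , r) i<ℓ h = p , h q r p
  after⇒ oF {i' = i'} (s≤s p , q , r) i<ℓ h = i' , p , r , h ≤-refl q r
  after⇒ oG (s≤s p , s≤s q) i<ℓ h = λ p' q' → h (≤-trans p p') (<-≤-trans q' q) q'
  after⇒ oY {i = suc i} (s≤s p , s≤s q) i<ℓ h = i , refl , h p q (<-trans ≤-refl i<ℓ)
  after⇒ oP {i' = i'} (s≤s p , q) i<ℓ h = i' , p , h ≤-refl q (≤-<-trans p i<ℓ)
  after⇒ oH (s≤s p , q) i<ℓ h = λ p' → h (≤-trans p z≤n) (≤-<-trans p' q) (≤-<-trans p' i<ℓ)

  binary⇒ : ∀ o {k ℓ i j i₁ j₁ i₂ j₂} {f g : Fm k} →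
            Holds (binCond o (lit i) (lit j) (lit i₁) (lit j₁) (lit i₂) (lit j₂)) [] →
            (∀ {x} → i₁ ≤ x → x < j₁ → x < ℓ → Val k ℓ f x) → (∀ {x} → i₂ ≤ x → x < j₂ → x < ℓ → Val k ℓ g x) →
            ∀ {x} → i ≤ x → x < j → x < ℓ → Val k ℓ (bin o f g) x
  binary⇒ oAnd {i = i} {j} {i₁} {j₁} {i₂} {j₂} (c₁ , c₂) h₁ h₂ {x} p q lt
    with within⇒ {i} {j} {i₁} {j₁} c₁ p q | within⇒ {i} {j} {i₂} {j₂} c₂ p q
  ... | p₁ , q₁ | p₂ , q₂ = h₁ p₁ q₁ lt , h₂ p₂ q₂ lt
  binary⇒ oOr {i = i} {j} {i₁} {j₁} {i₂} {j₂} (inj₁ c) h₁ h₂ p q lt with within⇒ {i} {j} {i₁} {j₁} c p q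
  ... | p₁ , q₁ = inj₁ (h₁ p₁ q₁ lt)
  binary⇒ oOr {i = i} {j} {i₁} {j₁} {i₂} {j₂} (inj₂ c) h₁ h₂ p q lt with within⇒ {i} {j} {i₂} {j₂} c p q
  ... | p₂ , q₂ = inj₂ (h₂ p₂ q₂ lt)

  -- The premises of a split each bring a formula of their own; unique readability identifies them.
  same-formula : ∀ {k u v} (f g : Fm k) → Match w u (enc f) → v ≡ u + length (enc f) → Match w u (enc g) → v ≡ u + length (enc g) → f ≡ g
  same-formula {u = u} f g m e m' e' = enc-injective f g
    (Match-unique u (enc f) (enc g) m m' (+-cancelˡ-≡ u _ _ (trans (sym e) e')))

  opaque
    small : ∀ c {_ : True (c ≤? 20)} → c < N n
    small c {p} = ≤-trans (s≤s (toWitness p)) (m≤n+m 21 n)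

    input-small : ∀ {x} → x ≤ n → x < N n
    input-small p = ≤-<-trans p (≤-trans (≤-reflexive (+-comm 1 n)) (+-monoʳ-≤ n (s≤s z≤n)))

    seq-below : ∀ {k ℓ a₁ a₂ a₃ a₄ u v i j} → k < N n → ℓ < N n → a₁ < N n → a₂ < N n → a₃ < N n → a₄ < N n →
                u < N n → v < N n → i < N n → j < N n → AllBelow (N n) (seqV id k ℓ a₁ a₂ a₃ a₄ u v i j)
    seq-below k ℓ a₁ a₂ a₃ a₄ u v i j = small 0 VAll.∷ k VAll.∷ ℓ VAll.∷ a₁ VAll.∷ a₂ VAll.∷ a₃ VAll.∷ a₄ VAll.∷
      u VAll.∷ v VAll.∷ i VAll.∷ j VAll.∷ small 0 VAll.∷ small 0 VAll.∷ small 0 VAll.∷ small 0 VAll.∷ VAll.[]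

    sym-below : ∀ {u σ x} → u < N n → σ < N n → x < N n → AllBelow (N n) (symV id u σ x)
    sym-below u σ x = small 7 VAll.∷ small 0 VAll.∷ small 0 VAll.∷ small 0 VAll.∷ small 0 VAll.∷ small 0 VAll.∷ small 0 VAll.∷
      u VAll.∷ σ VAll.∷ small 0 VAll.∷ small 0 VAll.∷ x VAll.∷ small 0 VAll.∷ small 0 VAll.∷ small 0 VAll.∷ VAll.[]

    cell-below : ∀ {u x y} → u < N n → x < N n → y < N n → AllBelow (N n) (cellV id u x y)
    cell-below u x y = small 8 VAll.∷ small 0 VAll.∷ small 0 VAll.∷ small 0 VAll.∷ small 0 VAll.∷ small 0 VAll.∷ small 0 VAll.∷
      u VAll.∷ small 0 VAll.∷ small 0 VAll.∷ small 0 VAll.∷ x VAll.∷ y VAll.∷ small 0 VAll.∷ small 0 VAll.∷ VAll.[]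

  opaque
    code-small : ∀ σ → symCode σ < N n
    code-small s0     = small 0
    code-small s1     = small 1
    code-small sRow   = small 2
    code-small sMid   = small 3
    code-small sAtom  = small 4
    code-small sNAtom = small 5
    code-small sAnd   = small 6
    code-small sOr    = small 7
    code-small sX     = small 8
    code-small sF     = small 9
    code-small sG     = small 10
    code-small sY     = small 11
    code-small sP     = small 12
    code-small sH     = small 13
    code-small sEnd   = small 14

  child-sym : ∀ {h f u x} σ → And f → Acc w h f → Edge f (symV id u (symCode σ) x) → u < N n → x < N n → SymAt w u σ
  child-sym {u = u} {x} σ a acc e bu bx with and-children a acc e (sym-below bu (code-small σ) bx)
  ... | _ , refl , acc' = sym-sound {u = u} {x} σ acc'

  cell-position : ∀ {k ℓ x y} → x < ℓ → y ≤ k → x * suc k + y < ℓ * suc k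
  cell-position {k} {ℓ} {x} {y} p q = ≤-trans (s≤s (+-monoʳ-≤ (x * suc k) q))
    (≤-trans (≤-reflexive (trans (sym (+-suc (x * suc k) k)) (+-comm (x * suc k) (suc k)))) (*-monoˡ-≤ (suc k) p))

  match-ones⁺ : ∀ m u → (∀ {t} → u ≤ t → t < u + m → SymAt w t s1) → SymAt w (u + m) sEnd → Match w u (replicate m s1 ++ [ sEnd ])
  match-ones⁺ zero    u one last = subst (λ i → SymAt w i sEnd) (+-identityʳ u) last , tt
  match-ones⁺ (suc m) u one last = one ≤-refl (m<m+n u (s≤s z≤n)) ,
    match-ones⁺ m (suc u) (λ {t} p q → one (<⇒≤ p) (subst (t <_) (sym (+-suc u m)) q)) (subst (λ i → SymAt w i sEnd) (+-suc u m) last)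

  length-at : ∀ {k} s (p : Fin k) → length (enc (at s p)) ≡ 2 + toℕ p
  length-at s p = cong suc (trans (length-snoc (replicate (toℕ p) s1) sEnd) (cong suc (length-replicate (toℕ p))))

  code-bit : ∀ s → symCode (bitSym s) ≡ 5 ∸ symCode (atSym s)
  code-bit true  = refl
  code-bit false = refl

  -- In an atom node e₁ is the code of the leading symbol, and 5 ∸ e₁ that of the bit required by the literal.
  atom-sound : ∀ {h k ℓ u v i j} s → 2 + u ≤ v → v < 2 + u + k → ℓ * suc k ≤ n → ℓ < N n → u < N n → v < N n →
               Acc w h (ruleV id 6 k ℓ 0 0 0 0 u v i j (symCode (atSym s)) 0 0 0) → Fact k ℓ (item u v i j)
  atom-sound {h} {k} {ℓ} {u} {v} {i} {j} s 2+u≤v v< fits bℓ bu bv acc =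
    at s p , (head , match-ones⁺ (toℕ p) (suc u) one last) , v≡u+length , holds
    where
    d : ℕ
    d = v ∸ (2 + u)
    v≡ : 2 + u + d ≡ v
    v≡ = m+[n∸m]≡n 2+u≤v
    p<k : d < k
    p<k = +-cancelˡ-< (2 + u) d k (≤-<-trans (≤-reflexive v≡) v<)
    p : Fin k
    p = fromℕ< p<k
    toℕp : toℕ p ≡ d
    toℕp = toℕ-fromℕ< p<k
    v≡u+length : v ≡ u + length (enc (at s p))
    v≡u+length = trans (sym v≡) (trans (cong (2 +_) (cong (u +_) (sym toℕp)))
      (trans (sym (trans (+-suc u (suc (toℕ p))) (cong suc (+-suc u (toℕ p))))) (cong (u +_) (sym (length-at s p)))))
    head : SymAt w u (atSym s)
    head = child-sym (atSym s) atom-and acc (from-atom (inj₁ (eqs-refl (symV id u (symCode (atSym s)) 0)))) bu (small 0)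
    one : ∀ {t} → suc u ≤ t → t < suc u + toℕ p → SymAt w t s1
    one {t} le lt = child-sym s1 atom-and acc (from-atom (inj₂ (inj₁ (le , lt' , eqs-refl (symV id t 1 0))))) (<-trans (<-trans ≤-refl lt') bv) (small 0)
      where
      lt' : suc t < v
      lt' = ≤-trans (s≤s lt) (≤-reflexive (trans (cong (λ q → 2 + (u + q)) toℕp) v≡))
    last : SymAt w (suc u + toℕ p) sEnd
    last = child-sym sEnd atom-and acc (from-atom (inj₂ (inj₂ (inj₁ (v≡' , eqs-refl (symV id (suc u + toℕ p) 14 0)))))) (≤-trans (≤-reflexive v≡') (<⇒≤ bv)) (small 0)
      where
      v≡' : suc (suc u + toℕ p) ≡ v
      v≡' = trans (cong (λ q → 2 + (u + q)) toℕp) v≡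
    holds : ∀ {x} → i ≤ x → x < j → x < ℓ → SymAt w (x * suc k + toℕ p) (bitSym s)
    holds {x} i≤x x<j x<ℓ = subst (λ q → SymAt w (x * suc k + q) (bitSym s)) (sym toℕp)
      (child-sym {x = x} (bitSym s) atom-and acc
        (from-atom (inj₂ (inj₂ (inj₂ (s≤s i≤x , x<j , x<ℓ , refl ,
          (refl , refl , refl , refl , refl , refl , refl , refl , code-bit s , refl , refl , refl , refl , refl , refl , refl))))))
        (input-small (≤-trans (<⇒≤ (cell-position x<ℓ (<⇒≤ p<k))) fits)) (<-trans x<ℓ bℓ))

  -- The edges that leave a sequent, with the guesses read off from the child. Soundness analyses
  -- edges through this view and completeness builds them from it.
  data Step (k ℓ : ℕ) (A C : Item) : Vec ℕ 15 → Set where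
    by-id    : from C < upto C → from A ≡ from C → upto A ≡ upto C →
               Holds (within (lit (lo C)) (lit (hi C)) (lit (lo A)) (lit (hi A))) [] → Step k ℓ A C (trueV id)
    by-cut   : ∀ d₁ d₂ d₃ d₄ → Step k ℓ A C (rule 2 k ℓ A C d₁ d₂ d₃ d₄)
    by-split : lo C < hi C → Step k ℓ A C (rule 3 k ℓ A C 0 0 0 0)
    by-un    : ∀ o i' j' → from C < upto C →
               hi C ≤ lo C ⊎ (hi C ≡ suc (lo C) × Holds (unCond o (lit ℓ) (lit (lo C)) (lit i') (lit j')) []) →
               Step k ℓ A C (rule 4 k ℓ A (item (from C) (upto C) i' j') (symCode (unSym o)) 0 0 0)
    by-bin   : ∀ o i' j' m i'' j'' → from C < upto C →
               Holds (binCond o (lit (lo C)) (lit (hi C)) (lit i') (lit j') (lit i'') (lit j'')) [] →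
               Step k ℓ A C (rule 5 k ℓ A (item (from C) (upto C) i' j') m i'' j'' (symCode (binSym o)))
    by-atom  : ∀ s → 2 + from C ≤ upto C → upto C < 2 + from C + k → ℓ * suc k ≤ n →
               Step k ℓ A C (rule 6 k ℓ (item 0 0 0 0) C (symCode (atSym s)) 0 0 0)

  step-view : ∀ {k ℓ A C g} → EdgeFrom 0 (sequent k ℓ A C) g → Step k ℓ A C g
  step-view {k} {ℓ} {item a₁ a₂ a₃ a₄} {item u v i j} {g@(_ ∷ _ ∷ _ ∷ _ ∷ _ ∷ _ ∷ _ ∷ _ ∷ _ ∷ i' ∷ j' ∷ d₁ ∷ d₂ ∷ d₃ ∷ d₄ ∷ [])}
    (inj₁ (p , q , r , c , eq)) with eqs⇒ g (trueV id) eq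
  ... | refl = by-id p q r c
  step-view {k} {ℓ} {item a₁ a₂ a₃ a₄} {item u v i j} {g@(_ ∷ _ ∷ _ ∷ _ ∷ _ ∷ _ ∷ _ ∷ _ ∷ _ ∷ i' ∷ j' ∷ d₁ ∷ d₂ ∷ d₃ ∷ d₄ ∷ [])}
    (inj₂ (inj₁ eq)) with eqs⇒ g (ruleV id 2 k ℓ a₁ a₂ a₃ a₄ u v i j d₁ d₂ d₃ d₄) eq
  ... | refl = by-cut d₁ d₂ d₃ d₄
  step-view {k} {ℓ} {item a₁ a₂ a₃ a₄} {item u v i j} {g@(_ ∷ _ ∷ _ ∷ _ ∷ _ ∷ _ ∷ _ ∷ _ ∷ _ ∷ i' ∷ j' ∷ d₁ ∷ d₂ ∷ d₃ ∷ d₄ ∷ [])}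
    (inj₂ (inj₂ (inj₁ (p , eq)))) with eqs⇒ g (ruleV id 3 k ℓ a₁ a₂ a₃ a₄ u v i j 0 0 0 0) eq
  ... | refl = by-split p
  step-view {k} {ℓ} {item a₁ a₂ a₃ a₄} {item u v i j} {g@(_ ∷ _ ∷ _ ∷ _ ∷ _ ∷ _ ∷ _ ∷ _ ∷ _ ∷ i' ∷ j' ∷ d₁ ∷ d₂ ∷ d₃ ∷ d₄ ∷ [])}
    (inj₂ (inj₂ (inj₂ (inj₁ (s≤s p , ops , eq))))) with eqs⇒ g (ruleV id 4 k ℓ a₁ a₂ a₃ a₄ u v i' j' d₁ 0 0 0) eq
       | either⇒ uops (λ o → lit d₁ ≐ lit (symCode (unSym o)) ∧ᶜ
           (lit j ≼ lit i ∨ᶜ lit j ≐ lit 1 ⊕ lit i ∧ᶜ unCond o (lit ℓ) (lit i) (lit i') (lit j'))) [] ops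
  ... | refl | o , _ , refl , c = by-un o i' j' p (Sum.map₁ s≤s⁻¹ c)
  step-view {k} {ℓ} {item a₁ a₂ a₃ a₄} {item u v i j} {g@(_ ∷ _ ∷ _ ∷ _ ∷ _ ∷ _ ∷ _ ∷ _ ∷ _ ∷ i' ∷ j' ∷ d₁ ∷ d₂ ∷ d₃ ∷ d₄ ∷ [])}
    (inj₂ (inj₂ (inj₂ (inj₂ (inj₁ (s≤s p , ops , eq)))))) with eqs⇒ g (ruleV id 5 k ℓ a₁ a₂ a₃ a₄ u v i' j' d₁ d₂ d₃ d₄) eq
       | either⇒ bops (λ o → lit d₄ ≐ lit (symCode (binSym o)) ∧ᶜ binCond o (lit i) (lit j) (lit i') (lit j') (lit d₂) (lit d₃)) [] ops
  ... | refl | o , _ , refl , c = by-bin o i' j' d₁ d₂ d₃ p c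
  step-view {k} {ℓ} {item a₁ a₂ a₃ a₄} {item u v i j} {g@(_ ∷ _ ∷ _ ∷ _ ∷ _ ∷ _ ∷ _ ∷ _ ∷ _ ∷ i' ∷ j' ∷ d₁ ∷ d₂ ∷ d₃ ∷ d₄ ∷ [])}
    (inj₂ (inj₂ (inj₂ (inj₂ (inj₂ (σ , s≤s le , lt , s≤s fits , eq)))))) with eqs⇒ g (ruleV id 6 k ℓ 0 0 0 0 u v i j d₁ 0 0 0) eq | σ
  ... | refl | inj₁ refl = by-atom true le lt fits
  ... | refl | inj₂ refl = by-atom false le lt fits

  ItemBelow : Item → Set
  ItemBelow (item u v i j) = u < N n × v < N n × i < N n × j < N n

  sequent-below : ∀ {k ℓ A C} → k < N n → ℓ < N n → ItemBelow A → ItemBelow C → AllBelow (N n) (sequent k ℓ A C)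
  sequent-below bk bℓ (b₁ , b₂ , b₃ , b₄) (bu , bv , bi , bj) = seq-below bk bℓ b₁ b₂ b₃ b₄ bu bv bi bj

  sequent-child : ∀ {h f k ℓ A C} → And f → Acc w h f → Edge f (sequent k ℓ A C) → k < N n → ℓ < N n → ItemBelow A → ItemBelow C →
                  ∃ λ h' → h ≡ suc h' × Acc w h' (sequent k ℓ A C)
  sequent-child a acc e bk bℓ bA bC = and-children a acc e (sequent-below bk bℓ bA bC)

  -- Bounds on all fields are carried along, because a conjunctive node vouches only for children
  -- whose fields are in range.
  sequent-sound : ∀ {h k ℓ A C} → k < N n → ℓ < N n → ItemBelow A → ItemBelow C →
                  Acc w h (sequent k ℓ A C) → Hypothesis k ℓ A → Fact k ℓ C
  step-sound : ∀ {h k ℓ A C g} → k < N n → ℓ < N n → ItemBelow A → ItemBelow C → AllBelow (N n) g →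
               Step k ℓ A C g → Acc w h g → Hypothesis k ℓ A → Fact k ℓ C

  sequent-sound bk bℓ bA bC acc hyp with or-children seq-or acc
  ... | h' , g , refl , e , bg , acc' = step-sound bk bℓ bA bC bg (step-view (edge-from e)) acc' hyp

  -- An absent hypothesis has equal ends, and the side condition `from C < upto C` rules that out.
  step-sound bk bℓ bA bC bg (by-id p refl refl c) acc (inj₁ refl) = contradiction p (n≮n _)
  step-sound {A = item _ _ a₃ a₄} {item _ _ i j} bk bℓ bA bC bg (by-id p refl refl c) acc (inj₂ (f , m , v≡ , hf)) =
    f , m , v≡ , λ p q lt → case within⇒ {i} {j} {a₃} {a₄} c p q of λ (p' , q') → hf p' q' lt
  step-sound {k = k} {ℓ} {A} {C} bk bℓ bA bC
    (_ VAll.∷ _ VAll.∷ _ VAll.∷ _ VAll.∷ _ VAll.∷ _ VAll.∷ _ VAll.∷ _ VAll.∷ _ VAll.∷ _ VAll.∷ _ VAll.∷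
     b₁ VAll.∷ b₂ VAll.∷ b₃ VAll.∷ b₄ VAll.∷ VAll.[]) (by-cut d₁ d₂ d₃ d₄) acc hyp
    with sequent-child {A = A} {item d₁ d₂ d₃ d₄} cut-and acc (from-cut (inj₁ (eqs-refl (sequent k ℓ A (item d₁ d₂ d₃ d₄))))) bk bℓ bA (b₁ , b₂ , b₃ , b₄)
       | sequent-child {A = item d₁ d₂ d₃ d₄} {C} cut-and acc (from-cut (inj₂ (eqs-refl (sequent k ℓ (item d₁ d₂ d₃ d₄) C)))) bk bℓ (b₁ , b₂ , b₃ , b₄) bC
  ... | _ , refl , l | _ , refl , r = sequent-sound bk bℓ (b₁ , b₂ , b₃ , b₄) bC r
        (inj₂ (sequent-sound {C = item d₁ d₂ d₃ d₄} bk bℓ bA (b₁ , b₂ , b₃ , b₄) l hyp))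
  step-sound {k = k} {ℓ} {A} {C@(item u v i j)} bk bℓ bA (bu , bv , bi , bj) bg (by-split i<j) acc hyp =
    -- The premise at `i`, which is there because the interval is nonempty, provides the formula for
    -- all positions.
    glue (at-point i ≤-refl i<j)
    where
    at-point : ∀ x → i ≤ x → x < j → Fact k ℓ (item u v x (suc x))
    at-point x p q with sequent-child {A = A} {item u v x (suc x)} split-and acc
                         (from-split (s≤s p , q , eqs-refl (sequent k ℓ A (item u v x (suc x))))) bk bℓ bA (bu , bv , <-trans q bj , ≤-<-trans q bj)
    ... | _ , refl , c = sequent-sound bk bℓ bA (bu , bv , <-trans q bj , ≤-<-trans q bj) c hyp
    glue : Fact k ℓ (item u v i (suc i)) → Fact k ℓ C
    glue (f , m , v≡ , _) = f , m , v≡ , λ {x} p q lt → case at-point x p q of λ (f' , m' , v≡' , hf') →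
      subst (λ f → Val k ℓ f x) (same-formula f' f m' v≡' m v≡) (hf' ≤-refl ≤-refl lt)
  step-sound {k = k} {ℓ} {A} {item u v i j} bk bℓ bA (bu , bv , bi , bj)
    (_ VAll.∷ _ VAll.∷ _ VAll.∷ _ VAll.∷ _ VAll.∷ _ VAll.∷ _ VAll.∷ _ VAll.∷ _ VAll.∷ bi' VAll.∷ bj' VAll.∷ _)
    (by-un o i' j' u<v c) acc hyp
    with sequent-child {A = A} {item (suc u) v i' j'} un-and acc
           (from-un (inj₁ (eqs-refl (sequent k ℓ A (item (suc u) v i' j'))))) bk bℓ bA (≤-<-trans u<v bv , bv , bi' , bj')
       | child-sym {x = 0} (unSym o) un-and acc (from-un (inj₂ (eqs-refl (symV id u (symCode (unSym o)) 0)))) bu (small 0)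
  ... | _ , refl , s | σ with sequent-sound {C = item (suc u) v i' j'} bk bℓ bA (≤-<-trans u<v bv , bv , bi' , bj') s hyp
  ...   | f , m , v≡ , hf = un o f , (σ , m) , trans v≡ (sym (+-suc u (length (enc f)))) , holds c
    where
    holds : j ≤ i ⊎ (j ≡ suc i × Holds (unCond o (lit ℓ) (lit i) (lit i') (lit j')) []) →
            ∀ {x} → i ≤ x → x < j → x < ℓ → After k ℓ o (Val k ℓ f) x
    holds (inj₁ j≤i) p q lt = contradiction (<-≤-trans q j≤i) (≤⇒≯ p)
    holds (inj₂ (refl , c)) p (s≤s q) lt with ≤-antisym p q
    ... | refl = after⇒ o {k} {i' = i'} {j'} c lt hf
  step-sound {k = k} {ℓ} {A} {item u v i j} bk bℓ bA (bu , bv , bi , bj)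
    (_ VAll.∷ _ VAll.∷ _ VAll.∷ _ VAll.∷ _ VAll.∷ _ VAll.∷ _ VAll.∷ _ VAll.∷ _ VAll.∷ bi' VAll.∷ bj' VAll.∷
     bm VAll.∷ bi'' VAll.∷ bj'' VAll.∷ _) (by-bin o i' j' m i'' j'' u<v c) acc hyp
    with sequent-child {A = A} {item (suc u) m i' j'} bin-and acc
           (from-bin (inj₁ (eqs-refl (sequent k ℓ A (item (suc u) m i' j'))))) bk bℓ bA (≤-<-trans u<v bv , bm , bi' , bj')
       | sequent-child {A = A} {item m v i'' j''} bin-and acc
           (from-bin (inj₂ (inj₁ (eqs-refl (sequent k ℓ A (item m v i'' j'')))))) bk bℓ bA (bm , bv , bi'' , bj'')
       | child-sym {x = 0} (binSym o) bin-and acc (from-bin (inj₂ (inj₂ (eqs-refl (symV id u (symCode (binSym o)) 0))))) bu (small 0)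
  ... | _ , refl , l | _ , refl , r | σ
    with sequent-sound {C = item (suc u) m i' j'} bk bℓ bA (≤-<-trans u<v bv , bm , bi' , bj') l hyp
       | sequent-sound {C = item m v i'' j''} bk bℓ bA (bm , bv , bi'' , bj'') r hyp
  ...   | f , mf , refl , hf | g , mg , v≡ , hg =
    bin o f g , (σ , Match-++⁺ (suc u) (enc f) mf mg) ,
    trans v≡ (trans (cong suc (trans (+-assoc u (length (enc f)) (length (enc g))) (cong (u +_) (sym (length-++ (enc f))))))
      (sym (+-suc u _))) , binary⇒ o {i₁ = i'} {j'} {i''} {j''} {f} {g} c hf hg
  step-sound {C = item u v i j} bk bℓ bA (bu , bv , bi , bj) bg (by-atom s le lt fits) acc hyp =
    atom-sound {i = i} {j} s le lt fits bℓ bu bv acc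

  -- The sum is turned round since `20 + n` computes to twenty successors, which pattern matching
  -- tells apart from the small tags.
  root≡ : root n ≡ Vec.replicate 15 (20 + n)
  root≡ = cong (Vec.replicate 15) (+-comm n 20)

  root-view : ∀ {f g} → EdgeFrom (20 + n) f g →
              ∃ λ k → ∃ λ ℓ → ∃ λ q → g ≡ goalV id k ℓ q × 4 * q ≡ n × 1 ≤ ℓ × suc (ℓ * suc k) ≤ q
  root-view {f} {g@(_ ∷ k ∷ ℓ ∷ _ ∷ _ ∷ _ ∷ _ ∷ q ∷ _ ∷ _ ∷ _ ∷ _ ∷ _ ∷ _ ∷ _ ∷ [])} (e , s≤s p , s≤s p' , eq) =
    k , ℓ , q , eqs⇒ g (goalV id k ℓ q) eq , e , p , p'

  sound : ∀ h → Acc w h (root n) → UTL-PathChecking w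
  sound h acc with or-children root-or (subst (Acc w h) root≡ acc)
  ... | h' , g , refl , e , bg , acc' with root-view {Vec.replicate 15 (20 + n)} (edge-from {20 + n} e)
  sound h acc | h' , g , refl , e , (_ VAll.∷ bk VAll.∷ bℓ VAll.∷ _ VAll.∷ _ VAll.∷ _ VAll.∷ _ VAll.∷ bq VAll.∷ _) , acc'
    | k , ℓ , q , refl , 4q≡n , 1≤ℓ , inside-q = finish ℓ refl 1≤ℓ
    where
    start : ℕ
    start = suc (ℓ * suc k)
    q≤n : q ≤ n
    q≤n = ≤-trans (m≤n*m q 4) (≤-reflexive 4q≡n)
    pos-small : ∀ {x y} → x < ℓ → y ≤ k → x * suc k + y < N n
    pos-small p p' = input-small (<⇒≤ (<-≤-trans (cell-position p p') (≤-trans (n≤1+n _) (≤-trans inside-q q≤n))))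
    cell : ∀ {x y} → x < ℓ → y < k → SymAt w (x * suc k + y) s0 ⊎ SymAt w (x * suc k + y) s1
    cell {x} {y} p p' with and-children goal-and acc' (from-goal (inj₁ (p , p' , refl , eqs-refl (cellV id (x * suc k + y) x y))))
                           (cell-below (pos-small p (<⇒≤ p')) (<-trans p bℓ) (<-trans p' bk))
    ... | _ , refl , c with or-children cell-or c
    ...   | h'' , g , refl , e' , bg , s with edge-from e'
    ...     | inj₁ eq' with eqs⇒ g (symV id (x * suc k + y) 0 0) eq'
    ...       | refl = inj₁ (sym-sound {u = x * suc k + y} {0} s0 s)
    cell {x} {y} p p' | _ , refl , c | h'' , g , refl , e' , bg , s | inj₂ eq' with eqs⇒ g (symV id (x * suc k + y) 1 0) eq'
    ... | refl = inj₂ (sym-sound {u = x * suc k + y} {0} s1 s)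
    rowEnd : ∀ {x} → x < ℓ → SymAt w (x * suc k + k) sRow
    rowEnd {x} p = child-sym {x = x} sRow goal-and acc' (from-goal (inj₂ (inj₁ (p , refl , eqs-refl (symV id (x * suc k + k) 2 x)))))
                     (pos-small p ≤-refl) (<-trans p bℓ)
    mid : SymAt w (ℓ * suc k) sMid
    mid = child-sym {x = 0} sMid goal-and acc' (from-goal (inj₂ (inj₂ (inj₁ (eqs-refl (symV id (ℓ * suc k) 3 0))))))
            (input-small (≤-trans (n≤1+n _) (≤-trans inside-q q≤n))) (small 0)
    fact : Fact k ℓ (item start q 0 1)
    fact with sequent-child {A = item 0 0 0 0} {item start q 0 1} goal-and acc'
                (from-goal (inj₂ (inj₂ (inj₂ (eqs-refl (seqV id k ℓ 0 0 0 0 start q 0 1)))))) bk bℓ zeros ends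
      where
      zeros = small 0 , small 0 , small 0 , small 0
      ends = input-small (≤-trans inside-q q≤n) , bq , small 0 , small 1
    ... | _ , refl , s = sequent-sound {A = item 0 0 0 0} {item start q 0 1} bk bℓ (small 0 , small 0 , small 0 , small 0)
                           (input-small (≤-trans inside-q q≤n) , bq , small 0 , small 1) s (inj₁ refl)
    π : Trace k ℓ
    π = readTrace {w} k ℓ 0
    match-π : Match w 0 (encTrace π)
    match-π = match-readTrace k ℓ 0 cell rowEnd
    finish : ∀ ℓ' → ℓ ≡ ℓ' → 1 ≤ ℓ' → UTL-PathChecking w
    finish (suc m) refl _ with fact
    ... | f , mf , q≡ , hf = k , m , π , toFormula f , encoded , sat⇐ k ℓ π (match-cell 0 π match-π) f (s≤s z≤n) (hf z≤n (s≤s z≤n) (s≤s z≤n))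
      where
      σs : List Sym
      σs = encTrace π ++ sMid ∷ encFormula (toFormula f)
      matched : Match w 0 σs
      matched = Match-++⁺ 0 (encTrace π) match-π (subst (λ p → Match w p (sMid ∷ encFormula (toFormula f))) (sym (length-encTrace {w} π))
        (mid , subst (Match w start) (sym (enc-toFormula f)) mf))
      len : length σs ≡ q
      len = trans (length-++ (encTrace π)) (trans (cong₂ _+_ (length-encTrace {w} π) (cong suc (cong length (enc-toFormula f))))
        (trans (+-suc (ℓ * suc k) (length (enc f))) (sym q≡)))
      encoded : encInstance π (toFormula f) ≡ w
      encoded = match-total w σs matched (trans (cong (4 *_) len) 4q≡n)

-- The rules with their heights

module Rules (topE : Exp 1) (w : List Bool) (k ℓ q : ℕ) (q≤n : q ≤ length w) (ℓk≤n : ℓ * suc k ≤ length w) (k≤n : k ≤ length w) where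
  open PathRules topE w
  open PathSemantics w k ℓ
  open Soundness topE w using (sequent; rule; Step; by-id; by-cut; by-split; by-un; by-bin; by-atom; ItemBelow; sequent-below;
                               small; input-small; sym-below; code-small; length-at; code-bit)

  ℓ≤n : ℓ ≤ n
  ℓ≤n = ≤-trans (m≤m*n ℓ (suc k)) ℓk≤n

  private
    bk : k < N n
    bk = input-small k≤n

    bℓ : ℓ < N n
    bℓ = input-small ℓ≤n

  step-edge : ∀ {A C g} → Step k ℓ A C g → EdgeFrom 0 (sequent k ℓ A C) g
  step-edge (by-id p q r c) = inj₁ (p , q , r , c , eqs-refl (trueV id))
  step-edge {A} {C} (by-cut d₁ d₂ d₃ d₄) = inj₂ (inj₁ (eqs-refl (rule 2 k ℓ A C d₁ d₂ d₃ d₄)))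
  step-edge {A} {C} (by-split p) = inj₂ (inj₂ (inj₁ (p , eqs-refl (rule 3 k ℓ A C 0 0 0 0))))
  step-edge {A} {C@(item u v i j)} (by-un o i' j' p c) = inj₂ (inj₂ (inj₂ (inj₁ (s≤s p ,
    either⇐ (λ o' → lit (symCode (unSym o)) ≐ lit (symCode (unSym o')) ∧ᶜ
      (lit j ≼ lit i ∨ᶜ lit j ≐ lit 1 ⊕ lit i ∧ᶜ unCond o' (lit ℓ) (lit i) (lit i') (lit j'))) [] (∈uops o) (refl , Sum.map₁ s≤s c) ,
    eqs-refl (rule 4 k ℓ A (item u v i' j') (symCode (unSym o)) 0 0 0)))))
    where
    ∈uops : ∀ o → o ∈ uops
    ∈uops oX = here refl
    ∈uops oF = there (here refl)
    ∈uops oG = there (there (here refl))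
    ∈uops oY = there (there (there (here refl)))
    ∈uops oP = there (there (there (there (here refl))))
    ∈uops oH = there (there (there (there (there (here refl)))))
  step-edge {A} {C@(item u v i j)} (by-bin o i' j' m i'' j'' p c) = inj₂ (inj₂ (inj₂ (inj₂ (inj₁ (s≤s p ,
    either⇐ (λ o' → lit (symCode (binSym o)) ≐ lit (symCode (binSym o')) ∧ᶜ
      binCond o' (lit i) (lit j) (lit i') (lit j') (lit i'') (lit j'')) [] (∈bops o) (refl , c) ,
    eqs-refl (rule 5 k ℓ A (item u v i' j') m i'' j'' (symCode (binSym o))))))))
    where
    ∈bops : ∀ o → o ∈ bops
    ∈bops oAnd = here refl
    ∈bops oOr  = there (here refl)
  step-edge {A} {C} (by-atom s p p' p'') = inj₂ (inj₂ (inj₂ (inj₂ (inj₂ (codes s , s≤s p , p' , s≤s p'' ,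
    eqs-refl (rule 6 k ℓ (item 0 0 0 0) C (symCode (atSym s)) 0 0 0))))))
    where
    codes : ∀ s → symCode (atSym s) ≡ 4 ⊎ symCode (atSym s) ≡ 5
    codes true  = inj₁ refl
    codes false = inj₂ refl

  rule-below : ∀ {t A C d₁ d₂ d₃ d₄} → t < N n → ItemBelow A → ItemBelow C → d₁ < N n → d₂ < N n → d₃ < N n → d₄ < N n →
               AllBelow (N n) (rule t k ℓ A C d₁ d₂ d₃ d₄)
  rule-below t (b₁ , b₂ , b₃ , b₄) (bu , bv , bi , bj) d₁ d₂ d₃ d₄ = t VAll.∷ bk VAll.∷ bℓ VAll.∷ b₁ VAll.∷ b₂ VAll.∷ b₃ VAll.∷ b₄ VAll.∷
    bu VAll.∷ bv VAll.∷ bi VAll.∷ bj VAll.∷ d₁ VAll.∷ d₂ VAll.∷ d₃ VAll.∷ d₄ VAll.∷ VAll.[]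

  true-below : AllBelow (N n) (trueV id)
  true-below = small 1 VAll.∷ small 0 VAll.∷ small 0 VAll.∷ small 0 VAll.∷ small 0 VAll.∷ small 0 VAll.∷ small 0 VAll.∷ small 0 VAll.∷
    small 0 VAll.∷ small 0 VAll.∷ small 0 VAll.∷ small 0 VAll.∷ small 0 VAll.∷ small 0 VAll.∷ small 0 VAll.∷ VAll.[]

  -- A rule takes two levels, one for the disjunctive sequent and one for the conjunctive rule node;
  -- hence the summand 2 in the rules below. A literal needs a third level for its symbols.
  D : ℕ → Item → Item → Set
  D h A C = ItemBelow A × ItemBelow C × Acc w h (sequent k ℓ A C)

  D-mono : ∀ {h h' A C} → h ≤ h' → D h A C → D h' A C
  D-mono {h' = zero}   z≤n d = d
  D-mono {h} {suc h'} le (bA , bC , acc) with m≤n⇒m<n∨m≡n le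
  ... | inj₁ (s≤s lt) = case D-mono lt (bA , bC , acc) of λ (_ , _ , acc') → bA , bC , acc-mono acc'
  ... | inj₂ refl     = bA , bC , acc

  Occurs : ℕ → Fm k → Set
  Occurs u f = Match w u (enc f) × u + length (enc f) ≤ q

  claim : ℕ → Fm k → ℕ → ℕ → Item
  claim u f i j = item u (u + length (enc f)) i j

  private
    u<v : ∀ u (f : Fm k) → u < u + length (enc f)
    u<v u f = m<m+n u (enc≥1 f)

    claim-below : ∀ {u f i j} → Occurs u f → i ≤ ℓ → j ≤ ℓ → ItemBelow (claim u f i j)
    claim-below {u} {f} (_ , le) i≤ j≤ = input-small (≤-trans (<⇒≤ (u<v u f)) (≤-trans le q≤n)) , input-small (≤-trans le q≤n) ,
      input-small (≤-trans i≤ ℓ≤n) , input-small (≤-trans j≤ ℓ≤n)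

    by-step : ∀ {h A C g} → Step k ℓ A C g → AllBelow (N n) g → Acc w h g → Acc w (suc h) (sequent k ℓ A C)
    by-step s b acc = or-node seq-or (from-seq (step-edge s)) b acc

    nonzero : ∀ {h f} → Acc w h f → ∃ λ h' → h ≡ suc h'
    nonzero (by-or _ _ _ _) = _ , refl
    nonzero (by-and _ _ _)  = _ , refl

    sym-acc : ∀ {h f u σ x} → Acc w h f → SymAt w u σ → Acc w h (symV id u (symCode σ) x)
    sym-acc {u = u} {σ} {x} acc s with nonzero acc
    ... | _ , refl = sym-complete {u = u} {σ} {x} s

  r-id : ∀ {u f i j i' j'} → Occurs u f → j ≤ i ⊎ (i' ≤ i × j ≤ j') → i ≤ ℓ → j ≤ ℓ → i' ≤ ℓ → j' ≤ ℓ →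
         D 2 (claim u f i' j') (claim u f i j)
  r-id {u} {f} {i} {j} {i'} {j'} oc c i≤ j≤ i'≤ j'≤ =
    claim-below {u} {f} oc i'≤ j'≤ , claim-below {u} {f} oc i≤ j≤ ,
    by-step {A = claim u f i' j'} {claim u f i j} (by-id (u<v u f) refl refl (Sum.map s≤s (λ (p , q) → s≤s p , s≤s q) c)) true-below true-acc

  r-cut : ∀ {h A B C} → D h A B → D h B C → D (2 + h) A C
  r-cut {h} {A} {B@(item d₁ d₂ d₃ d₄)} {C} (bA , bB@(b₁ , b₂ , b₃ , b₄) , l) (_ , bC , r) = bA , bC ,
    by-step {A = A} {C} (by-cut d₁ d₂ d₃ d₄) (rule-below (small 2) bA bC b₁ b₂ b₃ b₄)
      (and-node (λ ()) cut-and λ { {g} (inj₁ eq) _ → subst (Acc w h) (sym (eqs⇒ g (sequent k ℓ A B) eq)) l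
                                 ; {g} (inj₂ eq) _ → subst (Acc w h) (sym (eqs⇒ g (sequent k ℓ B C) eq)) r })

  r-split : ∀ {h A u f i j} → i < j → j ≤ ℓ → Occurs u f → (∀ x → i ≤ x → x < j → D h A (claim u f x (suc x))) → D (2 + h) A (claim u f i j)
  r-split {h} {A} {u} {f} {i} {j} i<j j≤ oc ds = bA , bC ,
    by-step {A = A} {claim u f i j} (by-split i<j) (rule-below (small 3) bA bC (small 0) (small 0) (small 0) (small 0))
      (and-node (λ ()) split-and
        λ { {g@(_ ∷ _ ∷ _ ∷ _ ∷ _ ∷ _ ∷ _ ∷ _ ∷ _ ∷ x ∷ _ ∷ _ ∷ _ ∷ _ ∷ _ ∷ [])} (s≤s p , p' , eq) _ →
            subst (Acc w h) (sym (eqs-eval g (splitChild A x) eq)) (ds x p p' .proj₂ .proj₂) })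
    where
    splitChild : Item → ℕ → Vec (Exp 0) 15
    splitChild (item a₁ a₂ a₃ a₄) x = seqV lit (lit k) (lit ℓ) (lit a₁) (lit a₂) (lit a₃) (lit a₄) (lit u) (lit (u + length (enc f))) (lit x) (lit 1 ⊕ lit x)
    bA : ItemBelow A
    bA = ds i ≤-refl i<j .proj₁
    bC : ItemBelow (claim u f i j)
    bC = claim-below {u} {f} oc (≤-trans (<⇒≤ i<j) j≤) j≤

  r-un : ∀ {h A u o f i j i' j'} → Occurs u (un o f) → i ≤ ℓ → j ≤ ℓ →
         j ≤ i ⊎ (j ≡ suc i × Holds (unCond o (lit ℓ) (lit i) (lit i') (lit j')) []) →
         D h A (claim (suc u) f i' j') → D (2 + h) A (claim u (un o f) i j)
  r-un {h} {A} {u} {o} {f} {i} {j} {i'} {j'} oc i≤ j≤ c (bA , (_ , _ , bi' , bj') , acc) = bA , bC ,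
    by-step {A = A} {claim u (un o f) i j} (by-un o i' j' (u<v u (un o f)) c)
      (rule-below (small 4) bA (bC .proj₁ , bC .proj₂ .proj₁ , bi' , bj') (code-small (unSym o)) (small 0) (small 0) (small 0))
      (and-node (λ ()) un-and
        λ { {g} (inj₁ eq) _ → subst (Acc w h) (sym (trans (eqs-eval g _ eq)
                                 (cong (λ v → sequent k ℓ A (item (suc u) v i' j')) (+-suc u (length (enc f)))))) acc
          ; {g} (inj₂ eq) _ → subst (Acc w h) (sym (eqs⇒ g (symV id u (symCode (unSym o)) 0) eq)) (sym-acc acc (oc .proj₁ .proj₁)) })
    where
    bC : ItemBelow (claim u (un o f) i j)
    bC = claim-below {u} {un o f} oc i≤ j≤

  r-bin : ∀ {h A u o f g i j i' j' i'' j''} → Occurs u (bin o f g) → i ≤ ℓ → j ≤ ℓ →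
          Holds (binCond o (lit i) (lit j) (lit i') (lit j') (lit i'') (lit j'')) [] →
          D h A (claim (suc u) f i' j') → D h A (claim (suc u + length (enc f)) g i'' j'') → D (2 + h) A (claim u (bin o f g) i j)
  r-bin {h} {A} {u} {o} {f} {g} {i} {j} {i'} {j'} {i''} {j''} oc i≤ j≤ c (bA , (_ , bm , bi' , bj') , l) (_ , (_ , _ , bi'' , bj'') , r) =
    bA , bC ,
    by-step {A = A} {claim u (bin o f g) i j} (by-bin o i' j' m i'' j'' (u<v u (bin o f g)) c)
      (rule-below (small 5) bA (bC .proj₁ , bC .proj₂ .proj₁ , bi' , bj') bm bi'' bj'' (code-small (binSym o)))
      (and-node (λ ()) bin-and
        λ { {v} (inj₁ eq) _ → subst (Acc w h) (sym (eqs-eval v _ eq)) l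
          ; {v} (inj₂ (inj₁ eq)) _ → subst (Acc w h) (sym (trans (eqs⇒ v (sequent k ℓ A (item m (u + length (enc (bin o f g))) i'' j'')) eq)
                (cong (λ v → sequent k ℓ A (item m v i'' j'')) end≡))) r
          ; {v} (inj₂ (inj₂ eq)) _ → subst (Acc w h) (sym (eqs⇒ v (symV id u (symCode (binSym o)) 0) eq)) (sym-acc l (oc .proj₁ .proj₁)) })
    where
    m : ℕ
    m = suc u + length (enc f)
    bC : ItemBelow (claim u (bin o f g) i j)
    bC = claim-below {u} {bin o f g} oc i≤ j≤
    end≡ : u + length (enc (bin o f g)) ≡ m + length (enc g)
    end≡ = trans (+-suc u _) (cong suc (trans (cong (u +_) (length-++ (enc f))) (sym (+-assoc u (length (enc f)) (length (enc g))))))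

  match-ones⁻ : ∀ m u → Match w u (replicate m s1 ++ [ sEnd ]) →
                (∀ {t} → u ≤ t → t < u + m → SymAt w t s1) × SymAt w (u + m) sEnd
  match-ones⁻ zero    u (s , _) = (λ {t} p p' → contradiction (<-≤-trans p' (≤-reflexive (+-identityʳ u))) (≤⇒≯ p)) ,
                                  subst (λ i → SymAt w i sEnd) (sym (+-identityʳ u)) s
  match-ones⁻ (suc m) u (s , ms) with match-ones⁻ m (suc u) ms
  ... | one , last = one' , subst (λ i → SymAt w i sEnd) (sym (+-suc u m)) last
    where
    one' : ∀ {t} → u ≤ t → t < u + suc m → SymAt w t s1
    one' {t} p p' with m≤n⇒m<n∨m≡n p
    ... | inj₁ lt   = one lt (subst (t <_) (+-suc u m) p')
    ... | inj₂ refl = s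

  r-at : ∀ {A u s p i j} → ItemBelow A → Occurs u (at s p) → i ≤ ℓ → j ≤ ℓ → (∀ {x} → i ≤ x → x < j → x < ℓ → Val (at s p) x) →
         D 3 A (claim u (at s p) i j)
  r-at {A} {u} {s} {p} {i} {j} bA oc i≤ j≤ hold = bA , bC ,
    by-step {A = A} {claim u (at s p) i j} (by-atom s (≤-trans (m≤m+n (2 + u) (toℕ p)) (≤-reflexive v≡))
        (≤-trans (s≤s (≤-reflexive (sym v≡))) (+-monoʳ-< (2 + u) (toℕ<n p))) ℓk≤n)
      (rule-below (small 6) (small 0 , small 0 , small 0 , small 0) bC (code-small (atSym s)) (small 0) (small 0) (small 0))
      (and-node (λ ()) atom-and λ {g} e _ → edges g e)
    where
    v : ℕ
    v = u + length (enc (at s p))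
    v≡ : 2 + u + toℕ p ≡ v
    v≡ = trans (sym (trans (+-suc u (suc (toℕ p))) (cong suc (+-suc u (toℕ p))))) (cong (u +_) (sym (length-at s p)))
    d≡ : v ∸ (2 + u) ≡ toℕ p
    d≡ = trans (cong (_∸ (2 + u)) (sym v≡)) (m+n∸m≡n (2 + u) (toℕ p))
    bC : ItemBelow (claim u (at s p) i j)
    bC = claim-below {u} {at s p} oc i≤ j≤
    ones = match-ones⁻ (toℕ p) (suc u) (oc .proj₁ .proj₂)
    edges : ∀ g → EdgeFrom 6 (rule 6 k ℓ (item 0 0 0 0) (claim u (at s p) i j) (symCode (atSym s)) 0 0 0) g → Acc w 1 g
    edges g@(_ ∷ _ ∷ _ ∷ _ ∷ _ ∷ _ ∷ _ ∷ t ∷ _ ∷ _ ∷ _ ∷ x ∷ _ ∷ _ ∷ _ ∷ []) (inj₁ eq) =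
      subst (Acc w 1) (sym (eqs⇒ g (symV id u (symCode (atSym s)) 0) eq)) (sym-complete {u = u} {atSym s} {0} (oc .proj₁ .proj₁))
    edges g@(_ ∷ _ ∷ _ ∷ _ ∷ _ ∷ _ ∷ _ ∷ t ∷ _ ∷ _ ∷ _ ∷ x ∷ _ ∷ _ ∷ _ ∷ []) (inj₂ (inj₁ (p₁ , p₂ , eq))) =
      subst (Acc w 1) (sym (eqs⇒ g (symV id t 1 0) eq))
        (sym-complete {u = t} {s1} {0} (ones .proj₁ p₁ (s≤s⁻¹ (≤-trans p₂ (≤-reflexive (sym v≡))))))
    edges g@(_ ∷ _ ∷ _ ∷ _ ∷ _ ∷ _ ∷ _ ∷ t ∷ _ ∷ _ ∷ _ ∷ x ∷ _ ∷ _ ∷ _ ∷ []) (inj₂ (inj₂ (inj₁ (p₁ , eq)))) =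
      subst (Acc w 1) (sym (eqs⇒ g (symV id t 14 0) eq))
        (sym-complete {u = t} {sEnd} {0} (subst (λ i → SymAt w i sEnd) (suc-injective (trans v≡ (sym p₁))) (ones .proj₂)))
    edges g@(_ ∷ _ ∷ _ ∷ _ ∷ _ ∷ _ ∷ _ ∷ t ∷ _ ∷ _ ∷ _ ∷ x ∷ _ ∷ _ ∷ _ ∷ []) (inj₂ (inj₂ (inj₂ (s≤s p₁ , p₂ , p₃ , p₄ , eq)))) =
      subst (Acc w 1) (sym (trans (eqs-eval g (symV lit (lit t) (lit 5 ⊖ lit (symCode (atSym s))) (lit x)) eq) (cong (λ c → symV id t c x) (sym (code-bit s)))))
        (sym-complete {u = t} {bitSym s} {x} (subst (λ i → SymAt w i (bitSym s)) (sym (trans p₄ (cong (x * suc k +_) d≡))) (hold p₁ p₂ p₃)))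

-- Derivations of logarithmic height

data Frame (k : ℕ) : Set where
  unF  : UOp → Frame k
  binL : BOp → Fm k → Frame k
  binR : BOp → Fm k → Frame k

plug : ∀ {k} → Frame k → Fm k → Fm k
plug (unF o)    f = un o f
plug (binL o g) f = bin o f g
plug (binR o g) f = bin o g f

fill : ∀ {k} → List (Frame k) → Fm k → Fm k
fill []       f = f
fill (φ ∷ φs) f = plug φ (fill φs f)

fill-++ : ∀ {k} (φs ψs : List (Frame k)) f → fill (φs ++ ψs) f ≡ fill φs (fill ψs f)
fill-++ []       ψs f = refl
fill-++ (φ ∷ φs) ψs f = cong (plug φ) (fill-++ φs ψs f)

∣_∣ : ∀ {k} → Fm k → ℕ
∣ f ∣ = length (enc f)

-- The offset counts the symbols before the hole and locates it in the word; the weight counts all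
-- symbols around the hole and measures the path.
frameOffset frameWeight : ∀ {k} → Frame k → ℕ
frameOffset (unF o)    = 1
frameOffset (binL o g) = 1
frameOffset (binR o g) = suc ∣ g ∣

frameWeight (unF o)    = 1
frameWeight (binL o g) = suc ∣ g ∣
frameWeight (binR o g) = suc ∣ g ∣

offset weight : ∀ {k} → List (Frame k) → ℕ
offset []       = 0
offset (φ ∷ φs) = frameOffset φ + offset φs

weight []       = 0
weight (φ ∷ φs) = frameWeight φ + weight φs

offset-++ : ∀ {k} (φs ψs : List (Frame k)) → offset (φs ++ ψs) ≡ offset φs + offset ψs
offset-++ []       ψs = refl
offset-++ (φ ∷ φs) ψs = trans (cong (frameOffset φ +_) (offset-++ φs ψs)) (sym (+-assoc (frameOffset φ) (offset φs) (offset ψs)))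

weight-++ : ∀ {k} (φs ψs : List (Frame k)) → weight (φs ++ ψs) ≡ weight φs + weight ψs
weight-++ []       ψs = refl
weight-++ (φ ∷ φs) ψs = trans (cong (frameWeight φ +_) (weight-++ φs ψs)) (sym (+-assoc (frameWeight φ) (weight φs) (weight ψs)))

size-plug : ∀ {k} φ (f : Fm k) → ∣ plug φ f ∣ ≡ frameWeight φ + ∣ f ∣
size-plug (unF o)    f = refl
size-plug (binL o g) f = cong suc (trans (length-++ (enc f)) (+-comm ∣ f ∣ ∣ g ∣))
size-plug (binR o g) f = cong suc (length-++ (enc g))

frameWeight≥1 : ∀ {k} (φ : Frame k) → 1 ≤ frameWeight φ
frameWeight≥1 (unF o)    = ≤-refl
frameWeight≥1 (binL o g) = s≤s z≤n
frameWeight≥1 (binR o g) = s≤s z≤n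

Local : ∀ {k} → Frame k → Set
Local (unF oX)   = ⊤
Local (unF oY)   = ⊤
Local (unF _)    = ⊥
Local (binL _ _) = ⊤
Local (binR _ _) = ⊤

data Threshold : UOp → Set where
  tF : Threshold oF
  tG : Threshold oG
  tP : Threshold oP
  tH : Threshold oH

local? : ∀ {k} (φ : Frame k) → Local φ ⊎ ∃ λ o → φ ≡ unF o × Threshold o
local? (unF oX)   = inj₁ tt
local? (unF oY)   = inj₁ tt
local? (unF oF)   = inj₂ (oF , refl , tF)
local? (unF oG)   = inj₂ (oG , refl , tG)
local? (unF oP)   = inj₂ (oP , refl , tP)
local? (unF oH)   = inj₂ (oH , refl , tH)
local? (binL _ _) = inj₁ tt
local? (binR _ _) = inj₁ tt

-- Below the lowest of the operators `F`, `G`, `P`, `H` truth passes upwards from position to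
-- position; at that operator an interval can take over.
lowest : ∀ {k} (φs : List (Frame k)) →
         All Local φs ⊎ ∃ λ o → ∃₂ λ αs βs → φs ≡ αs ++ unF o ∷ βs × Threshold o × All Local βs
lowest []       = inj₁ []
lowest (φ ∷ φs) with lowest φs
... | inj₂ (o , αs , βs , refl , t , ls) = inj₂ (o , φ ∷ αs , βs , refl , t , ls)
... | inj₁ ls with local? φ
...   | inj₁ l = inj₁ (l ∷ ls)
...   | inj₂ (o , refl , t) = inj₂ (o , [] , φs , refl , t , ls)

-- The separating frame is the one at which the weight summed from the top reaches `m`, or else the
-- last one. It belongs to neither half and may itself be heavy.
split-path : ∀ {k} (φs : List (Frame k)) {m m'} → 0 < m → 0 < m' → weight φs < m + m' →
             φs ≡ [] ⊎ ∃₂ λ αs φ → ∃ λ βs → φs ≡ αs ++ φ ∷ βs × weight αs < m × weight βs < m'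
split-path []       p p' lt = inj₁ refl
split-path (φ ∷ φs) {m} {m'} p p' lt with frameWeight φ <? m
... | no ge = inj₂ ([] , φ , φs , refl , p , +-cancelˡ-< m _ _ (≤-<-trans (+-monoˡ-≤ (weight φs) (≮⇒≥ ge)) lt))
... | yes lt' with split-path φs {m ∸ frameWeight φ} {m'} (m<n⇒0<n∸m lt') p'
                     (+-cancelˡ-< (frameWeight φ) _ _ (<-≤-trans lt (≤-reflexive (trans (cong (_+ m') (sym (m+[n∸m]≡n (<⇒≤ lt'))))
                       (+-assoc (frameWeight φ) (m ∸ frameWeight φ) m')))))
...   | inj₁ refl = inj₂ ([] , φ , [] , refl , p , p')
...   | inj₂ (αs , ψ , βs , refl , q , q') = inj₂ (φ ∷ αs , ψ , βs , refl ,
          <-≤-trans (+-monoʳ-< (frameWeight φ) q) (≤-reflexive (m+[n∸m]≡n (<⇒≤ lt'))) , q')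

SmallChildren : ∀ {k} → ℕ → Fm k → Set
SmallChildren m (at s p)    = ⊤
SmallChildren m (un o f)    = ∣ f ∣ < m
SmallChildren m (bin o f g) = ∣ f ∣ < m × ∣ g ∣ < m

-- Descend into a child of size at least `m'` as long as there is one. Such a child keeps at least
-- `m'` of fewer than `m + m'` symbols, so fewer than `m` are left on the path.
heavy-path : ∀ {k} (f : Fm k) {m m'} → 0 < m → ∣ f ∣ < m + m' →
             ∃₂ λ φs θ → f ≡ fill φs θ × weight φs < m × SmallChildren m' θ
heavy-path {k} f {m} {m'} 0<m lt = go f 0<m lt
  where
  descend : ∀ φ (g : Fm k) {m} → ∣ plug φ g ∣ < m + m' → m' ≤ ∣ g ∣ →
           (∀ {m₁} → 0 < m₁ → ∣ g ∣ < m₁ + m' → ∃₂ λ φs θ → g ≡ fill φs θ × weight φs < m₁ × SmallChildren m' θ) →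
           ∃₂ λ φs θ → plug φ g ≡ fill φs θ × weight φs < m × SmallChildren m' θ
  descend φ g {m} lt ge rec with rec {m ∸ frameWeight φ} (m<n⇒0<n∸m φ<m)
    (+-cancelˡ-< (frameWeight φ) _ _ (<-≤-trans (≤-<-trans (≤-reflexive (sym (size-plug φ g))) lt)
      (≤-reflexive (trans (cong (_+ m') (sym (m+[n∸m]≡n (<⇒≤ φ<m)))) (+-assoc (frameWeight φ) (m ∸ frameWeight φ) m')))))
    where
    φ<m : frameWeight φ < m
    φ<m = +-cancelʳ-< m' _ _ (≤-<-trans (≤-trans (+-monoʳ-≤ (frameWeight φ) ge) (≤-reflexive (sym (size-plug φ g)))) lt)
  ... | φs , θ , refl , q , sc = φ ∷ φs , θ , refl ,
        <-≤-trans (+-monoʳ-< (frameWeight φ) q) (≤-reflexive (m+[n∸m]≡n (<⇒≤ φ<m'))) , sc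
    where
    φ<m' : frameWeight φ < m
    φ<m' = +-cancelʳ-< m' _ _ (≤-<-trans (≤-trans (+-monoʳ-≤ (frameWeight φ) ge) (≤-reflexive (sym (size-plug φ (fill φs θ))))) lt)
  go : ∀ f {m} → 0 < m → ∣ f ∣ < m + m' → ∃₂ λ φs θ → f ≡ fill φs θ × weight φs < m × SmallChildren m' θ
  go (at s p) 0<m lt = [] , at s p , refl , 0<m , tt
  go (un o f) 0<m lt with ∣ f ∣ <? m'
  ... | yes s = [] , un o f , refl , 0<m , s
  ... | no ge = descend (unF o) f lt (≮⇒≥ ge) (go f)
  go (bin o f g) 0<m lt with ∣ f ∣ <? m' | ∣ g ∣ <? m'
  ... | yes s | yes s' = [] , bin o f g , refl , 0<m , s , s'
  ... | no ge | _      = descend (binL o g) f lt (≮⇒≥ ge) (go f)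
  ... | yes _ | no ge  = descend (binR o f) g lt (≮⇒≥ ge) (go g)


module _ {V : ℕ → Set} (V? : ∀ x → Dec (V x)) where

  down-extent : ∀ m → (∀ {x y} → x ≤ y → y < m → V y → V x) → ∃ λ e → e ≤ m × (∀ {x} → x < e → V x) × (∀ {x} → x < m → V x → x < e)
  down-extent zero    closed = 0 , z≤n , (λ ()) , λ ()
  down-extent (suc m) closed with V? m
  ... | yes v = suc m , ≤-refl , (λ { (s≤s p) → closed p ≤-refl v }) , λ p _ → p
  ... | no ¬v with down-extent m (λ p q → closed p (m≤n⇒m≤1+n q))
  ...   | e , e≤ , inside , outside = e , m≤n⇒m≤1+n e≤ , inside , outside'
    where
    outside' : ∀ {x} → x < suc m → V x → x < e
    outside' p v with m≤n⇒m<n∨m≡n p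
    ... | inj₁ (s≤s p') = outside p' v
    ... | inj₂ refl     = contradiction v ¬v

  up-extent : ∀ m → (∀ {x y} → x ≤ y → y < m → V x → V y) → ∃ λ a → a ≤ m × (∀ {x} → a ≤ x → x < m → V x) × (∀ {x} → x < m → V x → a ≤ x)
  up-extent zero    closed = 0 , z≤n , (λ _ ()) , λ _ _ → z≤n
  up-extent (suc m) closed with up-extent m (λ p q → closed p (m≤n⇒m≤1+n q))
  ... | a , a≤ , inside , outside with V? m
  ...   | yes v = a , m≤n⇒m≤1+n a≤ , inside' , outside'
    where
    inside' : ∀ {x} → a ≤ x → x < suc m → V x
    inside' p q with m≤n⇒m<n∨m≡n q
    ... | inj₁ (s≤s q') = inside p q'
    ... | inj₂ refl     = v
    outside' : ∀ {x} → x < suc m → V x → a ≤ x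
    outside' p v' with m≤n⇒m<n∨m≡n p
    ... | inj₁ (s≤s p') = outside p' v'
    ... | inj₂ refl     = a≤
  ...   | no ¬v = suc m , ≤-refl , (λ p q → contradiction (≤-trans q p) (n≮n _)) ,
                  λ p v → contradiction (closed (s≤s⁻¹ p) ≤-refl v) ¬v

-- Completeness for claims about at most one position

module Completeness (topE : Exp 1) (w : List Bool) (k ℓ q : ℕ) (q≤n : q ≤ length w) (ℓk≤n : ℓ * suc k ≤ length w) (k≤n : k ≤ length w)
                    (0<ℓ : 0 < ℓ) where
  open Rules topE w k ℓ q q≤n ℓk≤n k≤n
  open PathSemantics w k ℓ
  open Soundness topE w using (ItemBelow)

  data Spot : Set where
    none : Spot
    spot : ℕ → Spot

  low high : Spot → ℕ
  low none      = 0
  low (spot x)  = x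
  high none     = 0
  high (spot x) = suc x

  ValAt : Fm k → Spot → Set
  ValAt f none     = ⊤
  ValAt f (spot x) = x < ℓ × Val f x

  claimAt : ℕ → Fm k → Spot → Item
  claimAt u f p = claim u f (low p) (high p)

  low≤ : ∀ f p → ValAt f p → low p ≤ ℓ
  low≤ f none     _        = z≤n
  low≤ f (spot x) (lt , _) = <⇒≤ lt

  high≤ : ∀ f p → ValAt f p → high p ≤ ℓ
  high≤ f none     _        = z≤n
  high≤ f (spot x) (lt , _) = lt

  -- Completeness for one occurrence, relative to the hypothesis `A`. Claims about at most one
  -- position suffice, as one split reaches a nonempty interval.
  Knows : ℕ → Item → ℕ → Fm k → Set
  Knows h A u f = ∀ p → ValAt f p → D h A (claimAt u f p)

  knows-mono : ∀ {h h' A u f} → h ≤ h' → Knows h A u f → Knows h' A u f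
  knows-mono le kn p v = D-mono le (kn p v)

  occurs-un : ∀ {u o f} → Occurs u (un o f) → Occurs (suc u) f
  occurs-un {u} {o} {f} ((_ , m) , le) = m , ≤-trans (≤-reflexive (sym (+-suc u ∣ f ∣))) le

  end-bin : ∀ u o (f g : Fm k) → suc u + ∣ f ∣ + ∣ g ∣ ≡ u + ∣ bin o f g ∣
  end-bin u o f g = trans (cong suc (trans (+-assoc u ∣ f ∣ ∣ g ∣) (cong (u +_) (sym (length-++ (enc f)))))) (sym (+-suc u _))

  occurs-left : ∀ {u o f g} → Occurs u (bin o f g) → Occurs (suc u) f
  occurs-left {u} {o} {f} {g} ((_ , m) , le) = Match-++⁻ (suc u) (enc f) m .proj₁ ,
    ≤-trans (m≤m+n (suc u + ∣ f ∣) ∣ g ∣) (≤-trans (≤-reflexive (end-bin u o f g)) le)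

  occurs-right : ∀ {u o f g} → Occurs u (bin o f g) → Occurs (suc u + ∣ f ∣) g
  occurs-right {u} {o} {f} {g} ((_ , m) , le) = Match-++⁻ (suc u) (enc f) m .proj₂ , ≤-trans (≤-reflexive (end-bin u o f g)) le

  knows-interval : ∀ {h A u f i j} → Occurs u f → i < j → j ≤ ℓ → (∀ {x} → i ≤ x → x < j → Val f x) → Knows h A u f → D (2 + h) A (claim u f i j)
  knows-interval {u = u} {f} oc i<j j≤ v kn = r-split {u = u} {f} i<j j≤ oc λ x p p' → kn (spot x) (<-≤-trans p' j≤ , v p p')

  knows-at : ∀ {A u s p} → ItemBelow A → Occurs u (at s p) → Knows 3 A u (at s p)
  knows-at bA oc none     _        = r-at bA oc z≤n z≤n λ _ ()
  knows-at {s = s} {p} bA oc (spot x) (lt , v) = r-at {s = s} {p} bA oc (<⇒≤ lt) lt λ {y} p' q' _ → subst (λ z → Val (at s p) z) (≤-antisym p' (s≤s⁻¹ q')) v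

  -- Two levels are for the rule. Two more are for `G` and `H`, whose premise concerns an interval
  -- and is obtained by a split.
  knows-un : ∀ {h A u o f} → Occurs u (un o f) → Knows h A (suc u) f → Knows (4 + h) A u (un o f)
  knows-un {h} {u = u} {o} {f} oc kn none _ = r-un {u = u} {o} {f} oc z≤n z≤n (inj₁ z≤n) (D-mono (m≤n+m h 2) (kn none tt))
  knows-un {h} {A} {u} {o} {f} oc kn (spot x) (lt , v) = go o v oc
    where
    oc' : Occurs (suc u) f
    oc' = occurs-un {u} {o} oc
    exact : ∀ {o} y → y < ℓ → Val f y → Occurs u (un o f) → Holds (unCond o (lit ℓ) (lit x) (lit y) (lit (suc y))) [] →
            D (4 + h) A (claim u (un o f) x (suc x))
    exact {o} y lt' vy oc c = r-un {u = u} {o} {f} {i' = y} {suc y} oc (<⇒≤ lt) lt (inj₂ (refl , c)) (D-mono (m≤n+m h 2) (kn (spot y) (lt' , vy)))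
    go : ∀ o → After o (Val f) x → Occurs u (un o f) → D (4 + h) A (claim u (un o f) x (suc x))
    go oX (p , vy) oc = exact (suc x) p vy oc (p , s≤s ≤-refl , ≤-refl)
    go oY (y , refl , vy) oc = exact y (<-trans ≤-refl lt) vy oc (≤-refl , s≤s ≤-refl)
    go oF (y , p , p' , vy) oc = exact y p' vy oc (s≤s p , ≤-refl , p')
    go oP (y , p , vy) oc = exact y (≤-<-trans p lt) vy oc (s≤s p , ≤-refl)
    go oG vs oc = r-un {u = u} {oG} {f} {i' = x} {ℓ} oc (<⇒≤ lt) lt (inj₂ (refl , s≤s ≤-refl , s≤s ≤-refl))
                    (knows-interval {u = suc u} {f} oc' lt ≤-refl (λ p p' → vs p p') kn)
    go oH vs oc = r-un {u = u} {oH} {f} {i' = 0} {suc x} oc (<⇒≤ lt) lt (inj₂ (refl , s≤s z≤n , ≤-refl))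
                    (knows-interval {u = suc u} {f} oc' (s≤s z≤n) lt (λ _ p → vs (s≤s⁻¹ p)) kn)

  private
    inside-same : ∀ x → Holds (within (lit x) (lit (suc x)) (lit x) (lit (suc x))) []
    inside-same x = inj₂ (s≤s ≤-refl , s≤s ≤-refl)

  -- One spot in each argument suffices; an argument that does not matter is asserted nowhere, which still
  -- certifies that it is a formula.
  bin-spots : ∀ {u} o {f g} → Occurs u (bin o f g) → ∀ p → ValAt (bin o f g) p →
              ∃₂ λ p₁ p₂ → ValAt f p₁ × ValAt g p₂ ×
              (∀ {h A} → D h A (claimAt (suc u) f p₁) → D h A (claimAt (suc u + ∣ f ∣) g p₂) → D (2 + h) A (claimAt u (bin o f g) p))
  bin-spots {u} oAnd {f} {g} oc none _ = none , none , tt , tt , r-bin {u = u} {oAnd} {f} {g} oc z≤n z≤n (inj₁ (s≤s z≤n) , inj₁ (s≤s z≤n))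
  bin-spots {u} oOr {f} {g} oc none _ = none , none , tt , tt , r-bin {u = u} {oOr} {f} {g} oc z≤n z≤n (inj₁ (inj₁ (s≤s z≤n)))
  bin-spots {u} oAnd {f} {g} oc (spot x) (lt , v , v') = spot x , spot x , (lt , v) , (lt , v') ,
    r-bin {u = u} {oAnd} {f} {g} oc (<⇒≤ lt) lt (inside-same x , inside-same x)
  bin-spots {u} oOr {f} {g} oc (spot x) (lt , inj₁ v) = spot x , none , (lt , v) , tt ,
    r-bin {u = u} {oOr} {f} {g} oc (<⇒≤ lt) lt (inj₁ (inside-same x))
  bin-spots {u} oOr {f} {g} oc (spot x) (lt , inj₂ v) = none , spot x , tt , (lt , v) ,
    r-bin {u = u} {oOr} {f} {g} oc (<⇒≤ lt) lt (inj₂ (inside-same x))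

  knows-bin : ∀ {h A u o f g} → Occurs u (bin o f g) → Knows h A (suc u) f → Knows h A (suc u + ∣ f ∣) g → Knows (2 + h) A u (bin o f g)
  knows-bin {o = o} {f} {g} oc l r p v with bin-spots o {f} {g} oc p v
  ... | p₁ , p₂ , v₁ , v₂ , d = d (l p₁ v₁) (r p₂ v₂)

  Sibling : (ℕ → Fm k → Set) → ℕ → Frame k → Fm k → Set
  Sibling R u (unF o)    f = ⊤
  Sibling R u (binL o g) f = R (suc u + ∣ f ∣) g
  Sibling R u (binR o g) f = R (suc u) g

  occurs-plug : ∀ {u} φ {f} → Occurs u (plug φ f) → Occurs (u + frameOffset φ) f
  occurs-plug {u} (unF o)    {f} oc = subst (λ i → Occurs i f) (+-comm 1 u) (occurs-un {u} {o} oc)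
  occurs-plug {u} (binL o g) {f} oc = subst (λ i → Occurs i f) (+-comm 1 u) (occurs-left {u} {o} {f} {g} oc)
  occurs-plug {u} (binR o g) {f} oc = subst (λ i → Occurs i f) (sym (+-suc u ∣ g ∣)) (occurs-right {u} {o} {g} {f} oc)

  occurs-fill : ∀ {u} φs {f} → Occurs u (fill φs f) → Occurs (u + offset φs) f
  occurs-fill {u} []       {f} oc = subst (λ i → Occurs i f) (sym (+-identityʳ u)) oc
  occurs-fill {u} (φ ∷ φs) {f} oc = subst (λ i → Occurs i f) (+-assoc u (frameOffset φ) (offset φs)) (occurs-fill φs (occurs-plug φ oc))

  knows-plug : ∀ {h A u} φ {f} → Occurs u (plug φ f) → Knows h A (u + frameOffset φ) f → Sibling (Knows h A) u φ f → Knows (4 + h) A u (plug φ f)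
  knows-plug {h} {A} {u} (unF o)    {f} oc kn _ = knows-un {u = u} {o} {f} oc (subst (λ i → Knows h A i f) (+-comm u 1) kn)
  knows-plug {h} {A} {u} (binL o g) {f} oc kn s = knows-mono (m≤n+m (2 + h) 2)
    (knows-bin {u = u} {o} {f} {g} oc (subst (λ i → Knows h A i f) (+-comm u 1) kn) s)
  knows-plug {h} {A} {u} (binR o g) {f} oc kn s = knows-mono (m≤n+m (2 + h) 2)
    (knows-bin {u = u} {o} {g} {f} oc s (subst (λ i → Knows h A i f) (+-suc u ∣ g ∣) kn))

  knows-self : ∀ {u f} → Occurs u f → ∀ p → ValAt f p → D 2 (claimAt u f p) (claimAt u f p)
  knows-self {u} {f} oc p v = r-id {u} {f} oc (inj₂ (≤-refl , ≤-refl)) (low≤ f p v) (high≤ f p v) (low≤ f p v) (high≤ f p v)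

  -- Below local operators the truth of a formula at one position rests on at most one position of the hole.
  Transfer : ℕ → ℕ → List (Frame k) → Fm k → Set
  Transfer h u φs f = ∀ p → ValAt (fill φs f) p → ∃ λ p' → ValAt f p' × D h (claimAt (u + offset φs) f p') (claimAt u (fill φs f) p)

  -- The hypothesis is arbitrary because the siblings of a path are derived under whatever is
  -- assumed about its hole.
  Closed : ℕ → ℕ → Set
  Closed b m = ∀ A u f → ItemBelow A → ∣ f ∣ < m → Occurs u f → Knows b A u f

  -- The hypothesis is the claim about the hole itself. The hole then follows by identity, and a
  -- sibling has to be derived under this claim, whatever it is; hence `sib` for every `A`.
  transfer-plug : ∀ {b u} φ {f} → Local φ → 2 ≤ b → Occurs u (plug φ f) → (∀ A → ItemBelow A → Sibling (Knows b A) u φ f) →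
                  ∀ p → ValAt (plug φ f) p → ∃ λ p' → ValAt f p' × D (4 + b) (claimAt (u + frameOffset φ) f p') (claimAt u (plug φ f) p)
  transfer-plug {b} {u} φ {f} l 2≤b oc sib p v = go φ l oc sib p v
    where
    from-hole : ∀ {h} (φ : Frame k) {i p p'} → u + frameOffset φ ≡ i → D h (claimAt i f p') (claimAt u (plug φ f) p) →
                D h (claimAt (u + frameOffset φ) f p') (claimAt u (plug φ f) p)
    from-hole φ refl d = d
    self : ∀ {i} → Occurs i f → ∀ p → ValAt f p → D b (claimAt i f p) (claimAt i f p)
    self oc p v = D-mono 2≤b (knows-self oc p v)
    below : ∀ {i} → Occurs i f → ∀ p → ValAt f p → ItemBelow (claimAt i f p)
    below oc p v = knows-self oc p v .proj₁
    go : ∀ φ → Local φ → Occurs u (plug φ f) → (∀ A → ItemBelow A → Sibling (Knows b A) u φ f) → ∀ p → ValAt (plug φ f) p →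
         ∃ λ p' → ValAt f p' × D (4 + b) (claimAt (u + frameOffset φ) f p') (claimAt u (plug φ f) p)
    go (unF o) l oc sib none _ = none , tt , from-hole (unF o) {p = none} {none} (+-comm u 1)
      (r-un {u = u} {o} {f} oc z≤n z≤n (inj₁ z≤n) (D-mono (m≤n+m b 2) (self (occurs-un {u} {o} oc) none tt)))
    go (unF oX) l oc sib (spot x) (lt , p , v) = spot (suc x) , (p , v) , from-hole (unF oX) {p = spot x} {spot (suc x)} (+-comm u 1)
      (r-un {u = u} {oX} {f} {i' = suc x} {2 + x} oc (<⇒≤ lt) lt (inj₂ (refl , p , s≤s ≤-refl , ≤-refl))
        (D-mono (m≤n+m b 2) (self (occurs-un {u} {oX} oc) (spot (suc x)) (p , v))))
    go (unF oY) l oc sib (spot x) (lt , y , refl , v) = spot y , (<-trans ≤-refl lt , v) , from-hole (unF oY) {p = spot x} {spot y} (+-comm u 1)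
      (r-un {u = u} {oY} {f} {i' = y} {suc y} oc (<⇒≤ lt) lt (inj₂ (refl , ≤-refl , s≤s ≤-refl))
        (D-mono (m≤n+m b 2) (self (occurs-un {u} {oY} oc) (spot y) (<-trans ≤-refl lt , v))))
    go (binL o g) l oc sib p v with bin-spots o {f} {g} oc p v
    ... | p₁ , p₂ , v₁ , v₂ , d = p₁ , v₁ , from-hole (binL o g) {p = p} {p₁} (+-comm u 1)
          (D-mono (m≤n+m (2 + b) 2) (d (self oc₁ p₁ v₁) (sib (claimAt (suc u) f p₁) (below oc₁ p₁ v₁) p₂ v₂)))
      where
      oc₁ : Occurs (suc u) f
      oc₁ = occurs-left {u} {o} {f} {g} oc
    go (binR o g) l oc sib p v with bin-spots o {g} {f} oc p v
    ... | p₁ , p₂ , v₁ , v₂ , d = p₂ , v₂ , from-hole (binR o g) {p = p} {p₂} (+-suc u ∣ g ∣)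
          (D-mono (m≤n+m (2 + b) 2) (d (sib (claimAt (suc u + ∣ g ∣) f p₂) (below oc₁ p₂ v₂) p₁ v₁) (self oc₁ p₂ v₂)))
      where
      oc₁ : Occurs (suc u + ∣ g ∣) f
      oc₁ = occurs-right {u} {o} {g} {f} oc

-- Balancing derivations by cuts

module Balanced (topE : Exp 1) (w : List Bool) (k ℓ q : ℕ) (q≤n : q ≤ length w) (ℓk≤n : ℓ * suc k ≤ length w) (k≤n : k ≤ length w)
                (0<ℓ : 0 < ℓ) where
  open Rules topE w k ℓ q q≤n ℓk≤n k≤n
  open Completeness topE w k ℓ q q≤n ℓk≤n k≤n 0<ℓ
  open PathSemantics w k ℓ
  open Soundness topE w using (ItemBelow)

  -- The exact extent of a formula that holds precisely on an interval serves as an interpolant.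
  Interpolant : ℕ → Item → ℕ → Fm k → Set
  Interpolant t A u f = ∃ λ B → D (2 + t) A B × Knows 2 B u f

  interpolate-none : ∀ {t A u f} → Occurs u f → (∀ {x} → x < ℓ → ¬ Val f x) → Knows t A u f → Interpolant t A u f
  interpolate-none {t} {A} {u} {f} oc empty kn = claimAt u f none , D-mono (m≤n+m t 2) (kn none tt) , λ
    { none _ → knows-self oc none tt
    ; (spot x) (lt , v) → contradiction v (empty lt) }

  interpolate-interval : ∀ {t A u f a e} → Occurs u f → a < e → e ≤ ℓ → (∀ {x} → a ≤ x → x < e → Val f x) →
                         (∀ {x} → x < ℓ → Val f x → a ≤ x × x < e) → Knows t A u f → Interpolant t A u f
  interpolate-interval {t} {A} {u} {f} {a} {e} oc a<e e≤ inside outside kn =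
    claim u f a e , knows-interval {u = u} {f} oc a<e e≤ inside kn , λ
    { none _ → r-id {u} {f} oc (inj₁ z≤n) z≤n z≤n a≤ e≤
    ; (spot x) (lt , v) → r-id {u} {f} oc (inj₂ (outside lt v)) (<⇒≤ lt) lt a≤ e≤ }
    where
    a≤ : a ≤ ℓ
    a≤ = ≤-trans (<⇒≤ a<e) e≤

  interpolate-down : ∀ {t A u f} → Occurs u f → (∀ {x y} → x ≤ y → y < ℓ → Val f y → Val f x) → Knows t A u f → Interpolant t A u f
  interpolate-down {f = f} oc closed kn with down-extent (Val? f) ℓ closed
  ... | zero  , _  , _      , outside = interpolate-none oc (λ lt v → contradiction (outside lt v) n≮0) kn
  ... | suc e , e≤ , inside , outside = interpolate-interval {a = 0} {suc e} oc (s≤s z≤n) e≤ (λ _ → inside) (λ lt v → z≤n , outside lt v) kn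

  interpolate-up : ∀ {t A u f} → Occurs u f → (∀ {x y} → x ≤ y → y < ℓ → Val f x → Val f y) → Knows t A u f → Interpolant t A u f
  interpolate-up {f = f} oc closed kn with up-extent (Val? f) ℓ closed
  ... | a , a≤ , inside , outside with a <? ℓ
  ...   | yes a<ℓ = interpolate-interval {a = a} {ℓ} oc a<ℓ ≤-refl inside (λ lt v → outside lt v , lt) kn
  ...   | no ge   = interpolate-none oc (λ lt v → contradiction (<-≤-trans lt (≮⇒≥ ge)) (≤⇒≯ (outside lt v))) kn

  -- Truth of `F` and `H` is inherited by earlier positions and truth of `G` and `P` by later ones.
  -- From the resulting interval every true claim about the formula is an instance of `r-id`, whence
  -- the height 2 in `Interpolant`.
  interpolate : ∀ {t A u o f} → Threshold o → Occurs u (un o f) → Knows t A u (un o f) → Interpolant t A u (un o f)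
  interpolate tF oc = interpolate-down oc λ { p _ (y , p' , p'' , v) → y , ≤-trans p p' , p'' , v }
  interpolate tG oc = interpolate-up oc λ p _ vs p' p'' → vs (≤-trans p p') p''
  interpolate tP oc = interpolate-up oc λ { p _ (y , p' , v) → y , ≤-trans p' p , v }
  interpolate tH oc = interpolate-down oc λ p _ vs p' → vs (≤-trans p' p)

  knows-at-index : ∀ {h A i j f} → i ≡ j → Knows h A i f → Knows h A j f
  knows-at-index refl kn = kn

  -- What can be derived in b steps about formulas and paths of size below 2 ^ h.
  record Level (h b : ℕ) : Set where
    field
      closed   : Closed b (2 ^ h)
      transfer : ∀ u φs f → All Local φs → weight φs < 2 ^ h → Occurs u (fill φs f) → Transfer b u φs f
      lift     : ∀ A u φs f → weight φs < 2 ^ h → Occurs u (fill φs f) → Knows 2 A (u + offset φs) f → Knows b A u (fill φs f)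
  open Level

  climb-local : ∀ {h b t A u φs f} → Level h b → b ≤ t → All Local φs → weight φs < 2 ^ h → Occurs u (fill φs f) →
                Knows t A (u + offset φs) f → Knows (2 + t) A u (fill φs f)
  climb-local {u = u} {φs} {f} lv b≤t ls lt oc kn p v with lv .transfer u φs f ls lt oc p v
  ... | p' , v' , d = r-cut (kn p' v') (D-mono b≤t d)

  -- Under the lowest threshold operator `χ` one position at a time is carried up; at `χ` the
  -- interpolant becomes the hypothesis, and `lift` does the rest of the path. The 10 levels are 2
  -- for the cut below `χ`, 4 for the operator, 2 for its interval and 2 for the cut above.
  climb : ∀ {h b t A u} φs {f} → Level h b → b ≤ t → weight φs < 2 ^ h → Occurs u (fill φs f) →
          Knows t A (u + offset φs) f → Knows (10 + t) A u (fill φs f)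
  climb {h} {b} {t} {A} {u} φs {f} lv b≤t lt oc kn with lowest φs
  ... | inj₁ ls = knows-mono (+-monoˡ-≤ t (s≤s (s≤s z≤n))) (climb-local {φs = φs} lv b≤t ls lt oc kn)
  ... | inj₂ (o , αs , βs , refl , th , ls) = subst (Knows (10 + t) A u) (sym (fill-++ αs (unF o ∷ βs) f)) λ p v →
        r-cut (full .proj₂ .proj₁) (D-mono (≤-trans b≤t (m≤n+m t 8)) (lv .lift (full .proj₁) u αs χ lt-α oc-α (full .proj₂ .proj₂) p v))
    where
    χ : Fm k
    χ = un o (fill βs f)
    u' : ℕ
    u' = u + offset αs
    oc-α : Occurs u (fill αs χ)
    oc-α = subst (Occurs u) (fill-++ αs (unF o ∷ βs) f) oc
    oc-χ : Occurs u' χ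
    oc-χ = occurs-fill αs oc-α
    weights : weight αs + suc (weight βs) < 2 ^ h
    weights = ≤-<-trans (≤-reflexive (sym (weight-++ αs (unF o ∷ βs)))) lt
    lt-α : weight αs < 2 ^ h
    lt-α = ≤-<-trans (m≤m+n _ _) weights
    lt-β : weight βs < 2 ^ h
    lt-β = ≤-<-trans (≤-trans (n≤1+n _) (m≤n+m _ (weight αs))) weights
    index : u + offset (αs ++ unF o ∷ βs) ≡ suc u' + offset βs
    index = trans (cong (u +_) (offset-++ αs (unF o ∷ βs))) (trans (sym (+-assoc u (offset αs) _)) (+-suc u' (offset βs)))
    full : Interpolant (6 + t) A u' χ
    full = interpolate th oc-χ (knows-un {u = u'} {o} {fill βs f} oc-χ
      (climb-local {φs = βs} lv b≤t ls lt-β (occurs-un {u'} {o} oc-χ) (knows-at-index index kn)))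

  private
    twice : ∀ h → 2 ^ suc h ≡ 2 ^ h + 2 ^ h
    twice h = cong (2 ^ h +_) (+-identityʳ (2 ^ h))

    positive : ∀ h → 0 < 2 ^ h
    positive h = m^n>0 2 h

  -- A heavy path of weight below `2 ^ h` ends at a node with children of size below `2 ^ h`. The
  -- node costs 4 levels over its children, and climbing the path costs 10.
  closed-suc : ∀ {h b} → Level h b → Closed (14 + b) (2 ^ suc h)
  closed-suc {h} {b} lv A u f bA lt oc with heavy-path f {2 ^ h} {2 ^ h} (positive h) (<-≤-trans lt (≤-reflexive (twice h)))
  ... | φs , θ , refl , lt' , small-θ = climb φs lv (m≤n+m b 4) lt' oc (at-node θ small-θ (occurs-fill φs oc))
    where
    at-node : ∀ {i} θ → SmallChildren (2 ^ h) θ → Occurs i θ → Knows (4 + b) A i θ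
    at-node (at s p) _ oc = knows-mono (s≤s (s≤s (s≤s z≤n))) (knows-at bA oc)
    at-node {i} (un o f) lt oc = knows-un {u = i} {o} {f} oc (lv .closed A (suc i) f bA lt (occurs-un {i} {o} oc))
    at-node {i} (bin o f g) (lt , lt') oc = knows-mono (m≤n+m (2 + b) 2) (knows-bin {u = i} {o} {f} {g} oc
      (lv .closed A (suc i) f bA lt (occurs-left {i} {o} {f} {g} oc)) (lv .closed A (suc i + ∣ f ∣) g bA lt' (occurs-right {i} {o} {f} {g} oc)))

  sibling-closed : ∀ {b m A u} φ {f} → Closed b m → ItemBelow A → frameWeight φ < m → Occurs u (plug φ f) → Sibling (Knows b A) u φ f
  sibling-closed (unF o) cl bA lt oc = tt
  sibling-closed {u = u} (binL o g) {f} cl bA lt oc = cl _ (suc u + ∣ f ∣) g bA (<-trans ≤-refl lt) (occurs-right {u} {o} {f} {g} oc)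
  sibling-closed {u = u} (binR o g) {f} cl bA lt oc = cl _ (suc u) g bA (<-trans ≤-refl lt) (occurs-left {u} {o} {g} {f} oc)

  module Cut {h b : ℕ} (lv : Level h b) (u : ℕ) (αs : List (Frame k)) (φ : Frame k) (βs : List (Frame k)) (f : Fm k)
             (lt : weight (αs ++ φ ∷ βs) < 2 ^ suc h) (oc : Occurs u (fill (αs ++ φ ∷ βs) f)) where
    low-part node : Fm k
    low-part = fill βs f
    node     = plug φ low-part

    fill≡ : fill (αs ++ φ ∷ βs) f ≡ fill αs node
    fill≡ = fill-++ αs (φ ∷ βs) f

    u₁ u₂ : ℕ
    u₁ = u + offset αs
    u₂ = u₁ + frameOffset φ

    oc-top : Occurs u (fill αs node)
    oc-top = subst (Occurs u) fill≡ oc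

    oc-node : Occurs u₁ node
    oc-node = occurs-fill αs oc-top

    oc-low : Occurs u₂ low-part
    oc-low = occurs-plug φ oc-node

    index : u + offset (αs ++ φ ∷ βs) ≡ u₂ + offset βs
    index = trans (cong (u +_) (offset-++ αs (φ ∷ βs))) (trans (sym (+-assoc u (offset αs) _)) (sym (+-assoc u₁ (frameOffset φ) (offset βs))))

    φ-light : frameWeight φ < 2 ^ suc h
    φ-light = ≤-<-trans (≤-trans (m≤m+n (frameWeight φ) (weight βs))
      (≤-trans (m≤n+m _ (weight αs)) (≤-reflexive (sym (weight-++ αs (φ ∷ βs)))))) lt

    -- The frame at the cut may be heavier than half of the path. Its sibling is therefore taken
    -- from `closed-suc`, one level up, and not from `lv`.
    siblings : ∀ A → ItemBelow A → Sibling (Knows (14 + b) A) u₁ φ low-part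
    siblings A bA = sibling-closed φ (closed-suc lv) bA φ-light oc-node

  -- Two half paths are joined across the frame between them. That frame costs 4 on top of `14 + b`
  -- for its sibling, and each of the two cuts adds 2.
  transfer-suc : ∀ {h b} → Level h b → ∀ u φs f → All Local φs → weight φs < 2 ^ suc h → Occurs u (fill φs f) → Transfer (22 + b) u φs f
  transfer-suc {h} {b} lv u φs f ls lt oc p v with split-path φs (positive h) (positive h) (<-≤-trans lt (≤-reflexive (twice h)))
  ... | inj₁ refl = p , v , D-mono (m≤m+n 2 _) (subst (λ i → D 2 (claimAt i f p) (claimAt u f p)) (sym (+-identityʳ u)) (knows-self oc p v))
  ... | inj₂ (αs , φ , βs , refl , lt-α , lt-β) with Allₚ.++⁻ αs ls
  ...   | ls-α , l ∷ ls-β = p₃ .proj₁ , p₃ .proj₂ .proj₁ ,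
          subst₂ (λ i g → D (22 + b) (claimAt i f (p₃ .proj₁)) (claimAt u g p)) (sym index) (sym fill≡)
            (r-cut (r-cut (D-mono (m≤n+m b 18) (p₃ .proj₂ .proj₂)) (p₂ .proj₂ .proj₂)) (D-mono (m≤n+m b 20) (p₁ .proj₂ .proj₂)))
    where
    open Cut lv u αs φ βs f lt oc
    p₁ = lv .transfer u αs node ls-α lt-α oc-top p (subst (λ g → ValAt g p) fill≡ v)
    p₂ = transfer-plug φ {low-part} l (m≤m+n 2 _) oc-node siblings (p₁ .proj₁) (p₁ .proj₂ .proj₁)
    p₃ = lv .transfer u₂ βs f ls-β lt-β oc-low (p₂ .proj₁) (p₂ .proj₂ .proj₁)

  -- The lower half is lifted and passed through the frame at height `18 + b`. Since `lift` starts
  -- only from knowledge at height 2, the upper half is climbed instead, which renews that knowledge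
  -- by an interpolant and adds 10.
  lift-suc : ∀ {h b} → Level h b → ∀ A u φs f → weight φs < 2 ^ suc h → Occurs u (fill φs f) → Knows 2 A (u + offset φs) f → Knows (28 + b) A u (fill φs f)
  lift-suc {h} {b} lv A u φs f lt oc kn with split-path φs (positive h) (positive h) (<-≤-trans lt (≤-reflexive (twice h)))
  ... | inj₁ refl = knows-mono (m≤m+n 2 _) (knows-at-index (+-identityʳ u) kn)
  ... | inj₂ (αs , φ , βs , refl , lt-α , lt-β) = subst (Knows (28 + b) A u) (sym fill≡)
        (climb αs lv (m≤n+m b 18) lt-α oc-top
          (knows-plug φ oc-node (knows-mono (m≤n+m b 14) (lv .lift A u₂ βs f lt-β oc-low (knows-at-index index kn))) (siblings A (kn none tt .proj₁))))
    where open Cut lv u αs φ βs f lt oc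

  -- At `h = 0` only empty paths occur, and 2 is the height of an identity. After that each level
  -- adds the 28 of `lift-suc`, the largest of the three increments 14, 22 and 28.
  level : ∀ h → Level h (h * 28 + 2)
  level zero = record
    { closed   = λ A u f bA lt oc → contradiction (enc≥1 f) (<⇒≱ lt)
    ; transfer = λ { u [] f ls lt oc p v → p , v , subst (λ i → D 2 (claimAt i f p) (claimAt u f p)) (sym (+-identityʳ u)) (knows-self oc p v)
                   ; u (φ ∷ φs) f ls lt oc → contradiction (≤-trans (frameWeight≥1 φ) (m≤m+n _ _)) (<⇒≱ lt) }
    ; lift     = λ { A u [] f lt oc kn → knows-at-index (+-identityʳ u) kn
                   ; A u (φ ∷ φs) f lt oc kn → contradiction (≤-trans (frameWeight≥1 φ) (m≤m+n _ _)) (<⇒≱ lt) } }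
  level (suc h) = record
    { closed   = λ A u f bA lt oc → knows-mono (+-monoˡ-≤ _ (m≤m+n 14 14)) (closed-suc lv A u f bA lt oc)
    ; transfer = λ u φs f ls lt oc p v → map₂ (map₂ (D-mono (+-monoˡ-≤ _ (m≤m+n 22 6)))) (transfer-suc lv u φs f ls lt oc p v)
    ; lift     = lift-suc lv }
    where
    lv : Level h (h * 28 + 2)
    lv = level h

  derive : ∀ h A u f → ItemBelow A → ∣ f ∣ < 2 ^ h → Occurs u f → Val f 0 → D (h * 28 + 2) A (claim u f 0 1)
  derive h A u f bA lt oc v = level h .closed A u f bA lt oc (spot 0) (0<ℓ , v)

-- Acceptance of the root within the available layers

powE : ∀ {m} → Exp m → ℕ → Exp m
powE e zero    = lit 1
powE e (suc c) = e ⊗ powE e c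

eval-powE : ∀ {m} (e : Exp m) c env → eval (powE e c) env ≡ eval e env ^ c
eval-powE e zero    env = refl
eval-powE e (suc c) env = cong (eval e env *_) (eval-powE e c env)

power-between : ∀ n → ∃ λ h → n < 2 ^ h × 2 ^ h ≤ 2 + (n + n)
power-between zero    = 0 , s≤s z≤n , s≤s z≤n
power-between (suc n) with power-between n
... | h , lt , le with suc n <? 2 ^ h
...   | yes lt' = h , lt' , ≤-trans le (+-monoʳ-≤ 2 (+-mono-≤ (n≤1+n n) (n≤1+n n)))
...   | no ge   = suc h , ≤-trans (s≤s (≤-reflexive n≡)) (m<m+n (2 ^ h) (≤-trans (≤-trans (s≤s z≤n) lt) (m≤m+n _ 0))) ,
                  ≤-trans (≤-reflexive (cong (2 ^ h +_) (+-identityʳ (2 ^ h)))) (≤-trans (+-mono-≤ (≤-reflexive (sym n≡)) (≤-reflexive (sym n≡))) (m≤n+m _ 2))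
  where
  n≡ : suc n ≡ 2 ^ h
  n≡ = ≤-antisym lt (≮⇒≥ ge)

module RootComplete (topE : Exp 1) (w : List Bool) where
  open PathRules topE w
  open Soundness topE w using (sequent; root≡; small; input-small; sequent-below; sym-below; cell-below; cell-position)

  acc-raise : ∀ {h h' f} → h ≤ h' → Acc w h f → Acc w h' f
  acc-raise {h' = zero}   z≤n acc = acc
  acc-raise {h} {suc h'} le acc with m≤n⇒m<n∨m≡n le
  ... | inj₁ (s≤s lt) = acc-mono (acc-raise lt acc)
  ... | inj₂ refl     = acc

  -- The root and the goal stand above the sequent for the formula, which adds 2 to the height of
  -- its derivation.
  accept-root : ∀ {k m} (π : Trace k (suc m)) (φ : Formula k) → encInstance π φ ≡ w → Sat π 1 φ →
                ∀ h → n < 2 ^ h → Acc w (suc (suc (h * 28 + 2))) (root n)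
  accept-root {k} {m} π φ refl sat h n< = subst (Acc w _) (sym root≡)
    (or-node root-or (from-root (4q≡n , s≤s (s≤s z≤n) , s≤s (≤-trans (m≤m+n start ∣ f ∣) (≤-reflexive start+f)) , eqs-refl (goalV id k ℓ q)))
      goal-below (and-node (λ ()) goal-and λ {g} e _ → goals g e))
    where
    f : Fm k
    f = fromFormula φ
    ℓ q start b : ℕ
    ℓ = suc m
    start = suc (ℓ * suc k)
    b = h * 28 + 2
    σs : List Sym
    σs = encTrace π ++ sMid ∷ encFormula φ
    q = length σs
    encφ : encFormula φ ≡ enc f
    encφ = trans (cong encFormula (sym (to∘from φ))) (enc-toFormula f)
    4q≡n : 4 * q ≡ n
    4q≡n = sym (length-bitsOf σs)
    start+f : start + ∣ f ∣ ≡ q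
    start+f = sym (trans (length-++ (encTrace π)) (trans (cong₂ _+_ (length-encTrace {w} π) (cong suc (cong length encφ))) (+-suc (ℓ * suc k) ∣ f ∣)))
    q≤n : q ≤ n
    q≤n = ≤-trans (m≤n*m q 4) (≤-reflexive 4q≡n)
    start≤q : start ≤ q
    start≤q = ≤-trans (m≤m+n start ∣ f ∣) (≤-reflexive start+f)
    ℓk≤n : ℓ * suc k ≤ n
    ℓk≤n = ≤-trans (n≤1+n _) (≤-trans start≤q q≤n)
    k≤n : k ≤ n
    k≤n = ≤-trans (n≤1+n k) (≤-trans (m≤m+n (suc k) (m * suc k)) ℓk≤n)
    ℓ≤n : ℓ ≤ n
    ℓ≤n = ≤-trans (m≤m*n ℓ (suc k)) ℓk≤n
    halves = Match-++⁻ 0 (encTrace π) (match-bitsOf σs)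
    match-π : Match w 0 (encTrace π)
    match-π = halves .proj₁
    match-rest : Match w (ℓ * suc k) (sMid ∷ encFormula φ)
    match-rest = subst (λ i → Match w i (sMid ∷ encFormula φ)) (length-encTrace {w} π) (halves .proj₂)
    open Rules topE w k ℓ q q≤n ℓk≤n k≤n using (Occurs)
    occurs : Occurs start f
    occurs = subst (Match w start) encφ (match-rest .proj₂) , ≤-reflexive start+f
    holds : PathSemantics.Val w k ℓ f 0
    holds = PathSemantics.sat⇒ w k ℓ π (match-cell 0 π match-π) f (s≤s z≤n) (subst (Sat π 1) (sym (to∘from φ)) sat)
    derived : Acc w b (sequent k ℓ (item 0 0 0 0) (item start (start + ∣ f ∣) 0 1))
    derived = Balanced.derive topE w k ℓ q q≤n ℓk≤n k≤n (s≤s z≤n) h (item 0 0 0 0) start f (small 0 , small 0 , small 0 , small 0)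
                (≤-<-trans (≤-trans (m≤n+m ∣ f ∣ start) (≤-trans (≤-reflexive start+f) q≤n)) n<) occurs holds .proj₂ .proj₂
    2≤b : 2 ≤ b
    2≤b = m≤n+m 2 (h * 28)
    symbol : ∀ {u σ x} → SymAt w u σ → Acc w b (symV id u (symCode σ) x)
    symbol {u} {σ} {x} s = acc-raise (≤-trans (s≤s z≤n) 2≤b) (sym-complete {0} {u} {σ} {x} s)
    cell : ∀ {u x y} c → u < N n → SymAt w u (bitSym c) → Acc w b (cellV id u x y)
    cell {u} {x} {y} false bu s = acc-raise 2≤b (or-node cell-or (from-cell (inj₁ (eqs-refl (symV id u 0 0)))) (sym-below bu (small 0) (small 0)) (sym-complete {0} {u} {s0} {0} s))
    cell {u} {x} {y} true  bu s = acc-raise 2≤b (or-node cell-or (from-cell (inj₂ (eqs-refl (symV id u 1 0)))) (sym-below bu (small 1) (small 0)) (sym-complete {0} {u} {s1} {0} s))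
    goal-below : AllBelow (N n) (goalV id k ℓ q)
    goal-below = small 9 VAll.∷ input-small k≤n VAll.∷ input-small ℓ≤n VAll.∷ small 0 VAll.∷ small 0 VAll.∷ small 0 VAll.∷ small 0 VAll.∷
      input-small q≤n VAll.∷ small 0 VAll.∷ small 0 VAll.∷ small 0 VAll.∷ small 0 VAll.∷ small 0 VAll.∷ small 0 VAll.∷ small 0 VAll.∷ VAll.[]
    goals : ∀ g → EdgeFrom 9 (goalV id k ℓ q) g → Acc w b g
    goals g@(_ ∷ _ ∷ _ ∷ _ ∷ _ ∷ _ ∷ _ ∷ p ∷ _ ∷ _ ∷ _ ∷ x ∷ y ∷ _ ∷ _ ∷ []) (inj₁ (x< , y< , p≡ , eq)) =
      subst (Acc w b) (sym (eqs⇒ g (cellV id p x y) eq))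
        (cell (val π (suc x) (fromℕ< y<)) (input-small (≤-trans (≤-reflexive p≡) (≤-trans (<⇒≤ (cell-position x< (<⇒≤ y<))) ℓk≤n)))
          (subst (λ i → SymAt w i (bitSym (val π (suc x) (fromℕ< y<)))) (sym (trans p≡ (cong (x * suc k +_) (sym (toℕ-fromℕ< y<)))))
            (match-cell 0 π match-π (fromℕ< y<) x<)))
    goals g@(_ ∷ _ ∷ _ ∷ _ ∷ _ ∷ _ ∷ _ ∷ p ∷ _ ∷ _ ∷ _ ∷ x ∷ y ∷ _ ∷ _ ∷ []) (inj₂ (inj₁ (x< , p≡ , eq))) =
      subst (Acc w b) (sym (eqs⇒ g (symV id p 2 x) eq)) (symbol {σ = sRow} (subst (λ i → SymAt w i sRow) (sym p≡) (match-rowEnd 0 π match-π x<)))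
    goals g@(_ ∷ _ ∷ _ ∷ _ ∷ _ ∷ _ ∷ _ ∷ p ∷ _ ∷ _ ∷ _ ∷ x ∷ y ∷ _ ∷ _ ∷ []) (inj₂ (inj₂ (inj₁ eq))) =
      subst (Acc w b) (sym (eqs-eval g (symV lit (lit ℓ ⊗ (lit 1 ⊕ lit k)) (lit 3) (lit 0)) eq)) (symbol {σ = sMid} (match-rest .proj₁))
    goals g@(_ ∷ _ ∷ _ ∷ _ ∷ _ ∷ _ ∷ _ ∷ p ∷ _ ∷ _ ∷ _ ∷ x ∷ y ∷ _ ∷ _ ∷ []) (inj₂ (inj₂ (inj₂ eq))) =
      subst (Acc w b) (sym (trans (eqs-eval g (seqV lit (lit k) (lit ℓ) (lit 0) (lit 0) (lit 0) (lit 0) (lit 1 ⊕ lit ℓ ⊗ (lit 1 ⊕ lit k)) (lit q) (lit 0) (lit 1)) eq)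
        (cong (λ v → sequent k ℓ (item 0 0 0 0) (item start v 0 1)) (sym start+f)))) derived

power-bound : ∀ c d {e} h {B} → e ≡ c + d → 2 ^ h ≤ B → 2 ≤ B → 2 ^ (h * c + d) ≤ B ^ e
power-bound c d h {B} refl p q = ≤-trans (≤-reflexive (trans (^-distribˡ-+-* 2 (h * c) d) (cong (_* 2 ^ d) (sym (^-*-assoc 2 h c)))))
  (≤-trans (*-mono-≤ (^-monoˡ-≤ c p) (^-monoˡ-≤ d q)) (≤-reflexive (sym (^-distribˡ-+-* B c d))))

-- The height at the root is `28 * h + 4`: 28 for each doubling of the size, 2 at the bottom, 2 for
-- root and goal. A layer of at least `2 ^ (28 * h + 3)` admits one step more than its logarithm, so
-- 28 + 3 is enough.
opaque
  exponent : ℕ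
  exponent = 31

  exponent-def : exponent ≡ 28 + 3
  exponent-def = refl

-- Some 2 ^ h ≤ 2n + 2 exceeds n, so that this number is at least 2 raised to the 28h + 3 steps of a derivation.
topExp : Exp 1
topExp = powE (lit 2 ⊕ (var (# 0) ⊕ var (# 0))) exponent

topExp-bound : ∀ n h → 2 ^ h ≤ 2 + (n + n) → 2 ^ (h * 28 + 3) ≤ eval topExp (n ∷ [])
topExp-bound n h le = ≤-trans (power-bound 28 3 h exponent-def le (m≤m+n 2 (n + n)))
  (≤-reflexive (sym (eval-powE (lit 2 ⊕ (var (# 0) ⊕ var (# 0))) exponent (n ∷ []))))

theorem5 : InAC¹ UTL-PathChecking
theorem5 = Realise.inAC¹ pathGraph topExp complete (λ w → Soundness.sound topExp w)
  where
  complete : ∀ w → UTL-PathChecking w → ∃ λ h → 2 ^ h ≤ Unroll.top pathGraph topExp (length w) ×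
             Unroll.Acc pathGraph topExp w (suc h) (Unroll.root pathGraph topExp (length w))
  complete w (k , m , π , φ , e , sat) with power-between (length w)
  ... | h , n< , le = suc (h * 28 + 2) ,
        subst (λ i → 2 ^ i ≤ eval topExp (length w ∷ [])) (+-suc (h * 28) 2) (topExp-bound (length w) h le) ,
        RootComplete.accept-root topExp w π φ e sat h n<
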